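{- Let $k,N\ge1$ be integers, let $X_1,\dots,X_k$ be pairwise disjoint finite sets with $|X_i|=n_i\ge2$, and let $V_i\cong\mathbb C^{n_i}$ be the fundamental representation of $\mathrm{GL}(n_i)$. Let $P_N(\mathbf x)=\sum_{f\in\mathrm{EC}(N)}w(f)$ be the generating polynomial of eventually $N$-cyclic $k$-tuples on $X_1,\dots,X_k$. Then $$P_N(\mathbf x)=(N!)^{k-1}(N-1)!\;\chi\!\left(\bigotimes_{i=1}^k\left(V_i^{\otimes(n_{i-1}-N)}\otimes\Lambda^NV_i\right)-(N+1)^k\bigotimes_{i=1}^k\left(V_i^{\otimes(n_{i-1}-(N+1))}\otimes\Lambda^{N+1}V_i\right)\right),$$ where indices are taken modulo $k$.
   Context: Indices are modulo $k$, so $X_{k+1}=X_1$ and $n_0=n_k$. A $k$-tuple $f=(f_1,\dots,f_k)$ with $f_i:X_i\to X_{i+1}$ is eventually $N$-cyclic if the iterated images $(f_k\cdots f_1)^m(X_1)$ eventually stabilize (for large $m$) to a subset of $X_1$ of cardinality $N$ on which $f_k\cdots f_1$ acts as an $N$-cycle (a single cyclic permutation of all $N$ elements); $\mathrm{EC}(N)$ is the set of these. There is one commuting variable $x_v$ for each $v\in\bigsqcup_iX_i$, and $w(f)=\prod_{i=1}^k\prod_{v\in X_i}x_{f_i(v)}$. Let $G=\prod_{i=1}^k\mathrm{GL}(n_i)$; each $V_i$ is regarded as a representation of $G$ through the projection $G\to\mathrm{GL}(n_i)$. For a representation $W$ of $G$, $\chi(W)$ is its character as a function of $\mathbf x=(x_v)$: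 the trace on $W$ of $(\mathrm{diag}(x_v)_{v\in X_1},\dots,\mathrm{diag}(x_v)_{v\in X_k})$; $\chi$ is extended additively to formal integer combinations (virtual representations). A tensor product $\bigotimes_i$ containing a factor $\Lambda^rV_j$ with $r>n_j$ (so $\Lambda^rV_j=0$) is read as $0$, even if another factor carries a formally negative tensor exponent. -}

module Defs where

open import Algebra.Bundles using (CommutativeRing; Group)
open import Algebra.Module.Bundles using (LeftModule)
open import Algebra.Module.Morphism.Structures using (module LeftModuleMorphisms)
import Algebra.Module.Construct.TensorUnit as TensorUnit
import Algebra.Properties.Monoid.Mult as Mult
import Algebra.Properties.CommutativeMonoid.Sum as Sum
open import Data.Fin.Base using (Fin; zero; suc; toℕ; finToFun; funToFin)
import Data.Fin.Properties as Fin
open import Data.Integer.Base using (ℤ; +_; -[1+_]; -1ℤ; 1ℤ) renaming (_*_ to _*ℤ_)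
open import Data.List.Base using (List; []; _∷_; _++_; map; foldr; filter; allFin; cartesianProductWith)
open import Data.Nat.Base using (ℕ; zero; suc; _≤_; NonZero) renaming (_+_ to _+ℕ_; _*_ to _*ℕ_; _∸_ to _∸ℕ_; _^_ to _^ℕ_)
import Data.Nat.Properties as ℕ
open import Data.Nat.DivMod using (_mod_; _%_; m%n<n; %-distribˡ-+; m%n%n≡m%n; [m+n]%n≡m%n; m<n⇒m%n≡m)
open import Data.Nat.GeneralisedArithmetic using (fold; fold-+)
open import Data.Product.Base using (Σ; ∃; _×_; _,_; proj₁; proj₂; map₁; map₂)
open import Function.Base using (_∘_; id)
open import Function.Bundles using (_⇔_; mk⇔; Equivalence)
open import Function.Definitions using (Injective)
open import Level using () renaming (suc to ℓsuc)
open import Relation.Binary.PropositionalEquality using (_≡_; _≢_; refl; sym; trans; cong; subst; module ≡-Reasoning)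
open import Relation.Nullary.Decidable using (Dec; map′; _×-dec_; _→-dec_)

private
  variable
    p : ℕ

-- i + 1 and i - 1 modulo k, on the representatives 0, …, k - 1.
next : ∀ {k} → Fin k → Fin k
next {suc m} i = suc (toℕ i) mod suc m

prev : ∀ {k} → Fin k → Fin k
prev {suc m} i = (toℕ i +ℕ m) mod suc m

first : ∀ {k} .{{_ : NonZero k}} → Fin k
first {k} = 0 mod k

private
  toℕ-mod : ∀ a d .{{_ : NonZero d}} → toℕ (a mod d) ≡ a % d
  toℕ-mod a d = Fin.toℕ-fromℕ< (m%n<n a d)

  suc-% : ∀ a d .{{_ : NonZero d}} → suc (a % d) % d ≡ suc a % d
  suc-% a d = begin
    (1 +ℕ a % d) % d               ≡⟨ %-distribˡ-+ 1 (a % d) d ⟩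
    (1 % d +ℕ a % d % d) % d       ≡⟨ cong (λ b → (1 % d +ℕ b) % d) (m%n%n≡m%n a d) ⟩
    (1 % d +ℕ a % d) % d           ≡⟨ sym (%-distribˡ-+ 1 a d) ⟩
    (1 +ℕ a) % d                   ∎
    where open ≡-Reasoning

  fin-%≡ : ∀ {m} (i : Fin (suc m)) → (toℕ i +ℕ suc m) % suc m ≡ toℕ i
  fin-%≡ {m} i = trans ([m+n]%n≡m%n (toℕ i) (suc m)) (m<n⇒m%n≡m (Fin.toℕ<n i))

  next-prev : ∀ {k} (i : Fin k) → next (prev i) ≡ i
  next-prev {suc m} i = Fin.toℕ-injective (begin
    toℕ (next (prev i))                        ≡⟨ toℕ-mod (suc (toℕ (prev i))) (suc m) ⟩
    suc (toℕ (prev i)) % suc m                 ≡⟨ cong (λ b → suc b % suc m) (toℕ-mod (toℕ i +ℕ m) (suc m)) ⟩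
    suc ((toℕ i +ℕ m) % suc m) % suc m         ≡⟨ suc-% (toℕ i +ℕ m) (suc m) ⟩
    suc (toℕ i +ℕ m) % suc m                   ≡⟨ cong (_% suc m) (sym (ℕ.+-suc (toℕ i) m)) ⟩
    (toℕ i +ℕ suc m) % suc m                   ≡⟨ fin-%≡ i ⟩
    toℕ i                                      ∎)
    where open ≡-Reasoning

  toℕ-next^ : ∀ {m} (i : Fin (suc m)) j → toℕ (fold i next j) ≡ (toℕ i +ℕ j) % suc m
  toℕ-next^ {m} i zero = sym (trans (cong (_% suc m) (ℕ.+-identityʳ (toℕ i))) (m<n⇒m%n≡m (Fin.toℕ<n i)))
  toℕ-next^ {m} i (suc j) = begin
    toℕ (next (fold i next j))              ≡⟨ toℕ-mod (suc (toℕ (fold i next j))) (suc m) ⟩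
    suc (toℕ (fold i next j)) % suc m       ≡⟨ cong (λ b → suc b % suc m) (toℕ-next^ i j) ⟩
    suc ((toℕ i +ℕ j) % suc m) % suc m      ≡⟨ suc-% (toℕ i +ℕ j) (suc m) ⟩
    suc (toℕ i +ℕ j) % suc m                ≡⟨ cong (_% suc m) (sym (ℕ.+-suc (toℕ i) j)) ⟩
    (toℕ i +ℕ suc j) % suc m                ∎
    where open ≡-Reasoning

next^k : ∀ {k} (i : Fin k) → fold i next k ≡ i
next^k {suc m} i = Fin.toℕ-injective (trans (toℕ-next^ i (suc m)) (fin-%≡ i))

-- The set X i is Fin (n i); the disjoint union of the X i is Σ (Fin k) (Fin ∘ n).
Tuple : ∀ {k} → (Fin k → ℕ) → Set
Tuple n = ∀ i → Fin (n i) → Fin (n (next i))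

module _ {k} {n : Fin k → ℕ} (f : Tuple n) where

  walk : ∀ i j → Fin (n i) → Fin (n (fold i next j))
  walk i zero    v = v
  walk i (suc j) v = f (fold i next j) (walk i j v)

  -- f_k ⋯ f_1 : X_1 → X_1
  composite : .{{_ : NonZero k}} → Fin (n first) → Fin (n first)
  composite v = subst (Fin ∘ n) (next^k first) (walk first k v)

-- The limit subset is given by listing it, without repetition, along the cycle.
EventuallyCycle : ℕ → (Fin p → Fin p) → Set
EventuallyCycle {p} N F = ∃ λ (c : Fin N → Fin p) →
  Injective _≡_ _≡_ c ×
  (∀ j → F (c j) ≡ c (next j)) ×
  (∃ λ M → ∀ m → M ≤ m → ∀ v → (∃ λ u → fold u F m ≡ v) ⇔ (∃ λ j → c j ≡ v))

EC : ∀ {k} .{{_ : NonZero k}} {n : Fin k → ℕ} → ℕ → Tuple n → Set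
EC N f = EventuallyCycle N (composite f)

private
  module Decide (N : ℕ) (F : Fin p → Fin p) where

    -- p iterations are enough to reach the limit subset.
    Cycle : (Fin N → Fin p) → Set
    Cycle c = (∀ i j → c i ≡ c j → i ≡ j) ×
              (∀ j → F (c j) ≡ c (next j)) ×
              (∀ u → ∃ λ j → c j ≡ fold u F p)

    cycle? : ∀ c → Dec (Cycle c)
    cycle? c =
      Fin.all? (λ i → Fin.all? λ j → (c i Fin.≟ c j) →-dec (i Fin.≟ j)) ×-dec
      Fin.all? (λ j → F (c j) Fin.≟ c (next j)) ×-dec
      Fin.all? (λ u → Fin.any? λ j → c j Fin.≟ fold u F p)

    Cycle-resp : ∀ {c d} → (∀ j → c j ≡ d j) → Cycle c → Cycle d
    Cycle-resp e (inj , cyc , reach) =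
      (λ i j q → inj i j (trans (e i) (trans q (sym (e j))))) ,
      (λ j → trans (cong F (sym (e j))) (trans (cyc j) (e (next j)))) ,
      (λ u → map₂ (λ {j} q → trans (sym (e j)) q) (reach u))

    any-cycle? : Dec (∃ Cycle)
    any-cycle? = map′
      (λ (a , q) → finToFun a , q)
      (λ (c , q) → funToFin c , Cycle-resp (λ j → sym (Fin.finToFun-funToFin c j)) q)
      (Fin.any? (λ a → cycle? (finToFun a)))

    back : ∀ {c : Fin N → Fin p} → (∀ j → F (c j) ≡ c (next j)) → ∀ m j → ∃ λ u → fold u F m ≡ c j
    back {c} cyc zero    j = c j , refl
    back {c} cyc (suc m) j with back {c} cyc m (prev j)
    ... | u , q = u , trans (cong F q) (trans (cyc (prev j)) (cong c (next-prev j)))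

    sound : ∃ Cycle → EventuallyCycle N F
    sound (c , inj , cyc , reach) = c , (λ {i} {j} → inj i j) , cyc , p , λ m p≤m v → mk⇔
      (λ (u , q) → map₂ (λ e → trans e (trans
          (trans (sym (fold-+ u F p)) (cong (fold u F) (ℕ.m+[n∸m]≡n p≤m))) q))
        (reach (fold u F (m ∸ℕ p))))
      (λ (j , q) → map₂ (λ e → trans e q) (back {c} cyc m j))

    -- Once the orbit of u repeats, it is periodic.
    shift : ∀ {u} i d → fold u F i ≡ fold u F (i +ℕ d) →
            ∀ m → i ≤ m → ∀ q → fold u F m ≡ fold u F (q *ℕ d +ℕ m)
    shift {u} i d e m i≤m zero    = refl
    shift {u} i d e m i≤m (suc q) = begin
      fold u F m                                ≡⟨ cong (fold u F) (sym (ℕ.m∸n+n≡m i≤m)) ⟩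
      fold u F (m ∸ℕ i +ℕ i)                    ≡⟨ fold-+ u F (m ∸ℕ i) ⟩
      fold (fold u F i) F (m ∸ℕ i)              ≡⟨ cong (λ v → fold v F (m ∸ℕ i)) e ⟩
      fold (fold u F (i +ℕ d)) F (m ∸ℕ i)       ≡⟨ sym (fold-+ u F (m ∸ℕ i)) ⟩
      fold u F (m ∸ℕ i +ℕ (i +ℕ d))             ≡⟨ cong (fold u F) (sym (ℕ.+-assoc (m ∸ℕ i) i d)) ⟩
      fold u F (m ∸ℕ i +ℕ i +ℕ d)               ≡⟨ cong (λ b → fold u F (b +ℕ d)) (ℕ.m∸n+n≡m i≤m) ⟩
      fold u F (m +ℕ d)                         ≡⟨ shift i d e (m +ℕ d) (ℕ.≤-trans i≤m (ℕ.m≤m+n m d)) q ⟩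
      fold u F (q *ℕ d +ℕ (m +ℕ d))             ≡⟨ cong (fold u F) (trans (cong (q *ℕ d +ℕ_) (ℕ.+-comm m d)) (trans (sym (ℕ.+-assoc (q *ℕ d) d m)) (cong (_+ℕ m) (ℕ.+-comm (q *ℕ d) d)))) ⟩
      fold u F (d +ℕ q *ℕ d +ℕ m)               ∎
      where open ≡-Reasoning

    complete : EventuallyCycle N F → ∃ Cycle
    complete (c , inj , cyc , M , stable) = c , (λ i j → inj) , cyc , reach
      where
      reach : ∀ u → ∃ λ j → c j ≡ fold u F p
      reach u with Fin.pigeonhole (ℕ.n<1+n p) (λ i → fold u F (toℕ i))
      ... | i , j , i<j , e
        with d ← toℕ j ∸ℕ toℕ i in d≡ | i≤p ← ℕ.≤-pred (Fin.toℕ<n i) =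
        Equivalence.to (stable (M *ℕ d +ℕ p) M≤ (fold u F p))
          (u , sym (shift (toℕ i) d (trans e (cong (fold u F) j≡)) p i≤p M))
        where
        j≡ : toℕ j ≡ toℕ i +ℕ d
        j≡ = trans (sym (ℕ.m+[n∸m]≡n (ℕ.<⇒≤ i<j))) (cong (toℕ i +ℕ_) d≡)
        d>0 : 1 ≤ d
        d>0 = subst (1 ≤_) d≡ (ℕ.m<n⇒0<n∸m i<j)
        M≤ : M ≤ M *ℕ d +ℕ p
        M≤ = ℕ.≤-trans (subst (_≤ M *ℕ d) (ℕ.*-identityʳ M) (ℕ.*-monoʳ-≤ M d>0)) (ℕ.m≤m+n (M *ℕ d) p)

eventuallyCycle? : ∀ N (F : Fin p → Fin p) → Dec (EventuallyCycle N F)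
eventuallyCycle? N F = map′ sound complete any-cycle?
  where open Decide N F

EC? : ∀ {k} .{{_ : NonZero k}} {n : Fin k → ℕ} N (f : Tuple n) → Dec (EC N f)
EC? N f = eventuallyCycle? N (composite f)

-- If every A i is listed by as i, then the dependent functions are listed here,
-- each exactly once up to pointwise equality.
functions : ∀ {k} {A : Fin k → Set} → (∀ i → List (A i)) → List (∀ i → A i)
functions {zero}      as = (λ ()) ∷ []
functions {suc k} {A} as = cartesianProductWith cons (as zero) (functions (as ∘ suc))
  where
  cons : A zero → (∀ i → A (suc i)) → ∀ i → A i
  cons a g zero    = a
  cons a g (suc i) = g i

tuples : ∀ {k} (n : Fin k → ℕ) → List (Tuple n)
tuples n = functions (λ i → functions (λ _ → allFin (n (next i))))

module Characters {a} (K : CommutativeRing a a) where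

  open CommutativeRing K using
    ( Carrier; _≈_; _+_; _*_; -_; 0#; 1#; ring; +-commutativeMonoid; *-commutativeMonoid; +-monoid
    ; +-isCommutativeMonoid; *-cong; +-cong; -‿cong; -‿inverse; *-assoc; *-comm; *-identityˡ
    ; distribˡ; distribʳ; zeroˡ; zeroʳ)
    renaming (refl to ≈-refl; sym to ≈-sym; trans to ≈-trans; isEquivalence to ≈-isEquivalence)
  private
    module ∑ = Sum +-commutativeMonoid
    module ∏ = Sum *-commutativeMonoid
  open Mult +-monoid using () renaming (_×_ to _×ℕ_) public

  _×ℤ_ : ℤ → Carrier → Carrier
  (+ m)    ×ℤ x = m ×ℕ x
  -[1+ m ] ×ℤ x = - (suc m ×ℕ x)

  weight : ∀ {k} {n : Fin k → ℕ} → (∀ i → Fin (n i) → Carrier) → Tuple n → Carrier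
  weight x f = ∏.sum (λ i → ∏.sum (λ v → x (next i) (f i v)))

  P : ∀ {k} .{{_ : NonZero k}} {n : Fin k → ℕ} → ℕ → (∀ i → Fin (n i) → Carrier) → Carrier
  P {n = n} N x = foldr _+_ 0# (map (weight x) (filter (EC? N) (tuples n)))

  Mod : Set (ℓsuc a)
  Mod = LeftModule ring a a

  module _ (M M′ : Mod) where
    open LeftModuleMorphisms (LeftModule.rawLeftModule M) (LeftModule.rawLeftModule M′) public
      using () renaming (IsLeftModuleHomomorphism to IsLinear)

  infix 30 K^_
  K^_ : ℕ → Mod
  K^ d = record
    { Carrierᴹ = Fin d → Carrier
    ; _≈ᴹ_ = λ u v → ∀ i → u i ≈ v i
    ; _+ᴹ_ = λ u v i → u i + v i
    ; _*ₗ_ = λ r v i → r * v i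
    ; 0ᴹ = λ _ → 0#
    ; -ᴹ_ = λ v i → - v i
    ; isLeftModule = record
      { isLeftSemimodule = record
        { +ᴹ-isCommutativeMonoid = record
          { isMonoid = record
            { isSemigroup = record
              { isMagma = record
                { isEquivalence = record
                  { refl = λ _ → ≈-refl
                  ; sym = λ e i → ≈-sym (e i)
                  ; trans = λ e e′ i → ≈-trans (e i) (e′ i)
                  }
                ; ∙-cong = λ e e′ i → +-cong (e i) (e′ i)
                }
              ; assoc = λ u v w i → CommutativeRing.+-assoc K (u i) (v i) (w i)
              }
            ; identity = (λ v i → CommutativeRing.+-identityˡ K (v i))
                       , (λ v i → CommutativeRing.+-identityʳ K (v i))
            }
          ; comm = λ u v i → CommutativeRing.+-comm K (u i) (v i)
          }
        ; isPreleftSemimodule = record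
          { *ₗ-cong = λ e e′ i → *-cong e (e′ i)
          ; *ₗ-zeroˡ = λ v i → zeroˡ (v i)
          ; *ₗ-distribʳ = λ v r s i → distribʳ (v i) r s
          ; *ₗ-identityˡ = λ v i → *-identityˡ (v i)
          ; *ₗ-assoc = λ r s v i → *-assoc r s (v i)
          ; *ₗ-zeroʳ = λ r i → zeroʳ r
          ; *ₗ-distribˡ = λ r u v i → distribˡ r (u i) (v i)
          }
        }
      ; -ᴹ‿cong = λ e i → -‿cong (e i)
      ; -ᴹ‿inverse = (λ v i → proj₁ -‿inverse (v i)) , (λ v i → proj₂ -‿inverse (v i))
      }
    }

  module _ (M M′ : Mod) where
    private
      module M = LeftModule M
      module M′ = LeftModule M′

    mkLinear : (φ : M.Carrierᴹ → M′.Carrierᴹ) →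
      (∀ {u v} → u M.≈ᴹ v → φ u M′.≈ᴹ φ v) →
      (∀ u v → φ (u M.+ᴹ v) M′.≈ᴹ φ u M′.+ᴹ φ v) →
      φ M.0ᴹ M′.≈ᴹ M′.0ᴹ →
      (∀ v → φ (M.-ᴹ v) M′.≈ᴹ M′.-ᴹ φ v) →
      (∀ r v → φ (r M.*ₗ v) M′.≈ᴹ r M′.*ₗ φ v) →
      IsLinear M M′ φ
    mkLinear φ cong +-homo 0-homo neg-homo *-homo = record
      { +ᴹ-isGroupHomomorphism = record
        { isMonoidHomomorphism = record
          { isMagmaHomomorphism = record
            { isRelHomomorphism = record { cong = cong }
            ; homo = +-homo
            }
          ; ε-homo = 0-homo
          }
        ; ⁻¹-homo = neg-homo
        }
      ; *ₗ-homo = *-homo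
      }

  id-linear : ∀ M → IsLinear M M id
  id-linear M = mkLinear M M id id (λ _ _ → ≈ᴹ-refl) ≈ᴹ-refl (λ _ → ≈ᴹ-refl) (λ _ _ → ≈ᴹ-refl)
    where open LeftModule M

  ∘-linear : ∀ M {φ ψ} → IsLinear M M φ → IsLinear M M ψ → IsLinear M M (φ ∘ ψ)
  ∘-linear M {φ} {ψ} l l′ = mkLinear M M (φ ∘ ψ)
    (λ e → φ′.⟦⟧-cong (ψ′.⟦⟧-cong e))
    (λ u v → ≈ᴹ-trans (φ′.⟦⟧-cong (ψ′.+ᴹ-homo u v)) (φ′.+ᴹ-homo (ψ u) (ψ v)))
    (≈ᴹ-trans (φ′.⟦⟧-cong ψ′.0ᴹ-homo) φ′.0ᴹ-homo)
    (λ v → ≈ᴹ-trans (φ′.⟦⟧-cong (ψ′.-ᴹ-homo v)) (φ′.-ᴹ-homo (ψ v)))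
    (λ r v → ≈ᴹ-trans (φ′.⟦⟧-cong (ψ′.*ₗ-homo r v)) (φ′.*ₗ-homo r (ψ v)))
    where
    open LeftModule M
    module φ′ = LeftModuleMorphisms.IsLeftModuleHomomorphism l
    module ψ′ = LeftModuleMorphisms.IsLeftModuleHomomorphism l′

  module _ (M : Mod) where
    open LeftModule M
    private module ∑ᴹ = Sum +ᴹ-commutativeMonoid

    combination : ∀ {d} → (Fin d → Carrier) → (Fin d → Carrierᴹ) → Carrierᴹ
    combination r b = ∑ᴹ.sum (λ i → r i *ₗ b i)

    record IsBasis {d} (b : Fin d → Carrierᴹ) : Set a where
      field
        coordinates : Carrierᴹ → Fin d → Carrier
        expansion   : ∀ v → combination (coordinates v) b ≈ᴹ v
        unique      : ∀ v r → combination r b ≈ᴹ v → ∀ i → r i ≈ coordinates v i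

    -- t is the trace of φ: the sum of the diagonal entries of the matrix of φ
    -- in some finite basis.
    IsTrace : (Carrierᴹ → Carrierᴹ) → Carrier → Set a
    IsTrace φ t = ∃ λ d → ∃ λ (b : Fin d → Carrierᴹ) → Σ (IsBasis b) λ B →
      t ≈ ∑.sum (λ i → IsBasis.coordinates B (φ (b i)) i)

  infixl 6 _⊕_
  infixr 7 _⊙_

  data Term (X : Set a) : Set a where
    gen : X → Term X
    𝟘   : Term X
    _⊕_ : Term X → Term X → Term X
    _⊙_ : Carrier → Term X → Term X

  mapTerm : ∀ {X Y : Set a} → (X → Y) → Term X → Term Y
  mapTerm h (gen x) = gen (h x)
  mapTerm h 𝟘       = 𝟘
  mapTerm h (t ⊕ u) = mapTerm h t ⊕ mapTerm h u
  mapTerm h (r ⊙ t) = r ⊙ mapTerm h t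

  module Presented {X : Set a} (R : Term X → Term X → Set a) where

    infix 4 _∼_
    data _∼_ : Term X → Term X → Set a where
      relation : ∀ {t u} → R t u → t ∼ u
      ∼-refl   : ∀ {t} → t ∼ t
      ∼-sym    : ∀ {t u} → t ∼ u → u ∼ t
      ∼-trans  : ∀ {t u v} → t ∼ u → u ∼ v → t ∼ v
      ⊕-cong   : ∀ {t t′ u u′} → t ∼ t′ → u ∼ u′ → t ⊕ u ∼ t′ ⊕ u′
      ⊙-cong   : ∀ {r r′ t t′} → r ≈ r′ → t ∼ t′ → r ⊙ t ∼ r′ ⊙ t′
      ⊕-assoc  : ∀ t u v → (t ⊕ u) ⊕ v ∼ t ⊕ (u ⊕ v)
      ⊕-comm   : ∀ t u → t ⊕ u ∼ u ⊕ t
      ⊕-idˡ    : ∀ t → 𝟘 ⊕ t ∼ t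
      ⊙-distʳ  : ∀ t r s → (r + s) ⊙ t ∼ r ⊙ t ⊕ s ⊙ t
      ⊙-distˡ  : ∀ r t u → r ⊙ (t ⊕ u) ∼ r ⊙ t ⊕ r ⊙ u
      ⊙-assoc  : ∀ r s t → (r * s) ⊙ t ∼ r ⊙ s ⊙ t
      ⊙-idˡ    : ∀ t → 1# ⊙ t ∼ t
      ⊙-zeroˡ  : ∀ t → 0# ⊙ t ∼ 𝟘

    private
      ⊙-zeroʳ : ∀ r → r ⊙ 𝟘 ∼ 𝟘
      ⊙-zeroʳ r = ∼-trans (⊙-cong ≈-refl (∼-sym (⊙-zeroˡ 𝟘))) (∼-trans (∼-sym (⊙-assoc r 0# 𝟘))
        (∼-trans (⊙-cong (zeroʳ r) ∼-refl) (⊙-zeroˡ 𝟘)))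

      inverseʳ : ∀ t → t ⊕ (- 1#) ⊙ t ∼ 𝟘
      inverseʳ t = ∼-trans (⊕-cong (∼-sym (⊙-idˡ t)) ∼-refl) (∼-trans (∼-sym (⊙-distʳ t 1# (- 1#)))
        (∼-trans (⊙-cong (proj₂ -‿inverse 1#) ∼-refl) (⊙-zeroˡ t)))

    presented : Mod
    presented = record
      { Carrierᴹ = Term X
      ; _≈ᴹ_ = _∼_
      ; _+ᴹ_ = _⊕_
      ; _*ₗ_ = _⊙_
      ; 0ᴹ = 𝟘
      ; -ᴹ_ = (- 1#) ⊙_
      ; isLeftModule = record
        { isLeftSemimodule = record
          { +ᴹ-isCommutativeMonoid = record
            { isMonoid = record
              { isSemigroup = record
                { isMagma = record
                  { isEquivalence = record { refl = ∼-refl ; sym = ∼-sym ; trans = ∼-trans }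
                  ; ∙-cong = ⊕-cong
                  }
                ; assoc = ⊕-assoc
                }
              ; identity = ⊕-idˡ , (λ t → ∼-trans (⊕-comm t 𝟘) (⊕-idˡ t))
              }
            ; comm = ⊕-comm
            }
          ; isPreleftSemimodule = record
            { *ₗ-cong = ⊙-cong
            ; *ₗ-zeroˡ = ⊙-zeroˡ
            ; *ₗ-distribʳ = ⊙-distʳ
            ; *ₗ-identityˡ = ⊙-idˡ
            ; *ₗ-assoc = ⊙-assoc
            ; *ₗ-zeroʳ = ⊙-zeroʳ
            ; *ₗ-distribˡ = ⊙-distˡ
            }
          }
        ; -ᴹ‿cong = ⊙-cong ≈-refl
        ; -ᴹ‿inverse = (λ t → ∼-trans (⊕-comm _ t) (inverseʳ t)) , inverseʳ
        }
      }

    mapTerm-∼ : ∀ {h : X → X} → (∀ {t u} → R t u → mapTerm h t ∼ mapTerm h u) →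
                ∀ {t u} → t ∼ u → mapTerm h t ∼ mapTerm h u
    mapTerm-∼ p (relation q)    = p q
    mapTerm-∼ p ∼-refl          = ∼-refl
    mapTerm-∼ p (∼-sym e)       = ∼-sym (mapTerm-∼ p e)
    mapTerm-∼ p (∼-trans e e′)  = ∼-trans (mapTerm-∼ p e) (mapTerm-∼ p e′)
    mapTerm-∼ p (⊕-cong e e′)   = ⊕-cong (mapTerm-∼ p e) (mapTerm-∼ p e′)
    mapTerm-∼ p (⊙-cong e e′)   = ⊙-cong e (mapTerm-∼ p e′)
    mapTerm-∼ p (⊕-assoc t u v) = ⊕-assoc _ _ _
    mapTerm-∼ p (⊕-comm t u)    = ⊕-comm _ _
    mapTerm-∼ p (⊕-idˡ t)       = ⊕-idˡ _
    mapTerm-∼ p (⊙-distʳ t r s) = ⊙-distʳ _ r s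
    mapTerm-∼ p (⊙-distˡ r t u) = ⊙-distˡ r _ _
    mapTerm-∼ p (⊙-assoc r s t) = ⊙-assoc r s _
    mapTerm-∼ p (⊙-idˡ t)       = ⊙-idˡ _
    mapTerm-∼ p (⊙-zeroˡ t)     = ⊙-zeroˡ _

    mapTerm-linear : ∀ {h : X → X} → (∀ {t u} → R t u → mapTerm h t ∼ mapTerm h u) →
                     IsLinear presented presented (mapTerm h)
    mapTerm-linear {h} p = mkLinear presented presented (mapTerm h) (mapTerm-∼ p)
      (λ _ _ → ∼-refl) ∼-refl (λ _ → ∼-refl) (λ _ _ → ∼-refl)

    mapTerm-≗ : ∀ {h h′ : X → X} → (∀ x → gen (h x) ∼ gen (h′ x)) → ∀ t → mapTerm h t ∼ mapTerm h′ t
    mapTerm-≗ q (gen x) = q x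
    mapTerm-≗ q 𝟘       = ∼-refl
    mapTerm-≗ q (t ⊕ u) = ⊕-cong (mapTerm-≗ q t) (mapTerm-≗ q u)
    mapTerm-≗ q (r ⊙ t) = ⊙-cong ≈-refl (mapTerm-≗ q t)

    mapTerm-id : ∀ {h : X → X} → (∀ x → gen (h x) ∼ gen x) → ∀ t → mapTerm h t ∼ t
    mapTerm-id q (gen x) = q x
    mapTerm-id q 𝟘       = ∼-refl
    mapTerm-id q (t ⊕ u) = ⊕-cong (mapTerm-id q t) (mapTerm-id q u)
    mapTerm-id q (r ⊙ t) = ⊙-cong ≈-refl (mapTerm-id q t)

    mapTerm-∘ : ∀ {h h₁ h₂ : X → X} → (∀ x → gen (h x) ∼ gen (h₁ (h₂ x))) →
                ∀ t → mapTerm h t ∼ mapTerm h₁ (mapTerm h₂ t)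
    mapTerm-∘ q (gen x) = q x
    mapTerm-∘ q 𝟘       = ∼-refl
    mapTerm-∘ q (t ⊕ u) = ⊕-cong (mapTerm-∘ q t) (mapTerm-∘ q u)
    mapTerm-∘ q (r ⊙ t) = ⊙-cong ≈-refl (mapTerm-∘ q t)

  record Rep (G : Group a a) : Set (ℓsuc a) where
    private module G = Group G
    field
      space : Mod
    open LeftModule space public
    field
      act        : G.Carrier → Carrierᴹ → Carrierᴹ
      act-linear : ∀ g → IsLinear space space (act g)
      act-cong   : ∀ {g h} → g G.≈ h → ∀ v → act g v ≈ᴹ act h v
      act-ε      : ∀ v → act G.ε v ≈ᴹ v
      act-∙      : ∀ g h v → act (g G.∙ h) v ≈ᴹ act g (act h v)

    module Linear g = LeftModuleMorphisms.IsLeftModuleHomomorphism (act-linear g)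

  module _ {G : Group a a} where

    trivial : Rep G
    trivial = record
      { space = TensorUnit.leftModule
      ; act = λ _ v → v
      ; act-linear = λ _ → id-linear TensorUnit.leftModule
      ; act-cong = λ _ _ → ≈-refl
      ; act-ε = λ _ → ≈-refl
      ; act-∙ = λ _ _ _ → ≈-refl
      }

    module _ (V W : Rep G) where
      private
        module V = Rep V
        module W = Rep W

      data TensorRel : Term (V.Carrierᴹ × W.Carrierᴹ) → Term (V.Carrierᴹ × W.Carrierᴹ) → Set a where
        ⊗-cong   : ∀ {v v′ w w′} → v V.≈ᴹ v′ → w W.≈ᴹ w′ → TensorRel (gen (v , w)) (gen (v′ , w′))
        +-⊗      : ∀ v v′ w → TensorRel (gen (v V.+ᴹ v′ , w)) (gen (v , w) ⊕ gen (v′ , w))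
        ⊗-+      : ∀ v w w′ → TensorRel (gen (v , w W.+ᴹ w′)) (gen (v , w) ⊕ gen (v , w′))
        *-⊗      : ∀ r v w → TensorRel (gen (r V.*ₗ v , w)) (r ⊙ gen (v , w))
        ⊗-*      : ∀ r v w → TensorRel (gen (v , r W.*ₗ w)) (r ⊙ gen (v , w))

      private
        open module T = Presented TensorRel using (relation; ∼-trans)

        actᵍ : Group.Carrier G → V.Carrierᴹ × W.Carrierᴹ → V.Carrierᴹ × W.Carrierᴹ
        actᵍ g (v , w) = V.act g v , W.act g w

        preserves : ∀ g {t u} → TensorRel t u → mapTerm (actᵍ g) t T.∼ mapTerm (actᵍ g) u
        preserves g (⊗-cong e e′) = relation (⊗-cong (V.Linear.⟦⟧-cong g e) (W.Linear.⟦⟧-cong g e′))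
        preserves g (+-⊗ v v′ w) =
          ∼-trans (relation (⊗-cong (V.Linear.+ᴹ-homo g v v′) W.≈ᴹ-refl)) (relation (+-⊗ _ _ _))
        preserves g (⊗-+ v w w′) =
          ∼-trans (relation (⊗-cong V.≈ᴹ-refl (W.Linear.+ᴹ-homo g w w′))) (relation (⊗-+ _ _ _))
        preserves g (*-⊗ r v w) =
          ∼-trans (relation (⊗-cong (V.Linear.*ₗ-homo g r v) W.≈ᴹ-refl)) (relation (*-⊗ r _ _))
        preserves g (⊗-* r v w) =
          ∼-trans (relation (⊗-cong V.≈ᴹ-refl (W.Linear.*ₗ-homo g r w))) (relation (⊗-* r _ _))

      infixr 7 _⊗_
      _⊗_ : Rep G
      _⊗_ = record
        { space = T.presented
        ; act = λ g → mapTerm (actᵍ g)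
        ; act-linear = λ g → T.mapTerm-linear (preserves g)
        ; act-cong = λ e → T.mapTerm-≗ (λ (v , w) → relation (⊗-cong (V.act-cong e v) (W.act-cong e w)))
        ; act-ε = T.mapTerm-id (λ (v , w) → relation (⊗-cong (V.act-ε v) (W.act-ε w)))
        ; act-∙ = λ g h → T.mapTerm-∘ (λ (v , w) → relation (⊗-cong (V.act-∙ g h v) (W.act-∙ g h w)))
        }

    ⨂ : ∀ {d} → (Fin d → Rep G) → Rep G
    ⨂ {zero}  W = trivial
    ⨂ {suc d} W = W zero ⊗ ⨂ (W ∘ suc)

    -- A truncated exponent r = n ∸ s only arises beside a factor Λ s of a space of rank
    -- n < s, which is zero, so that the whole product is zero as it should be.
    infix 30 _^⊗_
    _^⊗_ : Rep G → ℕ → Rep G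
    V ^⊗ r = ⨂ {r} (λ _ → V)

    module _ (r : ℕ) (V : Rep G) where
      private module V = Rep V

      -- gen v stands for v₀ ∧ ⋯ ∧ vᵣ₋₁.
      data ExteriorRel : Term (Fin r → V.Carrierᴹ) → Term (Fin r → V.Carrierᴹ) → Set a where
        ∧-cong      : ∀ {u v} → (∀ i → u i V.≈ᴹ v i) → ExteriorRel (gen u) (gen v)
        additive    : ∀ j {u v w} → u j V.≈ᴹ v j V.+ᴹ w j →
                      (∀ i → i ≢ j → u i V.≈ᴹ v i) → (∀ i → i ≢ j → u i V.≈ᴹ w i) →
                      ExteriorRel (gen u) (gen v ⊕ gen w)
        homogeneous : ∀ j s {u v} → u j V.≈ᴹ s V.*ₗ v j → (∀ i → i ≢ j → u i V.≈ᴹ v i) →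
                      ExteriorRel (gen u) (s ⊙ gen v)
        alternating : ∀ {i j v} → i ≢ j → v i V.≈ᴹ v j → ExteriorRel (gen v) 𝟘

      private
        open module E = Presented ExteriorRel using (relation)

        actᵍ : Group.Carrier G → (Fin r → V.Carrierᴹ) → Fin r → V.Carrierᴹ
        actᵍ g v i = V.act g (v i)

        preserves : ∀ g {t u} → ExteriorRel t u → mapTerm (actᵍ g) t E.∼ mapTerm (actᵍ g) u
        preserves g (∧-cong e) = relation (∧-cong (λ i → V.Linear.⟦⟧-cong g (e i)))
        preserves g (additive j e e₁ e₂) = relation (additive j
          (V.≈ᴹ-trans (V.Linear.⟦⟧-cong g e) (V.Linear.+ᴹ-homo g _ _))
          (λ i q → V.Linear.⟦⟧-cong g (e₁ i q)) (λ i q → V.Linear.⟦⟧-cong g (e₂ i q)))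
        preserves g (homogeneous j s e e₁) = relation (homogeneous j s
          (V.≈ᴹ-trans (V.Linear.⟦⟧-cong g e) (V.Linear.*ₗ-homo g s _))
          (λ i q → V.Linear.⟦⟧-cong g (e₁ i q)))
        preserves g (alternating q e) = relation (alternating q (V.Linear.⟦⟧-cong g e))

      Λ : Rep G
      Λ = record
        { space = E.presented
        ; act = λ g → mapTerm (actᵍ g)
        ; act-linear = λ g → E.mapTerm-linear (preserves g)
        ; act-cong = λ e → E.mapTerm-≗ (λ v → relation (∧-cong (λ i → V.act-cong e (v i))))
        ; act-ε = E.mapTerm-id (λ v → relation (∧-cong (λ i → V.act-ε (v i))))
        ; act-∙ = λ g h → E.mapTerm-∘ (λ v → relation (∧-cong (λ i → V.act-∙ g h (v i))))
        }

  -- GL(d) as the linear automorphisms of K^d.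
  record GL (d : ℕ) : Set a where
    open LeftModule (K^ d) using (Carrierᴹ; _≈ᴹ_)
    field
      to from     : Carrierᴹ → Carrierᴹ
      to-linear   : IsLinear (K^ d) (K^ d) to
      from-linear : IsLinear (K^ d) (K^ d) from
      to-from     : ∀ v → to (from v) ≈ᴹ v
      from-to     : ∀ v → from (to v) ≈ᴹ v
    open LeftModuleMorphisms.IsLeftModuleHomomorphism to-linear public
      using () renaming (⟦⟧-cong to to-cong)
    open LeftModuleMorphisms.IsLeftModuleHomomorphism from-linear public
      using () renaming (⟦⟧-cong to from-cong)

  GL-group : ℕ → Group a a
  GL-group d = record
    { Carrier = GL d
    ; _≈_ = λ A B → ∀ v → to A v ≈ᴹ to B v
    ; _∙_ = λ A B → record
      { to = to A ∘ to B
      ; from = from B ∘ from A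
      ; to-linear = ∘-linear (K^ d) (to-linear A) (to-linear B)
      ; from-linear = ∘-linear (K^ d) (from-linear B) (from-linear A)
      ; to-from = λ v → ≈ᴹ-trans (to-cong A (to-from B (from A v))) (to-from A v)
      ; from-to = λ v → ≈ᴹ-trans (from-cong B (from-to A (to B v))) (from-to B v)
      }
    ; ε = record
      { to = id ; from = id
      ; to-linear = id-linear (K^ d) ; from-linear = id-linear (K^ d)
      ; to-from = λ _ → ≈ᴹ-refl ; from-to = λ _ → ≈ᴹ-refl
      }
    ; _⁻¹ = λ A → record
      { to = from A ; from = to A
      ; to-linear = from-linear A ; from-linear = to-linear A
      ; to-from = from-to A ; from-to = to-from A
      }
    ; isGroup = record
      { isMonoid = record
        { isSemigroup = record
          { isMagma = record
            { isEquivalence = record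
              { refl = λ _ → ≈ᴹ-refl
              ; sym = λ e v → ≈ᴹ-sym (e v)
              ; trans = λ e e′ v → ≈ᴹ-trans (e v) (e′ v)
              }
            ; ∙-cong = λ {A} {_} {_} {B′} e e′ v → ≈ᴹ-trans (to-cong A (e′ v)) (e (to B′ v))
            }
          ; assoc = λ _ _ _ _ → ≈ᴹ-refl
          }
        ; identity = (λ _ _ → ≈ᴹ-refl) , (λ _ _ → ≈ᴹ-refl)
        }
      ; inverse = from-to , to-from
      ; ⁻¹-cong = λ {A} {B} e v → ≈ᴹ-trans
          (from-cong A (≈ᴹ-sym (≈ᴹ-trans (e (from B v)) (to-from B v))))
          (from-to A (from B v))
      }
    }
    where
    open GL
    open LeftModule (K^ d) using (_≈ᴹ_; ≈ᴹ-refl; ≈ᴹ-sym; ≈ᴹ-trans)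

  -- Torus elements take values in units so that diag x is invertible; as K is any
  -- commutative ring, K may be a Laurent polynomial ring in the variables.
  record Unit : Set a where
    field
      value inverse : Carrier
      value*inverse : value * inverse ≈ 1#

  diag : ∀ {d} → (Fin d → Unit) → GL d
  diag {d} x = record
    { to = λ v i → value (x i) * v i
    ; from = λ v i → inverse (x i) * v i
    ; to-linear = scaling (value ∘ x)
    ; from-linear = scaling (inverse ∘ x)
    ; to-from = λ v i → cancel (value*inverse (x i))
    ; from-to = λ v i → cancel (≈-trans (*-comm _ _) (value*inverse (x i)))
    }
    where
    open Unit
    swap : ∀ r s t → r * (s * t) ≈ s * (r * t)
    swap r s t = ≈-trans (≈-sym (*-assoc r s t)) (≈-trans (*-cong (*-comm r s) ≈-refl) (*-assoc s r t))
    scaling : ∀ y → IsLinear (K^ d) (K^ d) (λ v i → y i * v i)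
    scaling y = mkLinear (K^ d) (K^ d) (λ v i → y i * v i)
      (λ e i → *-cong ≈-refl (e i))
      (λ u v i → distribˡ (y i) (u i) (v i))
      (λ i → zeroʳ (y i))
      (λ v i → ≈-sym (RingProperties.-‿distribʳ-* (y i) (v i)))
      (λ r v i → swap (y i) r (v i))
      where import Algebra.Properties.Ring ring as RingProperties
    cancel : ∀ {r s t} → r * s ≈ 1# → r * (s * t) ≈ t
    cancel e = ≈-trans (≈-sym (*-assoc _ _ _)) (≈-trans (*-cong e ≈-refl) (*-identityˡ _))

  module GLProduct {k} (n : Fin k → ℕ) where

    private module GLᵢ i = Group (GL-group (n i))

    G : Group a a
    G = record
      { Carrier = ∀ i → GL (n i)
      ; _≈_ = λ g h → ∀ i → GLᵢ._≈_ i (g i) (h i)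
      ; _∙_ = λ g h i → GLᵢ._∙_ i (g i) (h i)
      ; ε = GLᵢ.ε
      ; _⁻¹ = λ g i → GLᵢ._⁻¹ i (g i)
      ; isGroup = record
        { isMonoid = record
          { isSemigroup = record
            { isMagma = record
              { isEquivalence = record
                { refl = λ {g} i → GLᵢ.refl i {g i}
                ; sym = λ {g} {h} e i → GLᵢ.sym i {g i} {h i} (e i)
                ; trans = λ {g} {h} {l} e e′ i → GLᵢ.trans i {g i} {h i} {l i} (e i) (e′ i)
                }
              ; ∙-cong = λ {g} {g′} {h} {h′} e e′ i → GLᵢ.∙-cong i {g i} {g′ i} {h i} {h′ i} (e i) (e′ i)
              }
            ; assoc = λ g h l i → GLᵢ.assoc i (g i) (h i) (l i)
            }
          ; identity = (λ g i → GLᵢ.identityˡ i (g i)) , (λ g i → GLᵢ.identityʳ i (g i))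
          }
        ; inverse = (λ g i → GLᵢ.inverseˡ i (g i)) , (λ g i → GLᵢ.inverseʳ i (g i))
        ; ⁻¹-cong = λ {g} {h} e i → GLᵢ.⁻¹-cong i {g i} {h i} (e i)
        }
      }

    V : Fin k → Rep G
    V i = record
      { space = K^ (n i)
      ; act = λ g → GL.to (g i)
      ; act-linear = λ g → GL.to-linear (g i)
      ; act-cong = λ e → e i
      ; act-ε = λ _ _ → ≈-refl
      ; act-∙ = λ _ _ _ _ → ≈-refl
      }

    Torus : Set a
    Torus = ∀ i → Fin (n i) → Unit

    values : Torus → ∀ i → Fin (n i) → Carrier
    values x i v = Unit.value (x i v)

    IsCharacter : Rep G → (Torus → Carrier) → Set a
    IsCharacter W χ = ∀ x → IsTrace (Rep.space W) (Rep.act W (λ i → diag (x i))) (χ x)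

    VirtualRep : Set (ℓsuc a)
    VirtualRep = List (ℤ × Rep G)

    [_] : Rep G → VirtualRep
    [ W ] = (1ℤ , W) ∷ []

    infixr 7 _·_
    infixl 6 _⊖_

    _·_ : ℤ → VirtualRep → VirtualRep
    z · U = map (map₁ (z *ℤ_)) U

    _⊖_ : VirtualRep → VirtualRep → VirtualRep
    U ⊖ U′ = U ++ -1ℤ · U′

    -- A relation rather than a function, as IsTrace requires a basis; the trace does
    -- not depend on the basis, so there is at most one such χ.
    HasCharacter : VirtualRep → (Torus → Carrier) → Set a
    HasCharacter []            χ = ∀ x → χ x ≈ 0#
    HasCharacter ((z , W) ∷ U) χ = ∃ λ χ₁ → ∃ λ χ₂ →
      IsCharacter W χ₁ × HasCharacter U χ₂ × (∀ x → χ x ≈ (z ×ℤ χ₁ x) + χ₂ x)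

-- Fix f₂, …, f_k and put h = f_k ⋯ f₂. Summing over f₁ turns the composite into an arbitrary
-- self-map of X₁ in which a target u carries the weight z_u, the total weight of its fibre under h.
-- Once an N-cycle c in X₁ is prescribed, contracting one vertex after another shows that the maps
-- without another cycle have total weight z^c (s^(n₁ - N) - z(X₁ ∖ c) s^(n₁ - N - 1)), where
-- s = Σ z. Both terms are combinations of monomials z^d with d a repetition-free sequence in X₁,
-- and the sum of z^d over f₂, …, f_k factorises, because d lifts to one repetition-free sequence
-- in each X_i and the values of f_i away from that sequence are free. What remains is an identity
-- between power sums over such sequences and elementary symmetric polynomials, which are the
-- traces of the torus on exterior powers.
module Submission where

open import Defs
open import Algebra.Bundles using (CommutativeMonoid; CommutativeRing; Group)
open import Algebra.Module.Bundles using (LeftModule)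
import Algebra.Properties.CommutativeMonoid.Sum as CommutativeMonoidSum
import Algebra.Properties.Ring as RingProperties
import Algebra.Properties.Semiring.Exp as SemiringExp
import Algebra.Properties.Semiring.Mult as SemiringMult
import Algebra.Properties.Semiring.Sum as SemiringSum
open import Data.Bool.Base using (Bool; true; false; if_then_else_)
open import Data.Fin.Base using (Fin; zero; suc; toℕ; _<_; _↑ˡ_; _↑ʳ_; combine; remQuot; splitAt; join)
open import Data.Fin.Permutation using (Permutation′; permutation)
import Data.Fin.Properties as Fin
open import Data.List.Base using (List; allFin)
open import Data.Nat.Base as ℕ using (ℕ; zero; suc; _∸_; _!; NonZero; z≤n; s≤s)
open import Data.Nat.DivMod using (_mod_; _%_; m%n<n; %-distribˡ-+; m%n%n≡m%n; [m+n]%n≡m%n; m<n⇒m%n≡m)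
open import Data.Nat.GeneralisedArithmetic using (fold; fold-+)
import Data.Nat.Properties as ℕ
open import Data.Product.Base as Product using (Σ; ∃; _,_; proj₁; proj₂)
open import Data.Sum.Base using (_⊎_; inj₁; inj₂)
open import Function.Base using (_∘_; id)
open import Function.Bundles using (mk⇔; Equivalence)
open import Function.Definitions using (Injective)
open import Relation.Binary.PropositionalEquality as ≡ using (_≡_; _≢_; _≗_)
open import Relation.Nullary using (¬_; Dec; does; yes; no; contradiction)
open import Relation.Nullary.Decidable using (map′; _×-dec_; _→-dec_; ¬?)

-- Finite sums in a commutative monoid

-- The weight of the maps attracted to a marked cycle is a weighted Cayley formula: root weight
-- times s^(u - 1) for u > 0 unmarked vertices. Contraction proves it over any commutative ring,
-- without determinants or inverses, since merging a vertex into its target only pushes weights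
-- forward and leaves a problem of the same kind. The sum over f₂, ..., f_k can be carried out on
-- monomials only. The powers of s do not disturb it: s is the sum of the variables of X₂, whatever
-- these maps are. The negative term stays on the other side of each identity until the end. A
-- truncated exponent then always stands beside a vanishing factor. Constants: N elements carry (N -
-- 1)! cycles, and each of the k - 1 lifted sequences brings N!. In the negative term the lifts
-- bring (N + 1)!, and the vertex outside the cycle can be any of N + 1; the quotient is (N + 1)^k.
-- A trace requires a basis, but Λ is given by generators and relations over a ring that may not be
-- a field. Independence is obtained by mapping it to an explicit exterior algebra on coordinates.

module MonoidSums {c ℓ} (M : CommutativeMonoid c ℓ) where

  open CommutativeMonoid M
  open CommutativeMonoidSum M
  open ≡ using (_≡_)

  sum-ε : ∀ {n} {f : Fin n → Carrier} → (∀ i → f i ≈ ε) → sum f ≈ ε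
  sum-ε {n} e = trans (sum-cong-≋ e) (sum-replicate-zero n)

  sum-single : ∀ {n} {f : Fin n → Carrier} i → (∀ j → ¬ j ≡ i → f j ≈ ε) → sum f ≈ f i
  sum-single {f = f} zero e = trans (∙-congˡ {f zero} (sum-ε λ j → e (suc j) λ ())) (identityʳ _)
  sum-single (suc i) e = trans
    (∙-cong (e zero λ ()) (sum-single i λ j ne → e (suc j) (ne ∘ Fin.suc-injective))) (identityˡ _)

  if-yes : ∀ {P : Set} (d : Dec P) {x y : Carrier} → P → (if does d then x else y) ≈ x
  if-yes (yes _) p = refl
  if-yes (no ¬p) p = contradiction p ¬p

  if-no : ∀ {P : Set} (d : Dec P) {x y : Carrier} → ¬ P → (if does d then x else y) ≈ y
  if-no (yes p) ¬p = contradiction p ¬p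
  if-no (no _)  ¬p = refl

  module _ {N p} (c : Fin N → Fin p) where

    -- Summing over all preimages avoids choosing one, so `sum-extend` holds for every `c`. For
    -- injective `c` this is the extension by `ε` of a function on the image.
    extend : (Fin N → Carrier) → Fin p → Carrier
    extend r v = sum (λ j → if does (c j Fin.≟ v) then r j else ε)

    sum-extend : ∀ r → sum (extend r) ≈ sum r
    sum-extend r = trans (∑-comm {p} {N} _) (sum-cong-≋ {N} λ j →
      trans (sum-single {p} (c j) λ v ne → if-no (c j Fin.≟ v) (ne ∘ ≡.sym))
            (if-yes (c j Fin.≟ c j) ≡.refl))

    image? : ∀ v → Dec (∃ λ j → c j ≡ v)
    image? v = Fin.any? λ j → c j Fin.≟ v

    extend-outside : ∀ r {v} → ¬ (∃ λ j → c j ≡ v) → extend r v ≈ ε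
    extend-outside r {v} ¬im = sum-ε {N} λ j → if-no (c j Fin.≟ v) λ e → ¬im (j , e)

    extend-image : Injective _≡_ _≡_ c → ∀ r j → extend r (c j) ≈ r j
    extend-image inj r j = trans
      (sum-single {N} j λ i ne → if-no (c i Fin.≟ c j) (ne ∘ inj))
      (if-yes (c j Fin.≟ c j) ≡.refl)

  sum-split : ∀ m {n} (f : Fin (m ℕ.+ n) → Carrier) → sum f ≈ sum (λ i → f (i ↑ˡ n)) ∙ sum (λ j → f (m ↑ʳ j))
  sum-split zero    f = sym (identityˡ _)
  sum-split (suc m) f = trans (∙-congˡ {f zero} (sum-split m (f ∘ suc))) (sym (assoc _ _ _))

  sum-combine : ∀ m {n} (f : Fin (m ℕ.* n) → Carrier) →
                sum f ≈ sum {m} (λ i → sum {n} (λ j → f (combine i j)))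
  sum-combine zero    {n} f = refl
  sum-combine (suc m) {n} f = trans (sum-split n f) (∙-congˡ {sum (λ i → f (i ↑ˡ (m ℕ.* n)))} (sum-combine m {n} (λ k → f (n ↑ʳ k))))

-- Cycles of a self-map

module Cycles where

  open ≡ using (refl; sym; trans; cong; subst; module ≡-Reasoning)
  open import Data.Nat.Base using (_+_; _*_; _≤_)
  open Product using (_×_)

  toℕ-mod : ∀ a d .{{_ : NonZero d}} → toℕ (a mod d) ≡ a % d
  toℕ-mod a d = Fin.toℕ-fromℕ< (m%n<n a d)

  %-+ˡ : ∀ a b d .{{_ : NonZero d}} → (a % d + b) % d ≡ (a + b) % d
  %-+ˡ a b d = begin
    (a % d + b) % d          ≡⟨ %-distribˡ-+ (a % d) b d ⟩
    (a % d % d + b % d) % d  ≡⟨ cong (λ c → (c + b % d) % d) (m%n%n≡m%n a d) ⟩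
    (a % d + b % d) % d      ≡⟨ %-distribˡ-+ a b d ⟨
    (a + b) % d              ∎
    where open ≡-Reasoning

  %-+ʳ : ∀ a b d .{{_ : NonZero d}} → (a + b % d) % d ≡ (a + b) % d
  %-+ʳ a b d = begin
    (a + b % d) % d  ≡⟨ cong (_% d) (ℕ.+-comm a (b % d)) ⟩
    (b % d + a) % d  ≡⟨ %-+ˡ b a d ⟩
    (b + a) % d      ≡⟨ cong (_% d) (ℕ.+-comm b a) ⟩
    (a + b) % d      ∎
    where open ≡-Reasoning

  toℕ+d% : ∀ {m} (i : Fin (suc m)) → (toℕ i + suc m) % suc m ≡ toℕ i
  toℕ+d% {m} i = trans ([m+n]%n≡m%n (toℕ i) (suc m)) (m<n⇒m%n≡m (Fin.toℕ<n i))

  toℕ-next : ∀ {m} (i : Fin (suc m)) → toℕ (next i) ≡ suc (toℕ i) % suc m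
  toℕ-next {m} i = toℕ-mod (suc (toℕ i)) (suc m)

  toℕ-prev : ∀ {m} (i : Fin (suc m)) → toℕ (prev i) ≡ (toℕ i + m) % suc m
  toℕ-prev {m} i = toℕ-mod (toℕ i + m) (suc m)

  next-prev : ∀ {k} (i : Fin k) → next (prev i) ≡ i
  next-prev {suc m} i = Fin.toℕ-injective (begin
    toℕ (next (prev i))                 ≡⟨ toℕ-next (prev i) ⟩
    (1 + toℕ (prev i)) % suc m          ≡⟨ cong (λ a → suc a % suc m) (toℕ-prev i) ⟩
    (1 + (toℕ i + m) % suc m) % suc m   ≡⟨ %-+ʳ 1 (toℕ i + m) (suc m) ⟩
    suc (toℕ i + m) % suc m             ≡⟨ cong (_% suc m) (ℕ.+-suc (toℕ i) m) ⟨
    (toℕ i + suc m) % suc m             ≡⟨ toℕ+d% i ⟩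
    toℕ i                               ∎)
    where open ≡-Reasoning

  prev-next : ∀ {k} (i : Fin k) → prev (next i) ≡ i
  prev-next {suc m} i = Fin.toℕ-injective (begin
    toℕ (prev (next i))                 ≡⟨ toℕ-prev (next i) ⟩
    (toℕ (next i) + m) % suc m          ≡⟨ cong (λ a → (a + m) % suc m) (toℕ-next i) ⟩
    (suc (toℕ i) % suc m + m) % suc m   ≡⟨ %-+ˡ (suc (toℕ i)) m (suc m) ⟩
    suc (toℕ i + m) % suc m             ≡⟨ cong (_% suc m) (ℕ.+-suc (toℕ i) m) ⟨
    (toℕ i + suc m) % suc m             ≡⟨ toℕ+d% i ⟩
    toℕ i                               ∎)
    where open ≡-Reasoning

  next-permutation : ∀ {k} → Permutation′ k
  next-permutation = permutation next prev next-prev prev-next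

  toℕ-next^ : ∀ {m} (i : Fin (suc m)) t → toℕ (fold i next t) ≡ (toℕ i + t) % suc m
  toℕ-next^ {m} i zero =
    sym (trans (cong (_% suc m) (ℕ.+-identityʳ (toℕ i))) (m<n⇒m%n≡m (Fin.toℕ<n i)))
  toℕ-next^ {m} i (suc t) = begin
    toℕ (next (fold i next t))           ≡⟨ toℕ-next (fold i next t) ⟩
    suc (toℕ (fold i next t)) % suc m    ≡⟨ cong (λ b → suc b % suc m) (toℕ-next^ i t) ⟩
    (1 + (toℕ i + t) % suc m) % suc m    ≡⟨ %-+ʳ 1 (toℕ i + t) (suc m) ⟩
    suc (toℕ i + t) % suc m              ≡⟨ cong (_% suc m) (ℕ.+-suc (toℕ i) t) ⟨
    (toℕ i + suc t) % suc m              ∎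
    where open ≡-Reasoning

  next^-zero : ∀ {m} (j : Fin (suc m)) → fold zero next (toℕ j) ≡ j
  next^-zero j = Fin.toℕ-injective (trans (toℕ-next^ zero (toℕ j)) (m<n⇒m%n≡m (Fin.toℕ<n j)))

  -- Rotations of a cyclic index set

  module _ {m : ℕ} (o : Fin (suc m)) where

    rotate unrotate : Fin (suc m) → Fin (suc m)
    rotate j = fold o next (toℕ j)
    unrotate i = (toℕ i + (suc m ∸ toℕ o)) mod suc m

    private
      o+ : toℕ o + (suc m ∸ toℕ o) ≡ suc m
      o+ = ℕ.m+[n∸m]≡n (ℕ.<⇒≤ (Fin.toℕ<n o))

    unrotate-rotate : ∀ j → unrotate (rotate j) ≡ j
    unrotate-rotate j = Fin.toℕ-injective (begin
      toℕ (unrotate (rotate j))                    ≡⟨ toℕ-mod (toℕ (rotate j) + r) (suc m) ⟩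
      (toℕ (rotate j) + r) % suc m                 ≡⟨ cong (λ a → (a + r) % suc m) (toℕ-next^ o (toℕ j)) ⟩
      ((toℕ o + toℕ j) % suc m + r) % suc m        ≡⟨ %-+ˡ (toℕ o + toℕ j) r (suc m) ⟩
      (toℕ o + toℕ j + r) % suc m                  ≡⟨ cong (λ a → (a + r) % suc m) (ℕ.+-comm (toℕ o) (toℕ j)) ⟩
      (toℕ j + toℕ o + r) % suc m                  ≡⟨ cong (_% suc m) (trans (ℕ.+-assoc (toℕ j) (toℕ o) r) (cong (toℕ j +_) o+)) ⟩
      (toℕ j + suc m) % suc m                      ≡⟨ toℕ+d% j ⟩
      toℕ j                                        ∎)
      where
      open ≡-Reasoning
      r = suc m ∸ toℕ o

    rotate-unrotate : ∀ i → rotate (unrotate i) ≡ i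
    rotate-unrotate i = Fin.toℕ-injective (begin
      toℕ (rotate (unrotate i))                    ≡⟨ toℕ-next^ o (toℕ (unrotate i)) ⟩
      (toℕ o + toℕ (unrotate i)) % suc m           ≡⟨ cong (λ a → (toℕ o + a) % suc m) (toℕ-mod (toℕ i + r) (suc m)) ⟩
      (toℕ o + (toℕ i + r) % suc m) % suc m        ≡⟨ %-+ʳ (toℕ o) (toℕ i + r) (suc m) ⟩
      (toℕ o + (toℕ i + r)) % suc m                ≡⟨ cong (λ a → (toℕ o + a) % suc m) (ℕ.+-comm (toℕ i) r) ⟩
      (toℕ o + (r + toℕ i)) % suc m                ≡⟨ cong (_% suc m) (ℕ.+-assoc (toℕ o) r (toℕ i)) ⟨
      (toℕ o + r + toℕ i) % suc m                  ≡⟨ cong (λ a → (a + toℕ i) % suc m) o+ ⟩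
      (suc m + toℕ i) % suc m                      ≡⟨ cong (_% suc m) (ℕ.+-comm (suc m) (toℕ i)) ⟩
      (toℕ i + suc m) % suc m                      ≡⟨ toℕ+d% i ⟩
      toℕ i                                        ∎)
      where
      open ≡-Reasoning
      r = suc m ∸ toℕ o

    rotate-next : ∀ j → rotate (next j) ≡ next (rotate j)
    rotate-next j = Fin.toℕ-injective (begin
      toℕ (rotate (next j))                        ≡⟨ toℕ-next^ o (toℕ (next j)) ⟩
      (toℕ o + toℕ (next j)) % suc m               ≡⟨ cong (λ a → (toℕ o + a) % suc m) (toℕ-next j) ⟩
      (toℕ o + suc (toℕ j) % suc m) % suc m        ≡⟨ %-+ʳ (toℕ o) (suc (toℕ j)) (suc m) ⟩
      (toℕ o + suc (toℕ j)) % suc m                ≡⟨ toℕ-next^ o (suc (toℕ j)) ⟨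
      toℕ (next (rotate j))                        ∎)
      where open ≡-Reasoning

  argmin : ∀ {m p} (c : Fin (suc m) → Fin p) → ∃ λ o → ∀ j → toℕ (c o) ≤ toℕ (c j)
  argmin {zero}  c = zero , λ { zero → ℕ.≤-refl }
  argmin {suc m} c with argmin (c ∘ suc)
  ... | o , least with ℕ.≤-total (toℕ (c zero)) (toℕ (c (suc o)))
  ...   | inj₁ le = zero , λ { zero → ℕ.≤-refl ; (suc j) → ℕ.≤-trans le (least j) }
  ...   | inj₂ ge = suc o , λ { zero → ge ; (suc j) → least j }

  -- Exactly one rotation of a repetition-free listing is normal. In this form a sum over normal
  -- sequences splits into a choice of the head and a repetition-free sequence above it.
  Normal : ∀ {m p} → (Fin (suc m) → Fin p) → Set
  Normal c = (∀ j → c zero < c (suc j)) × Injective _≡_ _≡_ (c ∘ suc)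

  Normal⇒Injective : ∀ {m p} {c : Fin (suc m) → Fin p} → Normal c → Injective _≡_ _≡_ c
  Normal⇒Injective (lt , inj) {zero}  {zero}  e = refl
  Normal⇒Injective (lt , inj) {zero}  {suc j} e = contradiction (lt j) (ℕ.<-irrefl (cong toℕ e))
  Normal⇒Injective (lt , inj) {suc i} {zero}  e = contradiction (lt i) (ℕ.<-irrefl (cong toℕ (sym e)))
  Normal⇒Injective (lt , inj) {suc i} {suc j} e = cong suc (inj e)

  module _ {N p : ℕ} where

    _∈im_ : Fin p → (Fin N → Fin p) → Set
    u ∈im c = ∃ λ j → c j ≡ u

    Follows : (Fin p → Fin p) → (Fin N → Fin p) → Set
    Follows F c = ∀ j → F (c j) ≡ c (next j)

    -- Stabilisation of the images, stated orbit by orbit: a cycle that is followed is never left,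
    -- and on a finite set the entry times have a common bound.
    Attracts : (Fin p → Fin p) → (Fin N → Fin p) → Set
    Attracts F c = ∀ u → ∃ λ t → fold u F t ∈im c

    module _ {F : Fin p → Fin p} {c : Fin N → Fin p} (follows : Follows F c) where

      follows^ : ∀ t j → fold (c j) F t ≡ c (fold j next t)
      follows^ zero    j = refl
      follows^ (suc t) j = trans (cong F (follows^ t j)) (follows _)

      ∈im-step : ∀ d {v} → v ∈im c → fold v F d ∈im c
      ∈im-step d (j , refl) = fold j next d , sym (follows^ d j)

      ∈im-mono : ∀ {u s t} → s ≤ t → fold u F s ∈im c → fold u F t ∈im c
      ∈im-mono {u} {s} {t} s≤t q with ∈im-step (t ∸ s) q
      ... | j , e = j , trans e (trans (sym (fold-+ u F (t ∸ s))) (cong (fold u F) (ℕ.m∸n+n≡m s≤t)))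

      ∈im-back : ∀ t j → ∃ λ u → fold u F t ≡ c j
      ∈im-back zero    j = c j , refl
      ∈im-back (suc t) j with ∈im-back t (prev j)
      ... | u , q = u , trans (cong F q) (trans (follows (prev j)) (cong c (next-prev j)))

  bound : ∀ {p} (t : Fin p → ℕ) → ∃ λ M → ∀ u → t u ≤ M
  bound {zero}  t = 0 , λ ()
  bound {suc p} t with bound (t ∘ suc)
  ... | M , le = t zero + M , λ { zero → ℕ.m≤m+n _ _ ; (suc u) → ℕ.≤-trans (le u) (ℕ.m≤n+m _ _) }

  -- The description of the limit cycle is unique once the listing starts at the least element.
  record Cycle {m p} (F : Fin p → Fin p) (c : Fin (suc m) → Fin p) : Set where
    constructor cycle
    field
      normal   : Normal c
      follows  : Follows F c
      attracts : Attracts F c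

  module _ {m p : ℕ} {F : Fin p → Fin p} where

    Cycle⇒EventuallyCycle : ∀ {c : Fin (suc m) → Fin p} → Cycle F c → EventuallyCycle (suc m) F
    Cycle⇒EventuallyCycle {c} (cycle normal follows attracts)
      with bound (λ u → proj₁ (attracts u))
    ... | M , le = c , Normal⇒Injective normal , follows , M , λ t M≤t v → mk⇔
      (λ { (u , refl) → ∈im-mono follows (ℕ.≤-trans (le u) M≤t) (proj₂ (attracts u)) })
      (λ { (j , refl) → ∈im-back follows t j })

    EventuallyCycle⇒Cycle : EventuallyCycle (suc m) F → ∃ λ (c : Fin (suc m) → Fin p) → Cycle F c
    EventuallyCycle⇒Cycle (c , inj , follows , M , stable) with argmin c
    ... | o , least = c ∘ rotate o , cycle (less , inj′) follows′ attracts
      where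
      rotate-injective : Injective _≡_ _≡_ (rotate o)
      rotate-injective {i} {j} e =
        trans (sym (unrotate-rotate o i)) (trans (cong (unrotate o) e) (unrotate-rotate o j))
      less : ∀ j → c o < c (rotate o (suc j))
      less j = ℕ.≤∧≢⇒< (least (rotate o (suc j)))
        λ e → Fin.0≢1+n (rotate-injective {zero} {suc j} (inj (Fin.toℕ-injective e)))
      inj′ : Injective _≡_ _≡_ (c ∘ rotate o ∘ suc)
      inj′ e = Fin.suc-injective (rotate-injective (inj e))
      follows′ : Follows F (c ∘ rotate o)
      follows′ j = trans (follows (rotate o j)) (cong c (sym (rotate-next o j)))
      attracts : Attracts F (c ∘ rotate o)
      attracts u with Equivalence.to (stable M ℕ.≤-refl (fold u F M)) (u , refl)
      ... | j , e = M , unrotate o j , trans (cong c (rotate-unrotate o j)) e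

    private
      image-⊆ : ∀ {c d : Fin (suc m) → Fin p} → Cycle F c → Cycle F d → ∀ j → c j ∈im d
      image-⊆ {c} {d} C D j with Cycle.attracts D (c j)
      -- After `t * suc m` steps, a multiple of the cycle length, the orbit of `c j` is back at
      -- `c j`. Since this is at least `t`, it also lies in the image of `d`.
      ... | t , q = subst (_∈im d) (return t) (∈im-mono (Cycle.follows D) (ℕ.m≤m*n t (suc m)) q)
        where
        return : ∀ t → fold (c j) F (t * suc m) ≡ c j
        return zero    = refl
        return (suc t) = trans (fold-+ (c j) F (suc m)) (trans (cong (λ v → fold v F (suc m)) (return t))
          (trans (follows^ {F = F} {c} (Cycle.follows C) (suc m) j) (cong c (next^k j))))

      least-first : ∀ {c d : Fin (suc m) → Fin p} → Cycle F c → Cycle F d → toℕ (c zero) ≤ toℕ (d zero)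
      least-first C D with image-⊆ D C zero
      ... | zero  , e = ℕ.≤-reflexive (cong toℕ e)
      ... | suc j , e = ℕ.≤-trans (ℕ.<⇒≤ (proj₁ (Cycle.normal C) j)) (ℕ.≤-reflexive (cong toℕ e))

    -- Both listings have the same image, hence the same least element, and from there both follow
    -- `F`.
    Cycle-unique : ∀ {c d : Fin (suc m) → Fin p} → Cycle F c → Cycle F d → c ≗ d
    Cycle-unique {c} {d} C D j = begin
      c j                           ≡⟨ cong c (next^-zero j) ⟨
      c (fold zero next (toℕ j))    ≡⟨ follows^ {F = F} {c} (Cycle.follows C) (toℕ j) zero ⟨
      fold (c zero) F (toℕ j)       ≡⟨ cong (λ v → fold v F (toℕ j)) first≡ ⟩
      fold (d zero) F (toℕ j)       ≡⟨ follows^ {F = F} {d} (Cycle.follows D) (toℕ j) zero ⟩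
      d (fold zero next (toℕ j))    ≡⟨ cong d (next^-zero j) ⟩
      d j                           ∎
      where
      open ≡-Reasoning
      first≡ : c zero ≡ d zero
      first≡ = Fin.toℕ-injective (ℕ.≤-antisym (least-first C D) (least-first D C))

open Cycles

-- Reachability by contraction

module Reachability where

  open ≡ using (refl; sym; trans; cong; subst; module ≡-Reasoning)
  open import Data.Nat.Base using (_+_)
  open Product using (_×_)

  -- A map g : Fin m → Fin (suc m) describes a directed graph on m vertices, where vertex v has
  -- the number suc v and zero stands for an additional terminal vertex.
  -- Contracting the edge out of vertex zero redirects the edges into that vertex to τ.
  contract : ∀ {m} → Fin (suc m) → Fin (suc (suc m)) → Fin (suc m)
  contract τ zero          = zero
  contract τ (suc zero)    = τ
  contract τ (suc (suc u)) = suc u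

  private
    resolve : ∀ {m} → Fin (suc (suc m)) → (Fin (suc m) → Bool) → Bool
    resolve zero          k = k zero
    resolve (suc zero)    k = false
    resolve (suc (suc u)) k = k (suc u)

  -- Vertices are removed one by one: a marked vertex is merged into the terminal one and its own
  -- edge is forgotten, an unmarked vertex is merged into its target. A cycle without marks shrinks
  -- to a loop, which gives `false`. So the value tells whether every path ends at a mark or at the
  -- terminal vertex, computed along the recursion by which weights are summed in `∑-reaches`.
  reaches : ∀ m → (Fin m → Bool) → (Fin m → Fin (suc m)) → Bool
  reaches zero    b g = true
  reaches (suc m) b g =
    if b zero then reaches m (b ∘ suc) (contract zero ∘ g ∘ suc)
    else resolve (g zero) (λ τ → reaches m (b ∘ suc) (contract τ ∘ g ∘ suc))

  reaches-cong : ∀ m b {g h : Fin m → Fin (suc m)} → g ≗ h → reaches m b g ≡ reaches m b h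
  reaches-cong zero    b e = refl
  reaches-cong (suc m) b {g} {h} e with b zero
  ... | true  = reaches-cong m (b ∘ suc) (cong (contract zero) ∘ e ∘ suc)
  ... | false rewrite e zero with h zero
  ...   | zero        = reaches-cong m (b ∘ suc) (cong (contract zero) ∘ e ∘ suc)
  ...   | suc zero    = refl
  ...   | suc (suc u) = reaches-cong m (b ∘ suc) (cong (contract (suc u)) ∘ e ∘ suc)

  data Leads {m} (b : Fin m → Bool) (g : Fin m → Fin (suc m)) : Fin (suc m) → Set where
    terminal : Leads b g zero
    marked   : ∀ {v} → b v ≡ true → Leads b g (suc v)
    edge     : ∀ {v} → Leads b g (g v) → Leads b g (suc v)

  private
    lift : ∀ {m} → Fin (suc m) → Fin (suc (suc m))
    lift zero    = zero
    lift (suc u) = suc (suc u)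

    contract-lift : ∀ {m} (τ t : Fin (suc m)) → contract τ (lift t) ≡ t
    contract-lift τ zero    = refl
    contract-lift τ (suc t) = refl

    module _ {m} {b : Fin (suc m) → Bool} {g : Fin (suc m) → Fin (suc (suc m))} where

      -- The place to which edges into vertex zero may be redirected without changing which paths
      -- end. A loop at an unmarked vertex zero admits no such `τ`, because `lift` misses
      -- `suc zero`.
      Target : Fin (suc m) → Set
      Target τ = (b zero ≡ true × τ ≡ zero) ⊎ (b zero ≡ false × g zero ≡ lift τ)

      private
        g/ : Fin (suc m) → Fin m → Fin (suc m)
        g/ τ = contract τ ∘ g ∘ suc

      project : ∀ {τ} → Target τ → ∀ {t} → Leads b g t → Leads (b ∘ suc) (g/ τ) (contract τ t)
      project tg terminal = terminal
      project (inj₁ (_ , refl)) (marked {zero} e) = terminal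
      project (inj₂ (e′ , _))   (marked {zero} e) = contradiction (trans (sym e) e′) λ ()
      project tg (marked {suc v} e) = marked e
      project (inj₁ (_ , refl)) (edge {zero} l) = terminal
      project {τ} tg@(inj₂ (_ , e)) (edge {zero} l) =
        subst (Leads (b ∘ suc) (g/ τ)) (trans (cong (contract τ) e) (contract-lift τ τ)) (project tg l)
      project tg (edge {suc v} l) = edge (project tg l)

      embed : ∀ {τ} → Target τ → ∀ {t} → Leads (b ∘ suc) (g/ τ) t → Leads b g (lift t)
      embed tg terminal   = terminal
      embed tg (marked e) = marked e
      embed tg (edge {v} l) with g (suc v) in eq | embed tg l
      ... | zero        | l′ = edge (subst (Leads b g) (sym eq) l′)
      ... | suc (suc u) | l′ = edge (subst (Leads b g) (sym eq) l′)
      -- The edge had been redirected from vertex zero to `τ`. The path is restored by stopping at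
      -- vertex zero if it is marked, and by passing through it otherwise.
      ... | suc zero    | l′ with tg
      ...   | inj₁ (e , _) = edge (subst (Leads b g) (sym eq) (marked e))
      ...   | inj₂ (_ , e) = edge (subst (Leads b g) (sym eq) (edge (subst (Leads b g) (sym e) l′)))

      all-lead : ∀ {τ} → Target τ → (∀ t → Leads (b ∘ suc) (g/ τ) t) → ∀ t → Leads b g t
      all-lead tg l zero          = terminal
      all-lead tg l (suc (suc u)) = embed tg (l (suc u))
      all-lead (inj₁ (e , _)) l (suc zero) = marked e
      all-lead {τ} tg@(inj₂ (_ , e)) l (suc zero) = edge (subst (Leads b g) (sym e) (embed tg (l τ)))

      all-lead⁻ : ∀ {τ} → Target τ → (∀ t → Leads b g t) → ∀ t → Leads (b ∘ suc) (g/ τ) t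
      all-lead⁻ {τ} tg l t = subst (Leads (b ∘ suc) (g/ τ)) (contract-lift τ t) (project tg (l (lift t)))

      loop : b zero ≡ false → g zero ≡ suc zero → ∀ {t} → t ≡ suc zero → ¬ Leads b g t
      loop b0 g0 refl (marked e) = contradiction (trans (sym b0) e) λ ()
      loop b0 g0 refl (edge l)   = loop b0 g0 g0 l

  reaches-sound : ∀ m {b g} → reaches m b g ≡ true → ∀ t → Leads b g t
  reaches-sound zero    r zero = terminal
  reaches-sound (suc m) {b} {g} r with b zero in b0
  ... | true  = all-lead {τ = zero} (inj₁ (b0 , refl)) (reaches-sound m r)
  ... | false with g zero in g0
  ...   | zero        = all-lead {τ = zero} (inj₂ (b0 , g0)) (reaches-sound m r)
  ...   | suc (suc u) = all-lead {τ = suc u} (inj₂ (b0 , g0)) (reaches-sound m r)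

  reaches-complete : ∀ m {b g} → (∀ t → Leads b g t) → reaches m b g ≡ true
  reaches-complete zero    l = refl
  reaches-complete (suc m) {b} {g} l with b zero in b0
  ... | true  = reaches-complete m (all-lead⁻ {τ = zero} (inj₁ (b0 , refl)) l)
  ... | false with g zero in g0
  ...   | zero        = reaches-complete m (all-lead⁻ {τ = zero} (inj₂ (b0 , g0)) l)
  ...   | suc (suc u) = reaches-complete m (all-lead⁻ {τ = suc u} (inj₂ (b0 , g0)) l)
  ...   | suc zero    = contradiction (l (suc zero)) (loop b0 g0 refl)

  module _ {p} {b : Fin p → Bool} {F : Fin p → Fin p} where

    -- No edge of `suc ∘ F` enters the terminal vertex, so a path from a proper vertex can end only
    -- at a mark.
    Leads⇒iterate : ∀ {t} → Leads b (suc ∘ F) t → ∀ {u} → t ≡ suc u → ∃ λ s → b (fold u F s) ≡ true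
    Leads⇒iterate (marked e) refl = 0 , e
    Leads⇒iterate (edge {v} l) refl with Leads⇒iterate l refl
    ... | s , e = suc s , trans (cong b (fold-inside s)) e
      where
      fold-inside : ∀ s → F (fold v F s) ≡ fold (F v) F s
      fold-inside zero    = refl
      fold-inside (suc s) = cong F (fold-inside s)

    iterate⇒Leads : ∀ s {u} → b (fold u F s) ≡ true → Leads b (suc ∘ F) (suc u)
    iterate⇒Leads zero    e = marked e
    iterate⇒Leads (suc s) {u} e = edge (iterate⇒Leads s (trans (cong b (fold-inside s)) e))
      where
      fold-inside : ∀ s → fold (F u) F s ≡ F (fold u F s)
      fold-inside zero    = refl
      fold-inside (suc s) = cong F (fold-inside s)

  unmarked : ∀ {m} → (Fin m → Bool) → ℕ
  unmarked {zero}  b = 0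
  unmarked {suc m} b = (if b zero then 0 else 1) + unmarked (b ∘ suc)

  unmarked≡0 : ∀ {m} (b : Fin m → Bool) → unmarked b ≡ 0 → ∀ v → b v ≡ true
  unmarked≡0 {suc m} b e v with b zero in b0
  unmarked≡0 {suc m} b e zero    | true = b0
  unmarked≡0 {suc m} b e (suc v) | true = unmarked≡0 (b ∘ suc) e v

  module ℕ-Single = MonoidSums ℕ.+-0-commutativeMonoid
  open import Algebra.Properties.CommutativeMonoid.Sum ℕ.+-0-commutativeMonoid using (sum; sum-cong-≗)

  marks : ∀ {N p} → (Fin N → Fin p) → Fin p → Bool
  marks c v = does (ℕ-Single.image? c v)

  marks⇒∈ : ∀ {N p} (c : Fin N → Fin p) v → marks c v ≡ true → ∃ λ j → c j ≡ v
  marks⇒∈ c v e with ℕ-Single.image? c v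
  ... | yes q = q

  ∈⇒marks : ∀ {N p} (c : Fin N → Fin p) v → (∃ λ j → c j ≡ v) → marks c v ≡ true
  ∈⇒marks c v q with ℕ-Single.image? c v
  ... | yes _ = refl
  ... | no ¬q = contradiction q ¬q

  unmarked+marked : ∀ {m} (b : Fin m → Bool) → unmarked b + sum (λ v → if b v then 1 else 0) ≡ m
  unmarked+marked {zero}  b = refl
  unmarked+marked {suc m} b with b zero
  ... | true  = trans (ℕ.+-suc (unmarked (b ∘ suc)) _) (cong suc (unmarked+marked (b ∘ suc)))
  ... | false = cong suc (unmarked+marked (b ∘ suc))

  unmarked-marks : ∀ {N p} (c : Fin N → Fin p) → Injective _≡_ _≡_ c → unmarked (marks c) ≡ p ∸ N
  unmarked-marks {N} {p} c inj = trans (sym (ℕ.m+n∸n≡m (unmarked (marks c)) N)) (cong (_∸ N) (begin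
    unmarked (marks c) + N                                       ≡⟨ cong (unmarked (marks c) +_) (begin
      N                                                              ≡⟨ ones N ⟨
      sum {N} (λ j → 1)                                              ≡⟨ ℕ-Single.sum-extend c (λ _ → 1) ⟨
      sum (ℕ-Single.extend c (λ _ → 1))                              ≡⟨ sum-cong-≗ indicator ⟩
      sum (λ v → if marks c v then 1 else 0)                         ∎) ⟩
    unmarked (marks c) + sum (λ v → if marks c v then 1 else 0)  ≡⟨ unmarked+marked (marks c) ⟩
    p                                                            ∎))
    where
    open ≡-Reasoning
    ones : ∀ n → sum {n} (λ j → 1) ≡ n
    ones zero    = refl
    ones (suc n) = cong suc (ones n)
    indicator : ∀ v → ℕ-Single.extend c (λ _ → 1) v ≡ (if marks c v then 1 else 0)
    indicator v with ℕ-Single.image? c v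
    ... | yes (j , refl) = ℕ-Single.extend-image c inj (λ _ → 1) j
    ... | no ¬im         = ℕ-Single.extend-outside c (λ _ → 1) ¬im

open Reachability

-- Orbits through the cyclically indexed sets

module ChainOrbits where

  open ≡ using (refl; sym; trans; cong; subst; module ≡-Reasoning)
  open import Data.Nat.Base using (_+_; _≤_)

  -- The number of steps from the index next zero to i.
  position : ∀ {k} → Fin k → ℕ
  position = toℕ ∘ prev

  position-zero : ∀ {k} → position {suc k} zero ≡ k
  position-zero {k} = trans (toℕ-prev {k} zero) (m<n⇒m%n≡m (ℕ.n<1+n k))

  position-suc : ∀ {k} (i : Fin k) → position (suc i) ≡ toℕ i
  position-suc {k} i = begin
    toℕ (prev (suc i))            ≡⟨ toℕ-prev (suc i) ⟩
    suc (toℕ i + k) % suc k       ≡⟨ cong (_% suc k) (ℕ.+-suc (toℕ i) k) ⟨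
    (toℕ i + suc k) % suc k       ≡⟨ [m+n]%n≡m%n (toℕ i) (suc k) ⟩
    toℕ i % suc k                 ≡⟨ m<n⇒m%n≡m (ℕ.m<n⇒m<1+n (Fin.toℕ<n i)) ⟩
    toℕ i                         ∎
    where open ≡-Reasoning

  position-next : ∀ {k} (i : Fin k) → position (next i) ≡ toℕ i
  position-next i = cong toℕ (prev-next i)

  position-injective : ∀ {k} {i j : Fin k} → position i ≡ position j → i ≡ j
  position-injective {i = i} {j} e =
    trans (sym (next-prev i)) (trans (cong next (Fin.toℕ-injective e)) (next-prev j))

  position-last : ∀ {k} (i : Fin (suc k)) → k ≤ position i → i ≡ zero
  position-last zero    k≤ = refl
  position-last (suc i) k≤ = contradiction (Fin.toℕ<n i) (ℕ.≤⇒≯ (subst (_ ≤_) (position-suc i) k≤))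

  ,-injectiveʳ : ∀ {A : Set} {B : A → Set} {x : A} {y z : B x} → _≡_ {A = Σ A B} (x , y) (x , z) → y ≡ z
  ,-injectiveʳ refl = refl

  subst-,  : ∀ {A : Set} {B : A → Set} {p : Σ A B} {x} {y : B x} (e : proj₁ p ≡ x) → p ≡ (x , y) → subst B e (proj₂ p) ≡ y
  subst-, refl refl = refl

  module Orbits {k : ℕ} {n : Fin (suc k) → ℕ} (f : ∀ i → Fin (n (suc i)) → Fin (n (next (suc i)))) where

    Chain : (∀ i → Fin (n i)) → Set
    Chain ω = ∀ i → f i (ω (suc i)) ≡ ω (next (suc i))

    Vertex : Set
    Vertex = Σ (Fin (suc k)) (Fin ∘ n)

    -- The walk waits at index zero, so that `k` steps lead there from every start. Carrying the
    -- index along with the vertex keeps these equations free of transports.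
    step : Vertex → Vertex
    step (zero  , v) = zero , v
    step (suc i , v) = next (suc i) , f i v

    private
      position-≥ : ∀ q t → t ≤ k → t ≤ position (proj₁ (fold q step t))
      position-≥ q zero    t≤k = z≤n
      position-≥ q (suc t) t<k with fold q step t | position-≥ q t (ℕ.<⇒≤ t<k)
      ... | zero  , v | le = subst (suc t ≤_) (sym position-zero) t<k
      ... | suc i , v | le = subst (suc t ≤_) (sym (position-next (suc i))) (ℕ.s≤s (subst (t ≤_) (position-suc i) le))

      ends-at-zero : ∀ q → proj₁ (fold q step k) ≡ zero
      ends-at-zero q = position-last _ (position-≥ q k ℕ.≤-refl)

    chain-fold : ∀ {ω} → Chain ω → ∀ t i → ∃ λ j → fold (i , ω i) step t ≡ (j , ω j)
    chain-fold chain zero    i = i , refl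
    chain-fold {ω} chain (suc t) i with chain-fold {ω} chain t i
    ... | zero  , e = zero , cong step e
    ... | suc j , e = next (suc j) , trans (cong step e) (cong (next (suc j) ,_) (chain j))

    chain-end : ∀ {ω} → Chain ω → ∀ i → fold (i , ω i) step k ≡ (zero , ω zero)
    chain-end {ω} chain i with chain-fold {ω} chain k i
    ... | j , e with refl ← trans (sym (cong proj₁ e)) (ends-at-zero (i , ω i)) = e

    module _ (v : Fin (n (next zero))) where

      private
        start : Vertex
        start = next zero , v

        position-start : ∀ t → t ≤ k → position (proj₁ (fold start step t)) ≡ t
        position-start zero    t≤k = position-next zero
        position-start (suc t) t<k with fold start step t | position-start t (ℕ.<⇒≤ t<k)
        ... | zero  , u | e = contradiction t<k (ℕ.≤⇒≯ (ℕ.≤-reflexive (trans (sym position-zero) e)))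
        ... | suc i , u | e = trans (position-next (suc i)) (cong suc (trans (sym (position-suc i)) e))

        index : ∀ i → proj₁ (fold start step (position i)) ≡ i
        index i = position-injective (position-start (position i) (ℕ.≤-pred (Fin.toℕ<n (prev i))))

      orbit : ∀ i → Fin (n i)
      orbit i = subst (Fin ∘ n) (index i) (proj₂ (fold start step (position i)))

      orbit-fold : ∀ i → fold start step (position i) ≡ (i , orbit i)
      orbit-fold i = pair (index i)
        where
        pair : ∀ {p : Vertex} {i} (e : proj₁ p ≡ i) → p ≡ (i , subst (Fin ∘ n) e (proj₂ p))
        pair refl = refl

      orbit-chain : Chain orbit
      orbit-chain i = ,-injectiveʳ (begin
        step (suc i , orbit (suc i))                   ≡⟨ cong step (orbit-fold (suc i)) ⟨
        fold start step (suc (position (suc i)))       ≡⟨ cong (fold start step) (trans (cong suc (position-suc i)) (sym (position-next (suc i)))) ⟩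
        fold start step (position (next (suc i)))      ≡⟨ orbit-fold (next (suc i)) ⟩
        (next (suc i) , orbit (next (suc i)))          ∎)
        where open ≡-Reasoning

      orbit-start : orbit (next zero) ≡ v
      orbit-start = ,-injectiveʳ (trans (sym (orbit-fold (next zero)))
        (cong (fold start step) (position-next {suc k} zero)))

      orbit-unique : ∀ {ω} → Chain ω → ω (next zero) ≡ v → ∀ i → ω i ≡ orbit i
      orbit-unique {ω} chain refl i with chain-fold {ω} chain (position i) (next zero)
      ... | j , e = ,-injectiveʳ {z = orbit i} (trans (sym (subst (λ l → fold (next zero , ω (next zero)) step (position i) ≡ (l , ω l)) j≡i e)) (orbit-fold i))
        where
        j≡i : j ≡ i
        j≡i = trans (sym (cong proj₁ e)) (index i)

      walk-fold : (g : Tuple n) → (∀ i u → g (suc i) u ≡ f i u) → ∀ u → g zero u ≡ v →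
                  ∀ t → t ≤ k → (fold zero next (suc t) , walk g zero (suc t) u) ≡ fold start step t
      walk-fold g g≡f u refl zero    t≤k = refl
      walk-fold g g≡f u refl (suc t) t<k = trans
        -- `walk` does not wait at index zero. It agrees with `step` here because the vertex reached
        -- has position `t`, which is less than the position `k` of index zero.
        (sym (step≡ _ λ e → ℕ.<⇒≢ t<k (begin
          t                                                ≡⟨ position-start t (ℕ.<⇒≤ t<k) ⟨
          position (proj₁ (fold start step t))             ≡⟨ cong (position ∘ proj₁) (walk-fold g g≡f u refl t (ℕ.<⇒≤ t<k)) ⟨
          position (fold zero next (suc t))                ≡⟨ cong position e ⟩
          position {suc k} zero                            ≡⟨ position-zero ⟩
          k                                                ∎)))
        (cong step (walk-fold g g≡f u refl t (ℕ.<⇒≤ t<k)))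
        where
        open ≡-Reasoning
        step≡ : ∀ q → proj₁ q ≢ zero → step q ≡ (next (proj₁ q) , g (proj₁ q) (proj₂ q))
        step≡ (zero  , w) ne = contradiction refl ne
        step≡ (suc i , w) ne = cong (next (suc i) ,_) (sym (g≡f i w))

    return : Fin (n (next zero)) → Fin (n zero)
    return v = orbit v zero

    composite-return : (g : Tuple n) → (∀ i u → g (suc i) u ≡ f i u) → ∀ u → composite g u ≡ return (g zero u)
    composite-return g g≡f u = subst-, (next^k zero)
      (trans (walk-fold (g zero u) g g≡f u refl k ℕ.≤-refl)
        (trans (cong (fold (next zero , g zero u) step) (sym (position-zero {k}))) (orbit-fold (g zero u) zero)))

    -- `w i j` determines `w zero j`, the vertex at which the walk from it comes to rest. Hence a
    -- coincidence at any index would force one at index zero.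
    chain-injective : ∀ {M} (w : ∀ i → Fin M → Fin (n i)) → (∀ j → Chain (λ i → w i j)) →
      (∀ {j l} → w zero j ≡ w zero l → j ≡ l) → ∀ i {j l} → w i j ≡ w i l → j ≡ l
    chain-injective w chain inj i {j} {l} e = inj (,-injectiveʳ (trans (sym (chain-end {λ i → w i j} (chain j) i))
      (trans (cong (λ v → fold (i , v) step k) e) (chain-end {λ i → w i l} (chain l) i))))

open ChainOrbits

-- Sums over lists of functions

module Sums {a} (K : CommutativeRing a a) where

  open CommutativeRing K hiding (zero)
  open import Data.List.Base using ([]; _∷_; _++_; map; foldr; filter; tabulate; cartesianProductWith)
  open import Algebra.Solver.CommutativeMonoid +-commutativeMonoid using (solve; _⊜_; _⊕_)
  open import Relation.Binary.Reasoning.Setoid setoid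
  module ∑ = SemiringSum semiring
  module ∏ = CommutativeMonoidSum *-commutativeMonoid
  open ∑ public using () renaming (sum to ∑)
  open ∏ public using () renaming (sum to ∏)
  open MonoidSums +-commutativeMonoid public using () renaming (sum-ε to ∑-zero; sum-single to ∑-single)
  open MonoidSums *-commutativeMonoid public using () renaming (sum-ε to ∏-one; sum-single to ∏-single)

  ∏-zero : ∀ {n} {f : Fin n → Carrier} i → f i ≈ 0# → ∏ f ≈ 0#
  ∏-zero zero    e = trans (*-congʳ e) (zeroˡ _)
  ∏-zero (suc i) e = trans (*-congˡ (∏-zero i e)) (zeroʳ _)

  sumOver : ∀ {b} {A : Set b} → List A → (A → Carrier) → Carrier
  sumOver xs f = foldr _+_ 0# (map f xs)

  module _ {b} {A : Set b} where

    sumOver-cong : ∀ (xs : List A) {f g : A → Carrier} → (∀ x → f x ≈ g x) → sumOver xs f ≈ sumOver xs g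
    sumOver-cong []       e = refl
    sumOver-cong (x ∷ xs) e = +-cong (e x) (sumOver-cong xs e)

    sumOver-zero : ∀ (xs : List A) {f : A → Carrier} → (∀ x → f x ≈ 0#) → sumOver xs f ≈ 0#
    sumOver-zero []       e = refl
    sumOver-zero (x ∷ xs) e = trans (+-cong (e x) (sumOver-zero xs e)) (+-identityˡ 0#)

    sumOver-+ : ∀ (xs : List A) (f g : A → Carrier) →
                sumOver xs (λ x → f x + g x) ≈ sumOver xs f + sumOver xs g
    sumOver-+ []       f g = sym (+-identityˡ 0#)
    sumOver-+ (x ∷ xs) f g = trans (+-congˡ (sumOver-+ xs f g))
      (solve 4 (λ p q r s → (p ⊕ q) ⊕ (r ⊕ s) ⊜ (p ⊕ r) ⊕ (q ⊕ s)) refl _ _ _ _)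

    sumOver-*ˡ : ∀ (xs : List A) r (f : A → Carrier) → sumOver xs (λ x → r * f x) ≈ r * sumOver xs f
    sumOver-*ˡ []       r f = sym (zeroʳ r)
    sumOver-*ˡ (x ∷ xs) r f = trans (+-congˡ (sumOver-*ˡ xs r f)) (sym (distribˡ r _ _))

    sumOver-*ʳ : ∀ (xs : List A) r (f : A → Carrier) → sumOver xs (λ x → f x * r) ≈ sumOver xs f * r
    sumOver-*ʳ xs r f = trans (sumOver-cong xs λ x → *-comm (f x) r)
      (trans (sumOver-*ˡ xs r f) (*-comm r _))

    sumOver-++ : ∀ (xs ys : List A) (f : A → Carrier) → sumOver (xs ++ ys) f ≈ sumOver xs f + sumOver ys f
    sumOver-++ []       ys f = sym (+-identityˡ _)
    sumOver-++ (x ∷ xs) ys f = trans (+-congˡ (sumOver-++ xs ys f)) (sym (+-assoc _ _ _))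

    sumOver-∑ : ∀ (xs : List A) {n} (f : A → Fin n → Carrier) →
                sumOver xs (λ x → ∑ (f x)) ≈ ∑ (λ i → sumOver xs (λ x → f x i))
    sumOver-∑ []       {n} f = sym (∑.sum-replicate-zero n)
    sumOver-∑ (x ∷ xs) f = trans (+-congˡ (sumOver-∑ xs f)) (sym (∑.∑-distrib-+ (f x) _))

  sumOver-comm : ∀ {b c} {A : Set b} {B : Set c} (xs : List A) (ys : List B) (f : A → B → Carrier) →
                 sumOver xs (λ x → sumOver ys (f x)) ≈ sumOver ys (λ y → sumOver xs (λ x → f x y))
  sumOver-comm []       ys f = sym (sumOver-zero ys λ _ → refl)
  sumOver-comm (x ∷ xs) ys f = trans (+-congˡ (sumOver-comm xs ys f)) (sym (sumOver-+ ys (f x) _))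

  sumOver-map : ∀ {b c} {A : Set b} {B : Set c} (h : A → B) (xs : List A) (f : B → Carrier) →
                sumOver (map h xs) f ≡ sumOver xs (f ∘ h)
  sumOver-map h []       f = ≡.refl
  sumOver-map h (x ∷ xs) f = ≡.cong (f (h x) +_) (sumOver-map h xs f)

  sumOver-tabulate : ∀ {b} {A : Set b} {n} (h : Fin n → A) (f : A → Carrier) →
                     sumOver (tabulate h) f ≡ ∑ (f ∘ h)
  sumOver-tabulate {n = zero}  h f = ≡.refl
  sumOver-tabulate {n = suc n} h f = ≡.cong (f (h zero) +_) (sumOver-tabulate (h ∘ suc) f)

  sumOver-allFin : ∀ n (f : Fin n → Carrier) → sumOver (allFin n) f ≈ ∑ f
  sumOver-allFin n f = reflexive (sumOver-tabulate (λ i → i) f)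

  sumOver-cartesianProductWith : ∀ {b c d} {A : Set b} {B : Set c} {C : Set d}
    (h : A → B → C) (xs : List A) (ys : List B) (f : C → Carrier) →
    sumOver (cartesianProductWith h xs ys) f ≈ sumOver xs (λ x → sumOver ys (λ y → f (h x y)))
  sumOver-cartesianProductWith h []       ys f = refl
  sumOver-cartesianProductWith h (x ∷ xs) ys f = begin
    sumOver (map (h x) ys ++ cartesianProductWith h xs ys) f
      ≈⟨ sumOver-++ (map (h x) ys) _ f ⟩
    sumOver (map (h x) ys) f + sumOver (cartesianProductWith h xs ys) f
      ≈⟨ +-cong (reflexive (sumOver-map (h x) ys f)) (sumOver-cartesianProductWith h xs ys f) ⟩
    sumOver ys (f ∘ h x) + sumOver xs (λ x → sumOver ys (λ y → f (h x y)))
      ∎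

  ∏-sumOver : ∀ {k} {A : Fin k → Set} (as : ∀ i → List (A i)) (φ : ∀ i → A i → Carrier) →
              sumOver (functions as) (λ f → ∏ (λ i → φ i (f i))) ≈ ∏ (λ i → sumOver (as i) (φ i))
  ∏-sumOver {zero}  as φ = +-identityʳ 1#
  ∏-sumOver {suc k} as φ = begin
    sumOver (functions as) (λ f → ∏ (λ i → φ i (f i)))
      ≈⟨ sumOver-cartesianProductWith _ (as zero) (functions (as ∘ suc)) _ ⟩
    sumOver (as zero) (λ x → sumOver (functions (as ∘ suc)) (λ f → φ zero x * ∏ (λ i → φ (suc i) (f i))))
      ≈⟨ sumOver-cong (as zero) (λ x → trans (sumOver-*ˡ (functions (as ∘ suc)) (φ zero x) _)
           (*-congˡ (∏-sumOver (as ∘ suc) (λ i → φ (suc i))))) ⟩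
    sumOver (as zero) (λ x → φ zero x * ∏ (λ i → sumOver (as (suc i)) (φ (suc i))))
      ≈⟨ sumOver-*ʳ (as zero) _ (φ zero) ⟩
    sumOver (as zero) (φ zero) * ∏ (λ i → sumOver (as (suc i)) (φ (suc i)))
      ∎

  maps : ∀ m p → List (Fin m → Fin p)
  maps m p = functions (λ _ → allFin p)

  ∏-∑ : ∀ {m p} (φ : Fin m → Fin p → Carrier) →
        sumOver (maps m p) (λ f → ∏ (λ i → φ i (f i))) ≈ ∏ (λ i → ∑ (φ i))
  ∏-∑ {m} {p} φ = trans (∏-sumOver (λ _ → allFin p) φ) (∏.sum-cong-≋ λ i → sumOver-allFin p (φ i))

  -- Each class is represented exactly once, as far as sums in `K` can tell. Functions are listed
  -- only up to pointwise equality, so a summand is prescribed on a whole class and not at a single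
  -- entry.
  Listing : ∀ {A : Set} → List A → (A → A → Set) → Set a
  Listing {A} xs _~_ = ∀ x t (G : A → Carrier) →
    (∀ y → y ~ x → G y ≈ t) → (∀ y → ¬ (y ~ x) → G y ≈ 0#) → sumOver xs G ≈ t

  allFin-listing : ∀ n → Listing (allFin n) _≡_
  allFin-listing n x t G on off = trans (sumOver-allFin n G) (trans (∑-single x off) (on x ≡.refl))

  functions-listing : ∀ {k} {A : Fin k → Set} {as : ∀ i → List (A i)} {_~_ : ∀ {i} → A i → A i → Set} →
    (∀ {i} (x y : A i) → Dec (x ~ y)) → (∀ i → Listing (as i) _~_) →
    Listing (functions as) (λ f g → ∀ i → f i ~ g i)
  functions-listing {zero}  dec l x t G on off = trans (+-identityʳ _) (on _ λ ())
  functions-listing {suc k} {as = as} {_~_} dec l x t G on off = trans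
    (sumOver-cartesianProductWith _ (as zero) (functions (as ∘ suc)) G)
    (l zero (x zero) t _
      (λ y y~x → functions-listing {_~_ = _~_} dec (l ∘ suc) (x ∘ suc) t _
        (λ g g~x → on _ λ { zero → y~x ; (suc i) → g~x i })
        (λ g g≁x → off _ λ c → g≁x (c ∘ suc)))
      (λ y y≁x → sumOver-zero (functions (as ∘ suc)) λ g → off _ λ c → y≁x (c zero)))

  maps-listing : ∀ m p → Listing (maps m p) _≗_
  maps-listing m p = functions-listing {_~_ = _≡_} Fin._≟_ (λ _ → allFin-listing p)

  𝟙ᵇ : Bool → Carrier
  𝟙ᵇ true  = 1#
  𝟙ᵇ false = 0#

  𝟙 : ∀ {P : Set} → Dec P → Carrier
  𝟙 d = 𝟙ᵇ (does d)

  module _ {P : Set} where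

    𝟙-yes : (d : Dec P) → P → 𝟙 d ≈ 1#
    𝟙-yes (yes _) p = refl
    𝟙-yes (no ¬p) p = contradiction p ¬p

    𝟙-no : (d : Dec P) → ¬ P → 𝟙 d ≈ 0#
    𝟙-no (yes p) ¬p = contradiction p ¬p
    𝟙-no (no _)  ¬p = refl

    𝟙-⇔ : ∀ {Q : Set} (d : Dec P) (e : Dec Q) → (P → Q) → (Q → P) → 𝟙 d ≈ 𝟙 e
    𝟙-⇔ d (yes q) to from = 𝟙-yes d (from q)
    𝟙-⇔ d (no ¬q) to from = 𝟙-no d (¬q ∘ to)

    𝟙-× : ∀ {Q : Set} (d : Dec P) (e : Dec Q) → 𝟙 (d ×-dec e) ≈ 𝟙 d * 𝟙 e
    𝟙-× (yes _) (yes _) = sym (*-identityˡ 1#)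
    𝟙-× (yes _) (no _)  = sym (*-identityˡ 0#)
    𝟙-× (no _)  e       = sym (zeroˡ _)

    𝟙-guard : (d : Dec P) {x y : Carrier} → (P → x ≈ y) → 𝟙 d * x ≈ 𝟙 d * y
    𝟙-guard (yes p) e = *-congˡ (e p)
    𝟙-guard (no ¬p) e = trans (zeroˡ _) (sym (zeroˡ _))

  sumOver-filter : ∀ {b} {A : Set b} {Q : A → Set} (q : ∀ x → Dec (Q x)) (xs : List A) (f : A → Carrier) →
                   sumOver (filter q xs) f ≈ sumOver xs (λ x → 𝟙 (q x) * f x)
  sumOver-filter q []       f = refl
  sumOver-filter q (x ∷ xs) f with q x
  ... | yes _ = +-cong (sym (*-identityˡ _)) (sumOver-filter q xs f)
  ... | no _  = sym (trans (+-cong (zeroˡ _) (sym (sumOver-filter q xs f))) (+-identityˡ _))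

  𝟙-∏ : ∀ {n} {P : Fin n → Set} (d : ∀ i → Dec (P i)) (e : Dec (∀ i → P i)) → ∏ (λ i → 𝟙 (d i)) ≈ 𝟙 e
  𝟙-∏ d (yes p) = ∏-one λ i → 𝟙-yes (d i) (p i)
  𝟙-∏ d (no ¬p) with Fin.¬∀⟶∃¬ _ _ d ¬p
  ... | i , ¬pᵢ = ∏-zero i (𝟙-no (d i) ¬pᵢ)

  ∑-𝟙 : ∀ {n} (f : Fin n → Carrier) u → ∑ (λ v → 𝟙 (u Fin.≟ v) * f v) ≈ f u
  ∑-𝟙 f u = trans (∑-single u λ v v≢u → trans (*-congʳ (𝟙-no (u Fin.≟ v) (v≢u ∘ ≡.sym))) (zeroˡ _))
    (trans (*-congʳ (𝟙-yes (u Fin.≟ u) ≡.refl)) (*-identityˡ _))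

  push : ∀ {p q} → (Fin p → Fin q) → (Fin p → Carrier) → Fin q → Carrier
  push σ y u = ∑ (λ v → 𝟙 (σ v Fin.≟ u) * y v)

  ∑-push : ∀ {p q} (σ : Fin p → Fin q) y (r : Fin q → Carrier) →
           ∑ (λ u → push σ y u * r u) ≈ ∑ (λ v → y v * r (σ v))
  ∑-push {p} {q} σ y r = begin
    ∑ (λ u → push σ y u * r u)
      ≈⟨ ∑.sum-cong-≋ (λ u → ∑.*-distribʳ-sum {p} (r u) _) ⟩
    ∑ (λ u → ∑ (λ v → 𝟙 (σ v Fin.≟ u) * y v * r u))
      ≈⟨ ∑.∑-comm {q} {p} _ ⟩
    ∑ (λ v → ∑ (λ u → 𝟙 (σ v Fin.≟ u) * y v * r u))
      ≈⟨ ∑.sum-cong-≋ (λ v → trans (∑.sum-cong-≋ {q} λ u → *-assoc _ _ _) (∑-𝟙 (λ u → y v * r u) (σ v))) ⟩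
    ∑ (λ v → y v * r (σ v))
      ∎

  Extensional : ∀ {m p} → ((Fin m → Fin p) → Carrier) → Set a
  Extensional F = ∀ {f g} → f ≗ g → F f ≈ F g

  -- The values of `f` are weighted independently, so the `f` with `σ ∘ f` equal to a given `g` have
  -- as total weight the product of the fibre weights. This one change of variables serves for
  -- contraction, for adjoining the terminal vertex and for replacing f₁ by the composite.
  push-sumOver : ∀ {m p q} (σ : Fin p → Fin q) (W : Fin m → Fin p → Carrier) {F : (Fin m → Fin q) → Carrier} →
    Extensional F →
    sumOver (maps m p) (λ f → ∏ (λ i → W i (f i)) * F (σ ∘ f)) ≈
    sumOver (maps m q) (λ g → ∏ (λ i → push σ (W i) (g i)) * F g)
  push-sumOver {m} {p} {q} σ W {F} ext = sym (begin
    sumOver (maps m q) (λ g → ∏ (λ i → push σ (W i) (g i)) * F g)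
      ≈⟨ sumOver-cong (maps m q) (λ g → trans
           (*-congʳ (sym (∏-∑ (λ i v → 𝟙 (σ v Fin.≟ g i) * W i v))))
           (sym (sumOver-*ʳ (maps m p) (F g) _))) ⟩
    sumOver (maps m q) (λ g → sumOver (maps m p) (λ f → ∏ (λ i → 𝟙 (σ (f i) Fin.≟ g i) * W i (f i)) * F g))
      ≈⟨ sumOver-comm (maps m q) (maps m p) _ ⟩
    sumOver (maps m p) (λ f → sumOver (maps m q) (λ g → ∏ (λ i → 𝟙 (σ (f i) Fin.≟ g i) * W i (f i)) * F g))
      ≈⟨ sumOver-cong (maps m p) (λ f → maps-listing m q (σ ∘ f) _ _
           (λ g g≗ → *-cong
             (∏.sum-cong-≋ λ i → trans (*-congʳ (𝟙-yes (σ (f i) Fin.≟ g i) (≡.sym (g≗ i)))) (*-identityˡ _))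
             (ext g≗))
           (λ g g≗̸ → differ f g g≗̸)) ⟩
    sumOver (maps m p) (λ f → ∏ (λ i → W i (f i)) * F (σ ∘ f))
      ∎)
    where
    differ : ∀ f g → ¬ (g ≗ σ ∘ f) → ∏ (λ i → 𝟙 (σ (f i) Fin.≟ g i) * W i (f i)) * F g ≈ 0#
    differ f g g≗̸ with Fin.¬∀⟶∃¬ _ _ (λ i → g i Fin.≟ σ (f i)) g≗̸
    ... | i , ne = trans (*-congʳ (∏-zero i (trans (*-congʳ (𝟙-no (σ (f i) Fin.≟ g i) (ne ∘ ≡.sym))) (zeroˡ _))))
                         (zeroˡ _)

open import Data.Vec.Functional using (_∷_; _++_)
open import Data.Vec.Functional.Properties using (lookup-++ˡ; lookup-++ʳ)

-- Elementary symmetric polynomials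

module ElementarySymmetric {a} (K : CommutativeRing a a) where

  open CommutativeRing K hiding (zero)
  open Sums K
  open SemiringMult semiring using (_×_; ×-congʳ; ×-congˡ; ×-assocˡ; ×-comm-*)
  open import Algebra.Properties.CommutativeMonoid.Mult +-commutativeMonoid using (×-distrib-+)
  open import Algebra.Solver.CommutativeMonoid *-commutativeMonoid using (solve; _⊜_) renaming (_⊕_ to _⊛_)
  open import Relation.Binary.Reasoning.Setoid setoid

  ×-zeroʳ : ∀ m → m × 0# ≈ 0#
  ×-zeroʳ m = trans (sym (∑.sum-replicate m)) (∑.sum-replicate-zero m)

  ∑-× : ∀ {n} m (f : Fin n → Carrier) → ∑ (λ i → m × f i) ≈ m × ∑ f
  ∑-× {zero}  m f = sym (×-zeroʳ m)
  ∑-× {suc n} m f = trans (+-congˡ (∑-× m (f ∘ suc))) (sym (×-distrib-+ (f zero) (∑ (f ∘ suc)) m))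

  sumOver-maps-suc : ∀ m p {G : (Fin (suc m) → Fin p) → Carrier} → Extensional G →
                     sumOver (maps (suc m) p) G ≈ ∑ (λ u → sumOver (maps m p) (λ c → G (u ∷ c)))
  sumOver-maps-suc m p ext = trans
    (sumOver-cartesianProductWith _ (allFin p) (maps m p) _)
    (trans (sumOver-allFin p _) (∑.sum-cong-≋ {p} λ u → sumOver-cong (maps m p) λ c →
      ext λ { zero → ≡.refl ; (suc i) → ≡.refl }))

  esym : ∀ {n} → ℕ → (Fin n → Carrier) → Carrier
  esym zero x = 1#
  esym {zero}  (suc s) x = 0#
  esym {suc n} (suc s) x = x zero * esym s (x ∘ suc) + esym (suc s) (x ∘ suc)

  esym-cong : ∀ {n} s {x y : Fin n → Carrier} → (∀ i → x i ≈ y i) → esym s x ≈ esym s y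
  esym-cong zero e = refl
  esym-cong {zero}  (suc s) e = refl
  esym-cong {suc n} (suc s) e = +-cong (*-cong (e zero) (esym-cong s (e ∘ suc))) (esym-cong (suc s) (e ∘ suc))

  esym-zero-head : ∀ {n} s {x : Fin (suc n) → Carrier} → x zero ≈ 0# → esym s x ≈ esym s (x ∘ suc)
  esym-zero-head zero    e = refl
  esym-zero-head (suc s) e = trans (+-congʳ (trans (*-congʳ e) (zeroˡ _))) (+-identityˡ _)

  -- A variable is removed by setting it to zero. The index set stays the same, and the condition
  -- that a sequence avoids `u` is absorbed into its monomial by `monomial-omit`.
  omit : ∀ {n} → Fin n → (Fin n → Carrier) → Fin n → Carrier
  omit u x v = 𝟙 (¬? (u Fin.≟ v)) * x v

  after : ∀ {n} → Fin n → (Fin n → Carrier) → Fin n → Carrier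
  after u x v = 𝟙 (u Fin.<? v) * x v

  -- A squarefree monomial of degree `suc s` arises once from each of its variables in the role of
  -- `x u`.
  ∑-esym-omit : ∀ {n} s (x : Fin n → Carrier) → ∑ (λ u → x u * esym s (omit u x)) ≈ suc s × esym (suc s) x
  ∑-esym-omit {zero}  s x = sym (×-zeroʳ (suc s))
  ∑-esym-omit {suc n} zero x = begin
    x zero * 1# + ∑ (λ u → x (suc u) * 1#)       ≈⟨ +-congˡ (∑-esym-omit zero (x ∘ suc)) ⟩
    x zero * 1# + (esym 1 (x ∘ suc) + 0#)        ≈⟨ +-assoc _ _ _ ⟨
    x zero * 1# + esym 1 (x ∘ suc) + 0#          ∎
  ∑-esym-omit {suc n} (suc s) x = begin
    x₀ * esym (suc s) (omit zero x) + ∑ (λ u → x (suc u) * esym (suc s) (omit (suc u) x))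
      ≈⟨ +-cong (*-congˡ (trans (esym-zero-head (suc s) {omit zero x} (zeroˡ x₀))
                                (esym-cong {n} (suc s) λ v → *-identityˡ _)))
                (∑.sum-cong-≋ {n} λ u → trans
                  (*-congˡ (+-cong (*-cong (*-identityˡ x₀) (esym-cong s λ v → 𝟙-suc u v))
                                   (esym-cong (suc s) λ v → 𝟙-suc u v)))
                  (trans (distribˡ _ _ _)
                    (+-congʳ (solve 3 (λ p q r → p ⊛ (q ⊛ r) ⊜ q ⊛ (p ⊛ r)) refl _ _ _)))) ⟩
    x₀ * e₁ + ∑ (λ u → x₀ * (x′ u * esym s (omit u x′)) + x′ u * esym (suc s) (omit u x′))
      ≈⟨ +-congˡ (trans (∑.∑-distrib-+ (λ u → x₀ * (x′ u * esym s (omit u x′))) _) (+-cong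
           (trans (sym (∑.*-distribˡ-sum x₀ λ u → x′ u * esym s (omit u x′))) (*-congˡ (∑-esym-omit s x′)))
           (∑-esym-omit (suc s) x′))) ⟩
    x₀ * e₁ + (x₀ * (suc s × e₁) + suc (suc s) × e₂)
      ≈⟨ trans (sym (+-assoc _ _ _)) (+-congʳ (+-congˡ (×-comm-* (suc s) x₀ e₁))) ⟩
    suc (suc s) × (x₀ * e₁) + suc (suc s) × e₂
      ≈⟨ ×-distrib-+ (x₀ * e₁) e₂ (suc (suc s)) ⟨
    suc (suc s) × (x₀ * e₁ + e₂)
      ∎
    where
    x₀ = x zero
    x′ = x ∘ suc
    e₁ = esym (suc s) x′
    e₂ = esym (suc (suc s)) x′
    𝟙-suc : ∀ u v → omit (suc u) x (suc v) ≈ omit u x′ v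
    𝟙-suc u v = *-congʳ (𝟙-⇔ (¬? (suc u Fin.≟ suc v)) (¬? (u Fin.≟ v))
      (λ ne → ne ∘ ≡.cong suc) (λ ne → ne ∘ Fin.suc-injective))

  -- Here a squarefree monomial arises only once, with `u` its least index, so no multiplicity
  -- appears.
  ∑-esym-after : ∀ {n} s (x : Fin n → Carrier) → ∑ (λ u → x u * esym s (after u x)) ≈ esym (suc s) x
  ∑-esym-after {zero}  s x = refl
  ∑-esym-after {suc n} s x = +-cong
    (*-congˡ (trans (esym-zero-head s {after zero x} (zeroˡ _)) (esym-cong s λ v → *-identityˡ _)))
    (trans (∑.sum-cong-≋ {n} λ u → *-congˡ {x (suc u)} (trans (esym-zero-head s {after (suc u) x} (zeroˡ _))
             (esym-cong s λ v → *-congʳ (𝟙-⇔ (suc u Fin.<? suc v) (u Fin.<? v) ℕ.≤-pred s≤s))))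
           (∑-esym-after s (x ∘ suc)))

  module _ {M n : ℕ} where

    abstract
      injective? : (c : Fin M → Fin n) → Dec (Injective _≡_ _≡_ c)
      injective? c = map′ (λ inj {i} {j} → inj i j) (λ inj i j → inj)
        (Fin.all? λ i → Fin.all? λ j → (c i Fin.≟ c j) →-dec (i Fin.≟ j))

      avoids? : (u : Fin n) (c : Fin M → Fin n) → Dec (∀ j → u ≢ c j)
      avoids? u c = Fin.all? λ j → ¬? (u Fin.≟ c j)

      precedes? : (u : Fin n) (c : Fin M → Fin n) → Dec (∀ j → u < c j)
      precedes? u c = Fin.all? λ j → u Fin.<? c j

    Injective-resp : {c d : Fin M → Fin n} → c ≗ d → Injective _≡_ _≡_ c → Injective _≡_ _≡_ d
    Injective-resp e inj q = inj (≡.trans (e _) (≡.trans q (≡.sym (e _))))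

    monomial-cong : ∀ (x : Fin n → Carrier) {c d : Fin M → Fin n} → c ≗ d → ∏ (x ∘ c) ≈ ∏ (x ∘ d)
    monomial-cong x e = ∏.sum-cong-≋ λ i → reflexive (≡.cong x (e i))

    monomial-omit : ∀ (x : Fin n → Carrier) u (c : Fin M → Fin n) →
                    𝟙 (avoids? u c) * ∏ (x ∘ c) ≈ ∏ (omit u x ∘ c)
    monomial-omit x u c = trans
      (*-congʳ (sym (𝟙-∏ (λ j → ¬? (u Fin.≟ c j)) (avoids? u c))))
      (sym (∏.∑-distrib-+ (λ j → 𝟙 (¬? (u Fin.≟ c j))) (x ∘ c)))

    monomial-after : ∀ (x : Fin n → Carrier) u (c : Fin M → Fin n) →
                     𝟙 (precedes? u c) * ∏ (x ∘ c) ≈ ∏ (after u x ∘ c)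
    monomial-after x u c = trans
      (*-congʳ (sym (𝟙-∏ (λ j → u Fin.<? c j) (precedes? u c))))
      (sym (∏.∑-distrib-+ (λ j → 𝟙 (u Fin.<? c j)) (x ∘ c)))

  abstract
    normal? : ∀ {m n} (c : Fin (suc m) → Fin n) → Dec (Normal c)
    normal? c = precedes? (c zero) (c ∘ suc) ×-dec injective? (c ∘ suc)

  Normal-resp : ∀ {m n} {c d : Fin (suc m) → Fin n} → c ≗ d → Normal c → Normal d
  Normal-resp e (lt , inj) = (λ j → ≡.subst₂ _<_ (e zero) (e (suc j)) (lt j)) , Injective-resp (e ∘ suc) inj

  ∷-injective : ∀ {M n} {u : Fin n} {c : Fin M → Fin n} → (∀ j → u ≢ c j) → Injective _≡_ _≡_ c → Injective _≡_ _≡_ (u ∷ c)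
  ∷-injective av inj {zero}  {zero}  e = ≡.refl
  ∷-injective av inj {zero}  {suc j} e = contradiction e (av j)
  ∷-injective av inj {suc i} {zero}  e = contradiction (≡.sym e) (av i)
  ∷-injective av inj {suc i} {suc j} e = ≡.cong suc (inj e)

  injectiveSum : ∀ M {n} → (Fin n → Carrier) → Carrier
  injectiveSum M {n} x = sumOver (maps M n) (λ c → 𝟙 (injective? c) * ∏ (x ∘ c))

  normalSum : ∀ m {n} → (Fin n → Carrier) → Carrier
  normalSum m {n} x = sumOver (maps (suc m) n) (λ c → 𝟙 (normal? c) * ∏ (x ∘ c))

  private
    rearrange : ∀ p q r s → p * q * (r * s) ≈ r * (q * (p * s))
    rearrange = solve 4 (λ p q r s → (p ⊛ q) ⊛ (r ⊛ s) ⊜ r ⊛ (q ⊛ (p ⊛ s))) refl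

  injectiveSum≈ : ∀ M {n} (x : Fin n → Carrier) → injectiveSum M x ≈ (M !) × esym M x
  injectiveSum≈ zero {n} x = sumOver-cong (maps 0 n) λ c →
    trans (*-identityʳ _) (𝟙-yes (injective? {0} {n} c) λ { {()} })
  injectiveSum≈ (suc M) {n} x = begin
    injectiveSum (suc M) x
      ≈⟨ sumOver-maps-suc M n (λ {c} {d} e → *-cong
           (𝟙-⇔ (injective? c) (injective? d) (λ i → Injective-resp e i) (λ i → Injective-resp (≡.sym ∘ e) i))
           (monomial-cong x e)) ⟩
    ∑ (λ u → sumOver (maps M n) (λ c → 𝟙 (injective? (u ∷ c)) * (x u * ∏ (x ∘ c))))
      ≈⟨ ∑.sum-cong-≋ {n} (λ u → trans
           (sumOver-cong (maps M n) λ c → trans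
             (*-congʳ (trans (𝟙-⇔ (injective? (u ∷ c)) (avoids? u c ×-dec injective? c) split (λ (av , inj) → ∷-injective av inj))
                             (𝟙-× (avoids? u c) (injective? c))))
             (trans (rearrange _ _ _ _) (*-congˡ (*-congˡ (monomial-omit x u c)))))
           (sumOver-*ˡ (maps M n) (x u) _)) ⟩
    ∑ (λ u → x u * injectiveSum M (omit u x))
      ≈⟨ ∑.sum-cong-≋ {n} (λ u → trans (*-congˡ (injectiveSum≈ M (omit u x))) (×-comm-* (M !) _ _)) ⟩
    ∑ (λ u → (M !) × (x u * esym M (omit u x)))
      ≈⟨ trans (∑-× {n} (M !) _) (×-congʳ (M !) (∑-esym-omit M x)) ⟩
    (M !) × (suc M × esym (suc M) x)
      ≈⟨ trans (×-assocˡ _ (M !) (suc M)) (×-congˡ (ℕ.*-comm (M !) (suc M))) ⟩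
    (suc M !) × esym (suc M) x
      ∎
    where
    split : ∀ {u} {c : Fin M → Fin n} → Injective _≡_ _≡_ (u ∷ c) → (∀ j → u ≢ c j) Product.× Injective _≡_ _≡_ c
    split {u} {c} inj = (λ j e → Fin.0≢1+n (inj {zero} {suc j} e)) , λ e → Fin.suc-injective (inj e)

  -- The head is forced to be the least index, and only the other `m` entries can be ordered freely.
  normalSum≈ : ∀ m {n} (x : Fin n → Carrier) → normalSum m x ≈ (m !) × esym (suc m) x
  normalSum≈ m {n} x = begin
    normalSum m x
      ≈⟨ sumOver-maps-suc m n (λ {c} {d} e → *-cong
           (𝟙-⇔ (normal? c) (normal? d) (Normal-resp e) (Normal-resp (≡.sym ∘ e))) (monomial-cong x e)) ⟩
    ∑ (λ u → sumOver (maps m n) (λ c → 𝟙 (normal? (u ∷ c)) * (x u * ∏ (x ∘ c))))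
      ≈⟨ ∑.sum-cong-≋ {n} (λ u → trans
           (sumOver-cong (maps m n) λ c → trans
             (*-congʳ (trans (𝟙-⇔ (normal? (u ∷ c)) (precedes? u c ×-dec injective? c) id id)
                             (𝟙-× (precedes? u c) (injective? c))))
             (trans (rearrange _ _ _ _) (*-congˡ (*-congˡ (monomial-after x u c)))))
           (sumOver-*ˡ (maps m n) (x u) _)) ⟩
    ∑ (λ u → x u * injectiveSum m (after u x))
      ≈⟨ ∑.sum-cong-≋ {n} (λ u → trans (*-congˡ (injectiveSum≈ m (after u x))) (×-comm-* (m !) _ _)) ⟩
    ∑ (λ u → (m !) × (x u * esym m (after u x)))
      ≈⟨ trans (∑-× {n} (m !) _) (×-congʳ (m !) (∑-esym-after m x)) ⟩
    (m !) × esym (suc m) x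
      ∎

  -- Given the `suc (suc m)` vertices of a monomial, any of them may be the avoided vertex `u`; the
  -- rest then have `m !` normal orderings. This is one of the factors N + 1 in the negative term.
  normalSum-avoiding : ∀ m {n} (x : Fin n → Carrier) →
    sumOver (maps (suc m) n) (λ c → 𝟙 (normal? c) * ∑ (λ u → 𝟙 (avoids? u c) * (x u * ∏ (x ∘ c)))) ≈
    (m !) × (suc (suc m) × esym (suc (suc m)) x)
  normalSum-avoiding m {n} x = begin
    sumOver (maps (suc m) n) (λ c → 𝟙 (normal? c) * ∑ (λ u → 𝟙 (avoids? u c) * (x u * ∏ (x ∘ c))))
      ≈⟨ sumOver-cong (maps (suc m) n) (λ c → trans (∑.*-distribˡ-sum {n} (𝟙 (normal? c)) _)
           (∑.sum-cong-≋ {n} λ u → trans (solve 4 (λ p q r s → p ⊛ (q ⊛ (r ⊛ s)) ⊜ r ⊛ (p ⊛ (q ⊛ s))) refl _ _ _ _)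
             (*-congˡ {x u} (*-congˡ (monomial-omit x u c))))) ⟩
    sumOver (maps (suc m) n) (λ c → ∑ (λ u → x u * (𝟙 (normal? c) * ∏ (omit u x ∘ c))))
      ≈⟨ sumOver-∑ (maps (suc m) n) {n} _ ⟩
    ∑ (λ u → sumOver (maps (suc m) n) (λ c → x u * (𝟙 (normal? c) * ∏ (omit u x ∘ c))))
      ≈⟨ ∑.sum-cong-≋ {n} (λ u → trans (sumOver-*ˡ (maps (suc m) n) (x u) _)
           (trans (*-congˡ {x u} (normalSum≈ m (omit u x))) (×-comm-* (m !) _ _))) ⟩
    ∑ (λ u → (m !) × (x u * esym (suc m) (omit u x)))
      ≈⟨ trans (∑-× {n} (m !) _) (×-congʳ (m !) (∑-esym-omit (suc m) x)) ⟩
    (m !) × (suc (suc m) × esym (suc (suc m)) x)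
      ∎

-- Weighted forests

module Forests {a} (K : CommutativeRing a a) where

  open CommutativeRing K hiding (zero)
  open Sums K
  open ElementarySymmetric K using (sumOver-maps-suc; avoids?)
  open SemiringExp semiring using (_^_)
  open import Algebra.Solver.Ring.NaturalCoefficients.Default commutativeSemiring using (solve; _:=_; _:+_; _:*_)
  open import Relation.Binary.Reasoning.Setoid setoid

  if-cong : ∀ b {x y x′ y′ : Carrier} → x ≈ x′ → y ≈ y′ → (if b then x else y) ≈ (if b then x′ else y′)
  if-cong true  e e′ = e
  if-cong false e e′ = e′

  ∑-push-total : ∀ {p q} (σ : Fin p → Fin q) y → ∑ (push σ y) ≈ ∑ y
  ∑-push-total {p} {q} σ y = trans (∑.sum-cong-≋ {q} λ u → sym (*-identityʳ _))
    (trans (∑-push σ y (λ _ → 1#)) (∑.sum-cong-≋ {p} λ v → *-identityʳ _))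

  push-cong : ∀ {p q} (σ : Fin p → Fin q) {y z : Fin p → Carrier} → (∀ v → y v ≈ z v) →
              ∀ u → push σ y u ≈ push σ z u
  push-cong {p} σ e u = ∑.sum-cong-≋ {p} λ v → *-congˡ (e v)

  rootWeight : ∀ {m} → (Fin m → Bool) → (Fin (suc m) → Carrier) → Carrier
  rootWeight b y = ∑ (λ t → y t * 𝟙ᵇ ((true ∷ b) t))

  -- The total weight of the forests on u non-root vertices, when the roots have total weight f
  -- and all vertices together have total weight s.
  forestWeight : ℕ → Carrier → Carrier → Carrier
  forestWeight zero    f s = 1#
  forestWeight (suc u) f s = f * s ^ u

  ^-cong : ∀ u {s t} → s ≈ t → s ^ u ≈ t ^ u
  ^-cong zero    e = refl
  ^-cong (suc u) e = *-cong e (^-cong u e)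

  forestWeight-cong : ∀ u {f f′ s s′} → f ≈ f′ → s ≈ s′ → forestWeight u f s ≈ forestWeight u f′ s′
  forestWeight-cong zero    e e′ = refl
  forestWeight-cong (suc u) e e′ = *-cong e (^-cong u e′)

  module _ {m : ℕ} (b : Fin m → Bool) (y : Fin (suc (suc m)) → Carrier) where

    private
      y₀ = y zero
      y₁ = y (suc zero)
      φ = ∑ (λ u → y (suc (suc u)) * 𝟙ᵇ (b u))
      Y = ∑ (λ u → y (suc (suc u)))
      s = ∑ y
      n = unmarked b

    -- Vertex zero hands its weight `y₁` over to `τ`, where it counts towards the roots exactly if
    -- `τ` is a root.
    rootWeight-contract : ∀ τ → rootWeight b (push (contract τ) y) ≈ y₀ + (y₁ * 𝟙ᵇ ((true ∷ b) τ) + φ)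
    rootWeight-contract τ = trans (∑-push (contract τ) y (λ t → 𝟙ᵇ ((true ∷ b) t))) (+-congʳ (*-identityʳ y₀))

    -- The recursion for a non-root first vertex: the loop at it contributes 0, every other target
    -- the weight of the contracted forests.
    forestWeight-suc :
      y₀ * forestWeight n (rootWeight b (push (contract zero) y)) s +
        (y₁ * 0# + ∑ (λ u → y (suc (suc u)) * forestWeight n (rootWeight b (push (contract (suc u)) y)) s)) ≈
      forestWeight (suc n) (y₀ * 1# + (y₁ * 0# + φ)) s
    forestWeight-suc with unmarked b in n≡
    -- All other vertices are roots here, so every target except the loop is a root and the sum over
    -- targets is the root weight itself.
    ... | zero = trans
      (+-congˡ (+-congˡ (∑.sum-cong-≋ {m} λ u → *-congˡ (reflexive (≡.cong 𝟙ᵇ (≡.sym (unmarked≡0 b n≡ u)))))))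
      (sym (*-identityʳ _))
    ... | suc n′ = begin
      y₀ * (f zero * P) + (y₁ * 0# + ∑ (λ u → y (suc (suc u)) * (f (suc u) * P)))
        ≈⟨ +-cong (*-congˡ (*-congʳ (trans (rootWeight-contract zero) (+-congˡ (+-congʳ (*-identityʳ y₁))))))
             (+-cong (zeroʳ y₁) (trans
               (∑.sum-cong-≋ {m} λ u → trans (*-congˡ (*-congʳ (rootWeight-contract (suc u))))
                 (solve 6 (λ v y₀ y₁ i φ P → v :* ((y₀ :+ (y₁ :* i :+ φ)) :* P) :=
                   v :* ((y₀ :+ φ) :* P) :+ v :* i :* (y₁ :* P)) refl _ y₀ y₁ _ φ P))
               (trans (∑.∑-distrib-+ {m} _ _) (+-cong
                 (sym (∑.*-distribʳ-sum {m} ((y₀ + φ) * P) (λ u → y (suc (suc u)))))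
                 (sym (∑.*-distribʳ-sum {m} (y₁ * P) (λ u → y (suc (suc u)) * 𝟙ᵇ (b u)))))))) ⟩
      y₀ * ((y₀ + (y₁ + φ)) * P) + (0# + (Y * ((y₀ + φ) * P) + φ * (y₁ * P)))
        ≈⟨ +-congˡ (+-identityˡ _) ⟩
      y₀ * ((y₀ + (y₁ + φ)) * P) + (Y * ((y₀ + φ) * P) + φ * (y₁ * P))
        -- The loop is lost, but each root chosen as target has `y₁` added to the root weight. In
        -- total this gains `(y₀ + φ) * y₁`, exactly what is missing from `(y₀ + φ) * s`.
        ≈⟨ solve 5 (λ y₀ y₁ φ Y P → y₀ :* ((y₀ :+ (y₁ :+ φ)) :* P) :+ (Y :* ((y₀ :+ φ) :* P) :+ φ :* (y₁ :* P))
             := (y₀ :+ φ) :* ((y₀ :+ (y₁ :+ Y)) :* P)) refl y₀ y₁ φ Y P ⟩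
      (y₀ + φ) * (s * P)
        ≈⟨ *-congʳ (+-cong (*-identityʳ y₀) (trans (+-congʳ (zeroʳ y₁)) (+-identityˡ φ))) ⟨
      (y₀ * 1# + (y₁ * 0# + φ)) * (s * P)
        ∎
      where
      P = s ^ n′
      f = λ τ → rootWeight b (push (contract τ) y)

  marksWeight : ∀ {m q} → (Fin m → Bool) → (Fin m → Fin q → Carrier) → Carrier
  marksWeight b W = ∏ (λ v → if b v then ∑ (W v) else 1#)

  -- Reachability ignores the edge out of a marked vertex, so its weights sum up freely and may
  -- differ from `y`; this leaves room to force those edges along a cycle. Unmarked vertices share
  -- the weights `y`, a property that pushing along `contract` preserves, and arbitrary `y` is the
  -- generality in which the induction on vertices closes.
  ∑-reaches : ∀ m (b : Fin m → Bool) (y : Fin (suc m) → Carrier) (W : Fin m → Fin (suc m) → Carrier) →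
    (∀ v → b v ≡ false → ∀ t → W v t ≈ y t) →
    sumOver (maps m (suc m)) (λ g → ∏ (λ v → W v (g v)) * 𝟙ᵇ (reaches m b g)) ≈
    marksWeight b W * forestWeight (unmarked b) (rootWeight b y) (∑ y)
  ∑-reaches zero b y W same = trans (+-identityʳ _) refl
  ∑-reaches (suc m) b y W same = trans
    (sumOver-maps-suc m (suc (suc m)) (λ {g} {h} e → *-cong
      (∏.sum-cong-≋ {suc m} λ v → reflexive (≡.cong (W v) (e v)))
      (reflexive (≡.cong 𝟙ᵇ (reaches-cong (suc m) b e)))))
    expand
    where
    b′ = b ∘ suc
    W′ = λ τ v → push (contract τ) (W (suc v))
    Ω = marksWeight b′ (W ∘ suc)
    f = λ τ → rootWeight b′ (push (contract τ) y)

    R : Fin (suc m) → (Fin m → Fin (suc (suc m))) → Carrier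
    R τ g = 𝟙ᵇ (reaches m b′ (contract τ ∘ g))

    contracted : ∀ τ → sumOver (maps m (suc (suc m))) (λ g → ∏ (λ v → W (suc v) (g v)) * R τ g) ≈
      Ω * forestWeight (unmarked b′) (f τ) (∑ y)
    contracted τ = begin
      sumOver (maps m (suc (suc m))) (λ g → ∏ (λ v → W (suc v) (g v)) * R τ g)
        ≈⟨ push-sumOver (contract τ) (W ∘ suc) (λ e → reflexive (≡.cong 𝟙ᵇ (reaches-cong m b′ e))) ⟩
      sumOver (maps m (suc m)) (λ g → ∏ (λ v → W′ τ v (g v)) * 𝟙ᵇ (reaches m b′ g))
        ≈⟨ ∑-reaches m b′ (push (contract τ) y) (W′ τ)
             (λ v e → push-cong (contract τ) (same (suc v) e)) ⟩
      marksWeight b′ (W′ τ) * forestWeight (unmarked b′) (f τ) (∑ (push (contract τ) y))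
        ≈⟨ *-cong (∏.sum-cong-≋ {m} λ v → if-cong (b′ v) (∑-push-total (contract τ) (W (suc v))) refl)
             (forestWeight-cong (unmarked b′) refl (∑-push-total (contract τ) y)) ⟩
      Ω * forestWeight (unmarked b′) (f τ) (∑ y)
        ∎

    split : ∀ t τ → sumOver (maps m (suc (suc m))) (λ g → W zero t * ∏ (λ v → W (suc v) (g v)) * R τ g) ≈
      W zero t * (Ω * forestWeight (unmarked b′) (f τ) (∑ y))
    split t τ = trans (sumOver-cong (maps m (suc (suc m))) λ g → *-assoc _ _ _)
      (trans (sumOver-*ˡ (maps m (suc (suc m))) (W zero t) _) (*-congˡ (contracted τ)))

    swap : ∀ x y z → x * (y * z) ≈ y * (x * z)
    swap = solve 3 (λ x y z → x :* (y :* z) := y :* (x :* z)) refl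

    expand : ∑ (λ t → sumOver (maps m (suc (suc m))) (λ g →
        W zero t * ∏ (λ v → W (suc v) (g v)) * 𝟙ᵇ (reaches (suc m) b (t ∷ g)))) ≈
      marksWeight b W * forestWeight (unmarked b) (rootWeight b y) (∑ y)
    expand with b zero in b0
    ... | true = begin
      ∑ (λ t → sumOver (maps m (suc (suc m))) (λ g → W zero t * ∏ (λ v → W (suc v) (g v)) * R zero g))
        ≈⟨ trans (∑.sum-cong-≋ {suc (suc m)} λ t → split t zero)
             (sym (∑.*-distribʳ-sum {suc (suc m)} _ (W zero))) ⟩
      ∑ (W zero) * (Ω * forestWeight (unmarked b′) (f zero) (∑ y))
        ≈⟨ *-assoc _ _ _ ⟨
      ∑ (W zero) * Ω * forestWeight (unmarked b′) (f zero) (∑ y)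
        ≈⟨ *-congˡ (forestWeight-cong (unmarked b′)
             (trans (rootWeight-contract b′ y zero) (+-congʳ (sym (*-identityʳ _)))) refl) ⟩
      ∑ (W zero) * Ω * forestWeight (unmarked b′) (y zero * 1# + (y (suc zero) * 1# + _)) (∑ y)
        ∎
    ... | false = begin
      _ ≈⟨ +-cong (trans (split zero zero) (*-congʳ (same zero b0 zero)))
             (+-cong (trans (sumOver-zero (maps m (suc (suc m))) λ g → zeroʳ _) (sym (zeroʳ _)))
               (∑.sum-cong-≋ {m} λ u → trans (split (suc (suc u)) (suc u)) (*-congʳ (same zero b0 (suc (suc u)))))) ⟩
      y zero * (Ω * V zero) + (y (suc zero) * 0# + ∑ (λ u → y (suc (suc u)) * (Ω * V (suc u))))
        ≈⟨ +-cong (swap _ _ _) (+-cong (trans (*-congˡ (sym (zeroʳ Ω))) (swap _ _ _))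
             (trans (∑.sum-cong-≋ {m} λ u → swap _ _ _) (sym (∑.*-distribˡ-sum {m} Ω _)))) ⟩
      Ω * (y zero * V zero) + (Ω * (y (suc zero) * 0#) + Ω * ∑ (λ u → y (suc (suc u)) * V (suc u)))
        ≈⟨ trans (distribˡ Ω _ _) (+-congˡ (distribˡ Ω _ _)) ⟨
      Ω * (y zero * V zero + (y (suc zero) * 0# + ∑ (λ u → y (suc (suc u)) * V (suc u))))
        ≈⟨ *-cong (sym (*-identityˡ Ω)) (forestWeight-suc b′ y) ⟩
      1# * Ω * forestWeight (suc (unmarked b′)) (y zero * 1# + (y (suc zero) * 0# + _)) (∑ y)
        ∎
      where
      V = λ τ → forestWeight (unmarked b′) (f τ) (∑ y)

  module Prescribe {N p q} (c : Fin N → Fin p) (inj : Injective _≡_ _≡_ c)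
    (z : Fin q → Carrier) (Q : Fin N → Fin q → Carrier) where

    private module ∏-Single = MonoidSums *-commutativeMonoid

    -- A factor that depends on the value of `F` at `c j` is moved into the weight of the vertex
    -- `c j`. Conditions along `c` thus become part of a product over all vertices, to which the
    -- distributive law applies.
    weights : Fin p → Fin q → Carrier
    weights v t = z t * ∏-Single.extend c (λ j → Q j t) v

    total : Fin N → Carrier
    total j = ∑ (λ t → z t * Q j t)

    ∏-weights : ∀ (F : Fin p → Fin q) →
      ∏ (λ v → weights v (F v)) ≈ ∏ (z ∘ F) * ∏ (λ j → Q j (F (c j)))
    ∏-weights F = trans (∏.∑-distrib-+ {p} (z ∘ F) _) (*-congˡ (trans
      (∏.∑-comm {p} {N} _) (∏.sum-cong-≋ {N} λ j →
        trans (∏-single {p} (c j) λ v ne → ∏-Single.if-no (c j Fin.≟ v) (ne ∘ ≡.sym))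
              (∏-Single.if-yes (c j Fin.≟ c j) ≡.refl))))

    weights-unmarked : ∀ v → marks c v ≡ false → ∀ t → weights v t ≈ z t
    weights-unmarked v e t = trans (*-congˡ (∏-Single.extend-outside c _ λ im →
      contradiction (≡.trans (≡.sym e) (∈⇒marks c v im)) λ ())) (*-identityʳ (z t))

    ∑-weights-marked : ∀ j → ∑ (weights (c j)) ≈ total j
    ∑-weights-marked j = ∑.sum-cong-≋ {q} λ t → *-congˡ (∏-Single.extend-image c inj (λ j → Q j t) j)

    marksWeight-weights : marksWeight (marks c) weights ≈ ∏ total
    marksWeight-weights = trans (∏.sum-cong-≋ {p} at) (∏-Single.sum-extend c total)
      where
      at : ∀ v → (if marks c v then ∑ (weights v) else 1#) ≈ ∏-Single.extend c total v
      at v with ℕ-Single.image? c v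
      ... | yes (j , ≡.refl) = trans (∑-weights-marked j) (sym (∏-Single.extend-image c inj total j))
      ... | no ¬im           = sym (∏-Single.extend-outside c total ¬im)

    ∑-prescribed : sumOver (maps p q) (λ F → ∏ (z ∘ F) * ∏ (λ j → Q j (F (c j)))) ≈
                   ∑ z ^ (p ∸ N) * ∏ total
    ∑-prescribed = begin
      sumOver (maps p q) (λ F → ∏ (z ∘ F) * ∏ (λ j → Q j (F (c j))))
        ≈⟨ sumOver-cong (maps p q) (λ F → sym (∏-weights F)) ⟩
      sumOver (maps p q) (λ F → ∏ (λ v → weights v (F v)))
        ≈⟨ ∏-∑ weights ⟩
      ∏ (λ v → ∑ (weights v))
        ≈⟨ ∏.sum-cong-≋ {p} at ⟩
      ∏ (λ v → (if marks c v then 1# else ∑ z) * (if marks c v then ∑ (weights v) else 1#))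
        ≈⟨ ∏.∑-distrib-+ {p} _ _ ⟩
      ∏ (λ v → if marks c v then 1# else ∑ z) * marksWeight (marks c) weights
        ≈⟨ *-cong (unmarked-power (marks c)) marksWeight-weights ⟩
      ∑ z ^ unmarked (marks c) * ∏ total
        ≈⟨ *-congʳ (reflexive (≡.cong (∑ z ^_) (unmarked-marks c inj))) ⟩
      ∑ z ^ (p ∸ N) * ∏ total
        ∎
      where
      at : ∀ v → ∑ (weights v) ≈ (if marks c v then 1# else ∑ z) * (if marks c v then ∑ (weights v) else 1#)
      at v with marks c v in e
      ... | true  = sym (*-identityˡ _)
      ... | false = trans (∑.sum-cong-≋ {q} (weights-unmarked v e)) (sym (*-identityʳ _))
      unmarked-power : ∀ {m} (b : Fin m → Bool) {s} → ∏ (λ v → if b v then 1# else s) ≈ s ^ unmarked b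
      unmarked-power {zero}  b = refl
      unmarked-power {suc m} b with b zero
      ... | true  = trans (*-identityˡ _) (unmarked-power (b ∘ suc))
      ... | false = *-congˡ (unmarked-power (b ∘ suc))

  abstract
    follows? : ∀ {N p} (c : Fin N → Fin p) F → Dec (Follows F c)
    follows? c F = Fin.all? λ j → F (c j) Fin.≟ c (next j)

  module _ {N p} (c : Fin N → Fin p) (inj : Injective _≡_ _≡_ c) (z : Fin p → Carrier) where

    outsideWeight : Carrier
    outsideWeight = ∑ (λ u → 𝟙 (avoids? u c) * z u)

    private
      b = marks c
      s = ∑ z
      f = ∑ (λ u → z u * 𝟙ᵇ (b u))
      open Prescribe c inj z (λ j t → 𝟙 (t Fin.≟ c (next j)))

      f+outside : f + outsideWeight ≈ s
      f+outside = trans (sym (∑.∑-distrib-+ {p} _ _)) (∑.sum-cong-≋ {p} at)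
        where
        at : ∀ u → z u * 𝟙ᵇ (b u) + 𝟙 (avoids? u c) * z u ≈ z u
        at u with ℕ-Single.image? c u
        ... | yes (j , e) = trans (+-cong (*-identityʳ (z u)) (trans (*-congʳ (𝟙-no (avoids? u c) λ av → av j (≡.sym e))) (zeroˡ _)))
                                  (+-identityʳ (z u))
        ... | no ¬im = trans (+-cong (zeroʳ (z u)) (trans (*-congʳ (𝟙-yes (avoids? u c) λ j e → ¬im (j , ≡.sym e))) (*-identityˡ _)))
                             (+-identityˡ (z u))

      outside≈0 : unmarked b ≡ 0 → outsideWeight ≈ 0#
      outside≈0 e = ∑-zero {p} λ u → trans (*-congʳ (𝟙-no (avoids? u c) λ av →
        let j , e′ = marks⇒∈ c u (unmarked≡0 b e u) in av j (≡.sym e′))) (zeroˡ _)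

      forestWeight-split : ∀ n → unmarked b ≡ n → forestWeight n f s + outsideWeight * s ^ (n ∸ 1) ≈ s ^ n
      -- With no unmarked vertex there is nothing outside `c`. The vanishing of `outsideWeight`
      -- removes the term whose exponent is truncated.
      forestWeight-split zero    e = trans (+-congˡ (trans (*-congʳ (outside≈0 e)) (zeroˡ _))) (+-identityʳ 1#)
      forestWeight-split (suc n) e = trans (sym (distribʳ (s ^ n) f outsideWeight)) (*-congʳ f+outside)

    -- The marked vertices have root weight s minus `outsideWeight`. Inserted into the forest weight
    -- this splits off the second term, which is kept on the left so that no subtraction occurs.
    ∑-attracted :
      sumOver (maps p p) (λ F → ∏ (z ∘ F) * (𝟙 (follows? c F) * 𝟙ᵇ (reaches p (marks c) (suc ∘ F)))) +
        outsideWeight * ∏ (z ∘ c) * s ^ (p ∸ suc N) ≈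
      ∏ (z ∘ c) * s ^ (p ∸ N)
    ∑-attracted = begin
      sumOver (maps p p) (λ F → ∏ (z ∘ F) * (𝟙 (follows? c F) * R (suc ∘ F))) + outsideWeight * ∏ (z ∘ c) * s ^ (p ∸ suc N)
        ≈⟨ +-cong forests (trans (*-congʳ (*-comm _ _)) (trans (*-assoc _ _ _) (*-congˡ (*-congˡ (reflexive (≡.cong (s ^_) exponent)))))) ⟩
      ∏ (z ∘ c) * forestWeight (unmarked b) f s + ∏ (z ∘ c) * (outsideWeight * s ^ (unmarked b ∸ 1))
        ≈⟨ distribˡ _ _ _ ⟨
      ∏ (z ∘ c) * (forestWeight (unmarked b) f s + outsideWeight * s ^ (unmarked b ∸ 1))
        ≈⟨ *-congˡ (trans (forestWeight-split (unmarked b) ≡.refl) (reflexive (≡.cong (s ^_) (unmarked-marks c inj)))) ⟩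
      ∏ (z ∘ c) * s ^ (p ∸ N)
        ∎
      where
      R : (Fin p → Fin (suc p)) → Carrier
      R g = 𝟙ᵇ (reaches p b g)
      exponent : p ∸ suc N ≡ unmarked b ∸ 1
      exponent = ≡.trans (≡.cong (p ∸_) (≡.sym (ℕ.+-comm N 1))) (≡.trans (≡.sym (ℕ.∸-+-assoc p N 1))
        (≡.cong (_∸ 1) (≡.sym (unmarked-marks c inj))))
        where import Data.Nat.Properties as ℕ
      total≈ : ∏ total ≈ ∏ (z ∘ c)
      total≈ = trans
        (∏.sum-cong-≋ {N} λ j → trans (∑.sum-cong-≋ {p} λ t → trans (*-comm _ _) (*-congʳ
            (𝟙-⇔ (t Fin.≟ c (next j)) (c (next j) Fin.≟ t) ≡.sym ≡.sym)))
          (∑-𝟙 z (c (next j))))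
        (sym (∏.sum-permute (z ∘ c) next-permutation))
      -- The image of `suc` misses the terminal vertex, which therefore starts with weight zero and
      -- acquires weight only through contraction.
      root≈ : rootWeight b (push suc z) ≈ f
      root≈ = ∑-push suc z (λ t → 𝟙ᵇ ((true ∷ b) t))
      forests : sumOver (maps p p) (λ F → ∏ (z ∘ F) * (𝟙 (follows? c F) * R (suc ∘ F))) ≈
        ∏ (z ∘ c) * forestWeight (unmarked b) f s
      forests = begin
        sumOver (maps p p) (λ F → ∏ (z ∘ F) * (𝟙 (follows? c F) * R (suc ∘ F)))
          ≈⟨ sumOver-cong (maps p p) (λ F → trans (sym (*-assoc _ _ _)) (*-congʳ (sym (trans (∏-weights F)
               (*-congˡ (𝟙-∏ (λ j → F (c j) Fin.≟ c (next j)) (follows? c F))))))) ⟩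
        sumOver (maps p p) (λ F → ∏ (λ v → weights v (F v)) * R (suc ∘ F))
          ≈⟨ push-sumOver suc weights (λ e → reflexive (≡.cong 𝟙ᵇ (reaches-cong p b e))) ⟩
        sumOver (maps p (suc p)) (λ g → ∏ (λ v → push suc (weights v) (g v)) * R g)
          ≈⟨ ∑-reaches p b (push suc z) (λ v → push suc (weights v)) (λ v e → push-cong suc (weights-unmarked v e)) ⟩
        marksWeight b (λ v → push suc (weights v)) * forestWeight (unmarked b) (rootWeight b (push suc z)) (∑ (push suc z))
          ≈⟨ *-cong (trans (∏.sum-cong-≋ {p} λ v → if-cong (b v) (∑-push-total suc (weights v)) refl)
               (trans marksWeight-weights total≈))
               (forestWeight-cong (unmarked b) root≈ (∑-push-total suc z)) ⟩
        ∏ (z ∘ c) * forestWeight (unmarked b) f s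
          ∎

-- Transfer along the composite

module Transfer {a} (K : CommutativeRing a a) where

  open CommutativeRing K hiding (zero)
  open Sums K
  open ElementarySymmetric K
  open Forests K
  open Product using (_×_)
  open SemiringExp semiring using (_^_)
  open import Algebra.Solver.CommutativeMonoid *-commutativeMonoid using (solve; _⊜_) renaming (_⊕_ to _⊛_)
  open import Relation.Binary.Reasoning.Setoid setoid

  _≗?_ : ∀ {m p} (f g : Fin m → Fin p) → Dec (f ≗ g)
  f ≗? g = Fin.all? λ i → f i Fin.≟ g i

  sumOver-𝟙 : ∀ {m p} (f : Fin m → Fin p) {H : (Fin m → Fin p) → Carrier} → Extensional H →
              sumOver (maps m p) (λ g → 𝟙 (f ≗? g) * H g) ≈ H f
  sumOver-𝟙 {m} {p} f {H} ext = maps-listing m p f _ _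
    (λ g e → trans (*-cong (𝟙-yes (f ≗? g) (≡.sym ∘ e)) (ext e)) (*-identityˡ _))
    (λ g ne → trans (*-congʳ (𝟙-no (f ≗? g) λ e → ne (≡.sym ∘ e))) (zeroˡ _))

  module _ {k : ℕ} {n : Fin (suc k) → ℕ} (x : ∀ i → Fin (n i) → Carrier) where

    Tail : Set
    Tail = ∀ i → Fin (n (suc i)) → Fin (n (next (suc i)))

    tails : List Tail
    tails = functions (λ i → maps (n (suc i)) (n (next (suc i))))

    tailWeight : Tail → Carrier
    tailWeight f = ∏ (λ i → ∏ (λ v → x (next (suc i)) (f i v)))

    pushed : Tail → Fin (n zero) → Carrier
    pushed f = push (Orbits.return {n = n} f) (x (next zero))

    transferFactor : ℕ → Fin k → Carrier
    transferFactor M i = ∑ (x (next (suc i))) ^ (n (suc i) ∸ M)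

    module _ {M : ℕ} (c : Fin M → Fin (n zero)) where

      private
        Family : Set
        Family = ∀ i → Fin M → Fin (n i)

        families : List Family
        families = functions (λ i → maps M (n i))

        families-listing : Listing families (λ v w → ∀ i → v i ≗ w i)
        families-listing = functions-listing {as = λ i → maps M (n i)} {_~_ = _≗_} _≗?_ (λ i → maps-listing M (n i))

        Chains : Tail → Family → Set
        Chains f w = ∀ i j → f i (w (suc i) j) ≡ w (next (suc i)) j

        chains? : ∀ f w → Dec (Chains f w)
        chains? f w = Fin.all? λ i → Fin.all? λ j → f i (w (suc i) j) Fin.≟ w (next (suc i)) j

        monomial : Family → Fin (suc k) → Carrier
        monomial w i = ∏ (x i ∘ w i)

        allInjective : Family → Carrier
        allInjective w = ∏ (λ i → 𝟙 (injective? (w (suc i))))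

      -- Each target of the composite is reached along a unique family of orbits.
      monomial-pushed : ∀ f → ∏ (pushed f ∘ c) ≈
        sumOver families (λ w → 𝟙 (w zero ≗? c) * 𝟙 (chains? f w) * monomial w (next zero))
      monomial-pushed f = begin
        ∏ (pushed f ∘ c)
          ≈⟨ ∏-∑ (λ j v → 𝟙 (return v Fin.≟ c j) * x (next zero) v) ⟨
        sumOver ws (λ w₁ → ∏ (λ j → 𝟙 (return (w₁ j) Fin.≟ c j) * x (next zero) (w₁ j)))
          ≈⟨ sumOver-cong ws (λ w₁ → trans (∏.∑-distrib-+ {M} _ _)
               (*-congʳ (𝟙-∏ (λ j → return (w₁ j) Fin.≟ c j) ((return ∘ w₁) ≗? c)))) ⟩
        sumOver ws (λ w₁ → 𝟙 ((return ∘ w₁) ≗? c) * ∏ (x (next zero) ∘ w₁))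
          ≈⟨ sumOver-cong ws (λ w₁ → trans
               (*-congʳ (sym (lift w₁))) (sym (sumOver-*ʳ families _ _))) ⟩
        sumOver ws (λ w₁ → sumOver families (λ w → 𝟙 (lift? w₁ w) * ∏ (x (next zero) ∘ w₁)))
          ≈⟨ sumOver-comm ws families _ ⟩
        sumOver families (λ w → sumOver ws (λ w₁ → 𝟙 (lift? w₁ w) * ∏ (x (next zero) ∘ w₁)))
          ≈⟨ sumOver-cong families (λ w → trans
               (sumOver-cong ws λ w₁ → trans (*-congʳ (trans (𝟙-× (w (next zero) ≗? w₁) (w zero ≗? c ×-dec chains? f w))
                 (*-congˡ (𝟙-× (w zero ≗? c) (chains? f w)))))
                 (*-assoc _ _ _))
               (sumOver-𝟙 (w (next zero)) {H = λ w₁ → 𝟙 (w zero ≗? c) * 𝟙 (chains? f w) * ∏ (x (next zero) ∘ w₁)}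
                 λ e → *-congˡ (monomial-cong (x (next zero)) e))) ⟩
        sumOver families (λ w → 𝟙 (w zero ≗? c) * 𝟙 (chains? f w) * monomial w (next zero))
          ∎
        where
        open Orbits {n = n} f
        ws = maps M (n (next zero))
        lift? : ∀ w₁ w → Dec ((w (next zero) ≗ w₁) × ((w zero ≗ c) × Chains f w))
        lift? w₁ w = w (next zero) ≗? w₁ ×-dec (w zero ≗? c ×-dec chains? f w)
        lift : ∀ w₁ → sumOver families (λ w → 𝟙 (lift? w₁ w)) ≈ 𝟙 ((return ∘ w₁) ≗? c)
        lift w₁ = families-listing (λ i j → orbit (w₁ j) i) _ _
          (λ w e → 𝟙-⇔ (lift? w₁ w) ((return ∘ w₁) ≗? c)
            (λ (_ , start , _) j → ≡.trans (≡.sym (e zero j)) (start j))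
            (λ r → (λ j → ≡.trans (e (next zero) j) (orbit-start (w₁ j))) ,
                   (λ j → ≡.trans (e zero j) (r j)) ,
                   (λ i j → ≡.trans (≡.cong (f i) (e (suc i) j))
                      (≡.trans (orbit-chain (w₁ j) i) (≡.sym (e (next (suc i)) j))))))
          (λ w ne → 𝟙-no (lift? w₁ w) λ (l , _ , chains) →
            ne λ i j → orbit-unique (w₁ j) {λ i → w i j} (λ i → chains i j) (l j) i)

      module _ (inj : Injective _≡_ _≡_ c) where

        private
          -- A lift of a repetition-free sequence is automatically repetition-free, but only as long
          -- as `f` is known. The factor is recorded before the sums are exchanged: for fixed `w` it
          -- ensures that the values of each map are prescribed at distinct arguments.
          insert-injective : ∀ f w → 𝟙 (w zero ≗? c) * 𝟙 (chains? f w) ≈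
                             𝟙 (w zero ≗? c) * (𝟙 (chains? f w) * allInjective w)
          insert-injective f w = 𝟙-guard (w zero ≗? c) λ start → trans (sym (*-identityʳ _))
            (𝟙-guard (chains? f w) λ chains → sym (∏-one {k} λ i → 𝟙-yes (injective? (w (suc i)))
              λ {j} {l} e → Orbits.chain-injective {n = n} f w (λ j i → chains i j)
                (λ e′ → inj (≡.trans (≡.sym (start _)) (≡.trans e′ (start _)))) (suc i) e))

          -- Once the lifts are fixed, each chain condition involves a single map, so the sum over
          -- all tails is a product of sums over one map each.
          sum-tails : ∀ w → sumOver tails (λ f → tailWeight f * (𝟙 (chains? f w) * allInjective w)) ≈
            ∏ (λ i → 𝟙 (injective? (w (suc i))) * transferFactor M i * monomial w (next (suc i)))
          sum-tails w = begin
            sumOver tails (λ f → tailWeight f * (𝟙 (chains? f w) * allInjective w))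
              ≈⟨ sumOver-cong tails (λ f → trans
                   (*-congˡ (trans (*-congʳ (trans
                     (sym (𝟙-∏ (λ i → inner? f i) (chains? f w)))
                     (∏.sum-cong-≋ {k} λ i → sym (𝟙-∏ (λ j → f i (w (suc i) j) Fin.≟ w (next (suc i)) j) (inner? f i)))))
                     (sym (∏.∑-distrib-+ {k} _ _))))
                   (trans (sym (∏.∑-distrib-+ {k} _ _)) (∏.sum-cong-≋ {k} λ i → trans (sym (*-assoc _ _ _)) (*-comm _ _)))) ⟩
            sumOver tails (λ f → ∏ (λ i → 𝟙 (injective? (w (suc i))) *
                (∏ (x (next (suc i)) ∘ f i) * ∏ (λ j → 𝟙 (f i (w (suc i) j) Fin.≟ w (next (suc i)) j)))))
              ≈⟨ ∏-sumOver (λ i → maps (n (suc i)) (n (next (suc i)))) (λ i fᵢ → 𝟙 (injective? (w (suc i))) *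
                (∏ (x (next (suc i)) ∘ fᵢ) * ∏ (λ j → 𝟙 (fᵢ (w (suc i) j) Fin.≟ w (next (suc i)) j)))) ⟩
            ∏ (λ i → sumOver (maps (n (suc i)) (n (next (suc i)))) (λ fᵢ → 𝟙 (injective? (w (suc i))) *
                (∏ (x (next (suc i)) ∘ fᵢ) * ∏ (λ j → 𝟙 (fᵢ (w (suc i) j) Fin.≟ w (next (suc i)) j)))))
              ≈⟨ ∏.sum-cong-≋ {k} (λ i → trans (sumOver-*ˡ (maps (n (suc i)) (n (next (suc i)))) _ _)
                   (trans (𝟙-guard (injective? (w (suc i))) λ injᵢ → trans
                     (Prescribe.∑-prescribed (w (suc i)) injᵢ (x (next (suc i))) (λ j t → 𝟙 (t Fin.≟ w (next (suc i)) j)))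
                     (*-congˡ (∏.sum-cong-≋ {M} λ j → value i (w (next (suc i)) j))))
                     (sym (*-assoc _ _ _)))) ⟩
            ∏ (λ i → 𝟙 (injective? (w (suc i))) * transferFactor M i * monomial w (next (suc i)))
              ∎
            where
            inner? : ∀ f i → Dec (∀ j → f i (w (suc i) j) ≡ w (next (suc i)) j)
            inner? f i = Fin.all? λ j → f i (w (suc i) j) Fin.≟ w (next (suc i)) j
            value : ∀ i u → ∑ (λ t → x (next (suc i)) t * 𝟙 (t Fin.≟ u)) ≈ x (next (suc i)) u
            value i u = trans (∑.sum-cong-≋ {n (next (suc i))} λ t → trans (*-comm _ _)
              (*-congʳ (𝟙-⇔ (t Fin.≟ u) (u Fin.≟ t) ≡.sym ≡.sym))) (∑-𝟙 (x (next (suc i))) u)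

          factor : ∀ i → (Fin M → Fin (n i)) → Carrier
          factor zero    w = 𝟙 (w ≗? c) * ∏ (x zero ∘ w)
          factor (suc i) w = 𝟙 (injective? w) * transferFactor M i * ∏ (x (suc i) ∘ w)

          regroup : ∀ w → 𝟙 (w zero ≗? c) * monomial w (next zero) *
              ∏ (λ i → 𝟙 (injective? (w (suc i))) * transferFactor M i * monomial w (next (suc i))) ≈
            ∏ (λ i → factor i (w i))
          regroup w = begin
            s * monomial w (next zero) * ∏ (λ i → d i * monomial w (next (suc i)))
              ≈⟨ *-congˡ (∏.∑-distrib-+ {k} d _) ⟩
            s * monomial w (next zero) * (∏ d * ∏ (λ i → monomial w (next (suc i))))
              ≈⟨ solve 4 (λ p q r t → (p ⊛ q) ⊛ (r ⊛ t) ⊜ (p ⊛ r) ⊛ (q ⊛ t)) refl _ _ _ _ ⟩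
            s * ∏ d * ∏ (λ i → monomial w (next i))
              -- The values prescribed for the map out of index `i` lie in the set of index
              -- `next i`. Around the whole cycle this only permutes the monomials.
              ≈⟨ *-congˡ (∏.∑-permute (monomial w) next-permutation) ⟨
            s * ∏ d * (monomial w zero * ∏ (λ i → monomial w (suc i)))
              ≈⟨ solve 4 (λ p q r t → (p ⊛ r) ⊛ (q ⊛ t) ⊜ (p ⊛ q) ⊛ (r ⊛ t)) refl _ _ _ _ ⟩
            s * monomial w zero * (∏ d * ∏ (λ i → monomial w (suc i)))
              ≈⟨ *-congˡ (∏.∑-distrib-+ {k} d _) ⟨
            s * monomial w zero * ∏ (λ i → d i * monomial w (suc i))
              ∎
            where
            s = 𝟙 (w zero ≗? c)
            d = λ i → 𝟙 (injective? (w (suc i))) * transferFactor M i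

        transfer : sumOver tails (λ f → tailWeight f * ∏ (pushed f ∘ c)) ≈
          ∏ (x zero ∘ c) * ∏ (λ i → transferFactor M i * injectiveSum M (x (suc i)))
        transfer = begin
          sumOver tails (λ f → tailWeight f * ∏ (pushed f ∘ c))
            ≈⟨ sumOver-cong tails (λ f → trans (*-congˡ (monomial-pushed f)) (trans
                 (sym (sumOver-*ˡ families (tailWeight f) _))
                 (sumOver-cong families λ w → trans
                   (*-congˡ (*-congʳ (insert-injective f w)))
                   (solve 4 (λ p q r t → p ⊛ ((q ⊛ r) ⊛ t) ⊜ (q ⊛ t) ⊛ (p ⊛ r)) refl _ _ _ _)))) ⟩
          sumOver tails (λ f → sumOver families (λ w →
              𝟙 (w zero ≗? c) * monomial w (next zero) * (tailWeight f * (𝟙 (chains? f w) * allInjective w))))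
            ≈⟨ sumOver-comm tails families _ ⟩
          sumOver families (λ w → sumOver tails (λ f →
              𝟙 (w zero ≗? c) * monomial w (next zero) * (tailWeight f * (𝟙 (chains? f w) * allInjective w))))
            ≈⟨ sumOver-cong families (λ w → trans (sumOver-*ˡ tails _ _) (trans (*-congˡ (sum-tails w)) (regroup w))) ⟩
          sumOver families (λ w → ∏ (λ i → factor i (w i)))
            ≈⟨ ∏-sumOver (λ i → maps M (n i)) factor ⟩
          ∏ (λ i → sumOver (maps M (n i)) (factor i))
            ≈⟨ *-cong
                 (trans (sumOver-cong (maps M (n zero)) λ w → *-congʳ
                     (𝟙-⇔ (w ≗? c) (c ≗? w) (≡.sym ∘_) (≡.sym ∘_)))
                   (sumOver-𝟙 c (monomial-cong (x zero))))
                 (∏.sum-cong-≋ {k} λ i → trans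
                   (sumOver-cong (maps M (n (suc i))) λ w →
                     solve 3 (λ p q r → (p ⊛ q) ⊛ r ⊜ q ⊛ (p ⊛ r)) refl _ _ _)
                   (sumOver-*ˡ (maps M (n (suc i))) (transferFactor M i) _)) ⟩
          ∏ (x zero ∘ c) * ∏ (λ i → transferFactor M i * injectiveSum M (x (suc i)))
            ∎

-- Counting eventually cyclic tuples

module Counting {a} (K : CommutativeRing a a) where

  open CommutativeRing K hiding (zero)
  open Sums K
  open ElementarySymmetric K
  open Forests K
  open Transfer K
  open Characters K using (P; weight)
  open SemiringExp semiring using (_^_)
  open SemiringMult semiring using (_×_; ×-congʳ; ×-congˡ; ×-assocˡ; ×-comm-*; ×-assoc-*)
  open import Algebra.Solver.Ring.NaturalCoefficients.Default commutativeSemiring using (solve; _:=_; _:*_)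
  open import Relation.Binary.Reasoning.Setoid setoid

  fold-cong : ∀ {p} {F G : Fin p → Fin p} → F ≗ G → ∀ u t → fold u F t ≡ fold u G t
  fold-cong e u zero    = ≡.refl
  fold-cong {F = F} e u (suc t) = ≡.trans (≡.cong F (fold-cong e u t)) (e _)

  EventuallyCycle-resp : ∀ {N p} {F G : Fin p → Fin p} → F ≗ G → EventuallyCycle N F → EventuallyCycle N G
  EventuallyCycle-resp {F = F} {G} e (c , inj , follows , M , stable) =
    c , inj , (λ j → ≡.trans (≡.sym (e (c j))) (follows j)) , M , λ m M≤m v → mk⇔
      (λ (u , q) → Equivalence.to (stable m M≤m v) (u , ≡.trans (fold-cong e u m) q))
      (λ q → let u , r = Equivalence.from (stable m M≤m v) q in u , ≡.trans (≡.sym (fold-cong e u m)) r)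

  module _ {m p : ℕ} where

    private N = suc m

    abstract
      isEventuallyCycle : (Fin p → Fin p) → Carrier
      isEventuallyCycle F = 𝟙 (eventuallyCycle? N F)

      𝟙-eventuallyCycle : ∀ {F G} → F ≗ G → 𝟙 (eventuallyCycle? N F) ≈ isEventuallyCycle G
      𝟙-eventuallyCycle {F} {G} e = 𝟙-⇔ (eventuallyCycle? N F) (eventuallyCycle? N G)
        (EventuallyCycle-resp e) (EventuallyCycle-resp (≡.sym ∘ e))

    isEventuallyCycle-ext : Extensional isEventuallyCycle
    isEventuallyCycle-ext {F} {G} e = trans (sym (𝟙-eventuallyCycle {F} λ _ → ≡.refl)) (𝟙-eventuallyCycle e)

    attracted : (Fin p → Fin p) → (Fin N → Fin p) → Carrier
    attracted F c = 𝟙 (follows? c F) * 𝟙ᵇ (reaches p (marks c) (suc ∘ F))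

    private
      attracts⇒reaches : ∀ {F} {c : Fin N → Fin p} → Attracts F c → reaches p (marks c) (suc ∘ F) ≡ true
      attracts⇒reaches {F} {c} at = reaches-complete p λ
        { zero → terminal ; (suc u) → let t , q = at u in iterate⇒Leads t (∈⇒marks c (fold u F t) q) }

      reaches⇒attracts : ∀ {F} {c : Fin N → Fin p} → reaches p (marks c) (suc ∘ F) ≡ true → Attracts F c
      reaches⇒attracts {F} {c} r u with Leads⇒iterate (reaches-sound p r (suc u)) ≡.refl
      ... | t , e = t , marks⇒∈ c (fold u F t) e

      summand-yes : ∀ {F c} → Cycle F c → 𝟙 (normal? c) * attracted F c ≈ 1#
      summand-yes {F} {c} (cycle norm fol att) = trans
        (*-cong (𝟙-yes (normal? c) norm)
          (*-cong (𝟙-yes (follows? c F) fol) (reflexive (≡.cong 𝟙ᵇ (attracts⇒reaches att)))))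
        (trans (*-identityˡ _) (*-identityˡ _))

      summand-no : ∀ {F c} → ¬ Cycle F c → 𝟙 (normal? c) * attracted F c ≈ 0#
      summand-no {F} {c} ¬C = by (normal? c) (follows? c F) _ ≡.refl
        where
        by : (d : Dec (Normal c)) (e : Dec (Follows F c)) (r : Bool) →
             reaches p (marks c) (suc ∘ F) ≡ r → 𝟙 d * (𝟙 e * 𝟙ᵇ r) ≈ 0#
        by (no _)     _         _     _ = zeroˡ _
        by (yes _)    (no _)    _     _ = trans (*-congˡ (zeroˡ _)) (zeroʳ _)
        by (yes _)    (yes _)   false _ = trans (*-congˡ (zeroʳ _)) (zeroʳ _)
        by (yes norm) (yes fol) true  r = contradiction (cycle norm fol (reaches⇒attracts r)) ¬C

    Cycle-resp : ∀ {F : Fin p → Fin p} {c d : Fin N → Fin p} → c ≗ d → Cycle F c → Cycle F d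
    Cycle-resp {F} e (cycle norm fol att) = cycle (Normal-resp e norm)
      (λ j → ≡.trans (≡.cong F (≡.sym (e j))) (≡.trans (fol j) (e (next j))))
      (λ u → let t , j , q = att u in t , j , ≡.trans (≡.sym (e j)) q)

    -- By `Cycle-unique` at most one class of listings contributes, so the sum over candidates
    -- counts no map twice.
    isEventuallyCycle≈ : ∀ F → isEventuallyCycle F ≈
      sumOver (maps N p) (λ c → 𝟙 (normal? c) * attracted F c)
    isEventuallyCycle≈ F = trans (sym (𝟙-eventuallyCycle λ _ → ≡.refl)) (by (eventuallyCycle? N F))
      where
      by : (d : Dec (EventuallyCycle N F)) → 𝟙 d ≈ sumOver (maps N p) (λ c → 𝟙 (normal? c) * attracted F c)
      by (yes ec) with EventuallyCycle⇒Cycle ec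
      ... | c , C = sym (maps-listing N p c _ _
        (λ d e → summand-yes (Cycle-resp (≡.sym ∘ e) C))
        (λ d ne → summand-no λ D → ne (Cycle-unique D C)))
      by (no ¬ec) = sym (sumOver-zero (maps N p) λ c → summand-no (¬ec ∘ Cycle⇒EventuallyCycle))

    -- The weight outside `c` is multiplied out into monomials of the sequences `u ∷ c`. Apart from
    -- powers of the total weight, everything is then in the form to which `transfer` applies.
    ∑-isEventuallyCycle : ∀ (z : Fin p → Carrier) →
      sumOver (maps p p) (λ F → ∏ (z ∘ F) * isEventuallyCycle F) +
        sumOver (maps N p) (λ c → 𝟙 (normal? c) * ∑ (λ u → 𝟙 (avoids? u c) * ∏ (z ∘ (u ∷ c)))) * ∑ z ^ (p ∸ suc N) ≈
      sumOver (maps N p) (λ c → 𝟙 (normal? c) * ∏ (z ∘ c)) * ∑ z ^ (p ∸ N)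
    ∑-isEventuallyCycle z = begin
      sumOver (maps p p) (λ F → ∏ (z ∘ F) * isEventuallyCycle F) + B * ∑ z ^ (p ∸ suc N)
        ≈⟨ +-cong by-cycle (sym (sumOver-*ʳ (maps N p) _ _)) ⟩
      sumOver (maps N p) (λ c → 𝟙 (normal? c) * sumOver (maps p p) (λ F → ∏ (z ∘ F) * attracted F c)) +
        sumOver (maps N p) (λ c → 𝟙 (normal? c) * ∑ (λ u → 𝟙 (avoids? u c) * ∏ (z ∘ (u ∷ c))) * ∑ z ^ (p ∸ suc N))
        ≈⟨ sumOver-+ (maps N p) _ _ ⟨
      sumOver (maps N p) (λ c → 𝟙 (normal? c) * sumOver (maps p p) (λ F → ∏ (z ∘ F) * attracted F c) +
        𝟙 (normal? c) * ∑ (λ u → 𝟙 (avoids? u c) * ∏ (z ∘ (u ∷ c))) * ∑ z ^ (p ∸ suc N))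
        ≈⟨ sumOver-cong (maps N p) (λ c → trans
             (trans (+-congˡ (*-assoc _ _ _)) (sym (distribˡ _ _ _)))
             (trans (𝟙-guard (normal? c) λ norm → trans (+-congˡ (*-congʳ (outside c))) (∑-attracted c (Normal⇒Injective norm) z))
               (sym (*-assoc _ _ _)))) ⟩
      sumOver (maps N p) (λ c → 𝟙 (normal? c) * ∏ (z ∘ c) * ∑ z ^ (p ∸ N))
        ≈⟨ sumOver-*ʳ (maps N p) _ _ ⟩
      sumOver (maps N p) (λ c → 𝟙 (normal? c) * ∏ (z ∘ c)) * ∑ z ^ (p ∸ N)
        ∎
      where
      B = sumOver (maps N p) (λ c → 𝟙 (normal? c) * ∑ (λ u → 𝟙 (avoids? u c) * ∏ (z ∘ (u ∷ c))))
      outside : ∀ (c : Fin N → Fin p) → ∑ (λ u → 𝟙 (avoids? u c) * ∏ (z ∘ (u ∷ c))) ≈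
                  ∑ (λ u → 𝟙 (avoids? u c) * z u) * ∏ (z ∘ c)
      outside c = trans (∑.sum-cong-≋ {p} λ u → sym (*-assoc _ _ _)) (sym (∑.*-distribʳ-sum {p} (∏ (z ∘ c)) _))
      by-cycle : sumOver (maps p p) (λ F → ∏ (z ∘ F) * isEventuallyCycle F) ≈
        sumOver (maps N p) (λ c → 𝟙 (normal? c) * sumOver (maps p p) (λ F → ∏ (z ∘ F) * attracted F c))
      by-cycle = begin
        sumOver (maps p p) (λ F → ∏ (z ∘ F) * isEventuallyCycle F)
          ≈⟨ sumOver-cong (maps p p) (λ F → trans (*-congˡ (isEventuallyCycle≈ F))
               (trans (sym (sumOver-*ˡ (maps N p) _ _)) (sumOver-cong (maps N p) λ c →
                 solve 3 (λ x y z → x :* (y :* z) := y :* (x :* z)) refl _ _ _))) ⟩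
        sumOver (maps p p) (λ F → sumOver (maps N p) (λ c → 𝟙 (normal? c) * (∏ (z ∘ F) * attracted F c)))
          ≈⟨ sumOver-comm (maps p p) (maps N p) _ ⟩
        sumOver (maps N p) (λ c → sumOver (maps p p) (λ F → 𝟙 (normal? c) * (∏ (z ∘ F) * attracted F c)))
          ≈⟨ sumOver-cong (maps N p) (λ c → sumOver-*ˡ (maps p p) _ _) ⟩
        sumOver (maps N p) (λ c → 𝟙 (normal? c) * sumOver (maps p p) (λ F → ∏ (z ∘ F) * attracted F c))
          ∎

  module _ {k : ℕ} {n : Fin (suc k) → ℕ} (x : ∀ i → Fin (n i) → Carrier) (m : ℕ) where

    private
      N = suc m
      n₀ = n zero
      s₁ = ∑ (x (next zero))

      sumOver-tuples : ∀ {H : Tuple n → Carrier} (Φ : (Fin n₀ → Fin (n (next zero))) → Tail x → Carrier) →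
        (∀ g → H g ≈ Φ (g zero) (λ i → g (suc i))) →
        sumOver (tuples n) H ≈ sumOver (maps n₀ (n (next zero))) (λ f₀ → sumOver (tails x) (Φ f₀))
      sumOver-tuples Φ e = trans (sumOver-cartesianProductWith _ (maps n₀ (n (next zero))) (tails x) _)
        (sumOver-cong (maps n₀ (n (next zero))) λ f₀ → sumOver-cong (tails x) λ f → e _)

      EC≈ : ∀ g → 𝟙 (EC? N g) ≈ isEventuallyCycle {m} (Orbits.return {n = n} (λ i → g (suc i)) ∘ g zero)
      EC≈ g = 𝟙-eventuallyCycle {m} (Orbits.composite-return {n = n} (λ i → g (suc i)) g λ i u → ≡.refl)

      tail-factor : ℕ → Carrier
      tail-factor M = ∏ (λ i → transferFactor x M i * injectiveSum M (x (suc i)))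

    P-by-tails : P N x ≈ sumOver (tails x) (λ f → tailWeight x f *
      sumOver (maps n₀ n₀) (λ F → ∏ (pushed x f ∘ F) * isEventuallyCycle {m} F))
    P-by-tails = begin
      P N x
        ≈⟨ sumOver-filter {Q = EC N} (EC? N) (tuples n) (weight x) ⟩
      sumOver (tuples n) (λ g → 𝟙 (EC? N g) * weight x g)
        ≈⟨ sumOver-tuples (λ f₀ f → tailWeight x f *
               (∏ (x (next zero) ∘ f₀) * isEventuallyCycle {m} (Orbits.return {n = n} f ∘ f₀)))
             (λ g → trans (*-congʳ (EC≈ g)) (swap _ _ _)) ⟩
      sumOver (maps n₀ (n (next zero))) (λ f₀ → sumOver (tails x) (λ f →
          tailWeight x f * (∏ (x (next zero) ∘ f₀) * isEventuallyCycle {m} (Orbits.return {n = n} f ∘ f₀))))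
        ≈⟨ sumOver-comm (maps n₀ (n (next zero))) (tails x) _ ⟩
      sumOver (tails x) (λ f → sumOver (maps n₀ (n (next zero))) (λ f₀ →
          tailWeight x f * (∏ (x (next zero) ∘ f₀) * isEventuallyCycle {m} (Orbits.return {n = n} f ∘ f₀))))
        ≈⟨ sumOver-cong (tails x) (λ f → trans (sumOver-*ˡ (maps n₀ (n (next zero))) _ _)
             (*-congˡ (push-sumOver (Orbits.return {n = n} f) (λ _ → x (next zero)) (isEventuallyCycle-ext {m})))) ⟩
      sumOver (tails x) (λ f → tailWeight x f *
          sumOver (maps n₀ n₀) (λ F → ∏ (pushed x f ∘ F) * isEventuallyCycle {m} F))
        ∎
      where
      swap : ∀ p q r → p * (q * r) ≈ r * (q * p)
      swap = solve 3 (λ p q r → p :* (q :* r) := r :* (q :* p)) refl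

    private
      positive : sumOver (tails x) (λ f → tailWeight x f *
          sumOver (maps N n₀) (λ c → 𝟙 (normal? c) * ∏ (pushed x f ∘ c))) ≈
        tail-factor N * normalSum m (x zero)
      positive = begin
        sumOver (tails x) (λ f → tailWeight x f * sumOver (maps N n₀) (λ c → 𝟙 (normal? c) * ∏ (pushed x f ∘ c)))
          ≈⟨ sumOver-cong (tails x) (λ f → trans (sym (sumOver-*ˡ (maps N n₀) _ _))
               (sumOver-cong (maps N n₀) λ c → solve 3 (λ p q r → p :* (q :* r) := q :* (p :* r)) refl _ _ _)) ⟩
        sumOver (tails x) (λ f → sumOver (maps N n₀) (λ c → 𝟙 (normal? c) * (tailWeight x f * ∏ (pushed x f ∘ c))))
          ≈⟨ sumOver-comm (tails x) (maps N n₀) _ ⟩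
        sumOver (maps N n₀) (λ c → sumOver (tails x) (λ f → 𝟙 (normal? c) * (tailWeight x f * ∏ (pushed x f ∘ c))))
          ≈⟨ sumOver-cong (maps N n₀) (λ c → trans (sumOver-*ˡ (tails x) _ _)
               (trans (𝟙-guard (normal? c) λ norm → transfer x c (Normal⇒Injective norm))
                 (solve 3 (λ p q r → p :* (q :* r) := r :* (p :* q)) refl _ _ _))) ⟩
        sumOver (maps N n₀) (λ c → tail-factor N * (𝟙 (normal? c) * ∏ (x zero ∘ c)))
          ≈⟨ sumOver-*ˡ (maps N n₀) _ _ ⟩
        tail-factor N * normalSum m (x zero)
          ∎

      Avoiding : (Fin n₀ → Carrier) → Carrier
      Avoiding z = sumOver (maps N n₀) (λ c → 𝟙 (normal? c) * ∑ (λ u → 𝟙 (avoids? u c) * ∏ (z ∘ (u ∷ c))))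

      avoiding : ∀ z → Avoiding z ≈ ∑ (λ u → sumOver (maps N n₀) (λ c → 𝟙 (normal? c) * 𝟙 (avoids? u c) * ∏ (z ∘ (u ∷ c))))
      avoiding z = trans (sumOver-cong (maps N n₀) λ c → trans (∑.*-distribˡ-sum {n₀} _ _)
          (∑.sum-cong-≋ {n₀} λ u → sym (*-assoc _ _ _))) (sumOver-∑ (maps N n₀) {n₀} _)

      negative : sumOver (tails x) (λ f → tailWeight x f * Avoiding (pushed x f)) ≈
        tail-factor (suc N) * Avoiding (x zero)
      negative = begin
        sumOver (tails x) (λ f → tailWeight x f * Avoiding (pushed x f))
          ≈⟨ sumOver-cong (tails x) (λ f → trans (*-congˡ (avoiding (pushed x f))) (trans (∑.*-distribˡ-sum {n₀} _ _)
               (∑.sum-cong-≋ {n₀} λ u → trans (sym (sumOver-*ˡ (maps N n₀) _ _)) (sumOver-cong (maps N n₀) λ c →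
                 solve 3 (λ p q r → p :* (q :* r) := q :* (p :* r)) refl _ _ _)))) ⟩
        sumOver (tails x) (λ f → ∑ (λ u → sumOver (maps N n₀) (λ c →
            𝟙 (normal? c) * 𝟙 (avoids? u c) * (tailWeight x f * ∏ (pushed x f ∘ (u ∷ c))))))
          ≈⟨ trans (sumOver-∑ (tails x) {n₀} _) (∑.sum-cong-≋ {n₀} λ u → sumOver-comm (tails x) (maps N n₀) _) ⟩
        ∑ (λ u → sumOver (maps N n₀) (λ c → sumOver (tails x) (λ f →
            𝟙 (normal? c) * 𝟙 (avoids? u c) * (tailWeight x f * ∏ (pushed x f ∘ (u ∷ c))))))
          ≈⟨ ∑.sum-cong-≋ {n₀} (λ u → trans (sumOver-cong (maps N n₀) λ c → trans (sumOver-*ˡ (tails x) _ _)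
               (trans (trans (*-assoc _ _ _) (trans (𝟙-guard (normal? c) λ norm → 𝟙-guard (avoids? u c) λ av →
                 transfer x (u ∷ c) (∷-injective av (Normal⇒Injective norm))) (sym (*-assoc _ _ _))))
                 (solve 3 (λ p q r → p :* (q :* r) := r :* (p :* q)) refl _ _ _)))
               (sumOver-*ˡ (maps N n₀) _ _)) ⟩
        ∑ (λ u → tail-factor (suc N) * sumOver (maps N n₀) (λ c → 𝟙 (normal? c) * 𝟙 (avoids? u c) * ∏ (x zero ∘ (u ∷ c))))
          ≈⟨ trans (sym (∑.*-distribˡ-sum {n₀} _ _)) (*-congˡ (sym (avoiding (x zero)))) ⟩
        tail-factor (suc N) * Avoiding (x zero)
          ∎

    P-identity : P N x + tail-factor (suc N) * Avoiding (x zero) * s₁ ^ (n₀ ∸ suc N) ≈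
                 tail-factor N * normalSum m (x zero) * s₁ ^ (n₀ ∸ N)
    P-identity = begin
      P N x + tail-factor (suc N) * Avoiding (x zero) * s₁ ^ (n₀ ∸ suc N)
        ≈⟨ +-cong P-by-tails (trans (*-congʳ (sym negative)) (sym (sumOver-*ʳ (tails x) _ _))) ⟩
      _ ≈⟨ sumOver-+ (tails x) _ _ ⟨
      sumOver (tails x) (λ f → tailWeight x f * _ + tailWeight x f * Avoiding (pushed x f) * s₁ ^ (n₀ ∸ suc N))
        ≈⟨ sumOver-cong (tails x) (λ f → trans
             (trans (+-congˡ (trans (*-assoc _ _ _) (*-congˡ (*-congˡ (^-cong (n₀ ∸ suc N) (sym (total f))))))) (sym (distribˡ _ _ _)))
             (trans (*-congˡ (∑-isEventuallyCycle {m} (pushed x f)))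
               (trans (sym (*-assoc _ _ _)) (*-congˡ (^-cong (n₀ ∸ N) (total f)))))) ⟩
      sumOver (tails x) (λ f → tailWeight x f * sumOver (maps N n₀) (λ c → 𝟙 (normal? c) * ∏ (pushed x f ∘ c)) * s₁ ^ (n₀ ∸ N))
        ≈⟨ trans (sumOver-*ʳ (tails x) _ _) (*-congʳ positive) ⟩
      tail-factor N * normalSum m (x zero) * s₁ ^ (n₀ ∸ N)
        ∎
      where
      -- Pushing forward preserves total weight. The powers of this total are thus the same for all
      -- tails and can be taken out of the sum.
      total : ∀ f → ∑ (pushed x f) ≈ s₁
      total f = ∑-push-total (Orbits.return {n = n} f) (x (next zero))

    torusMonomial : ℕ → Carrier
    torusMonomial M = ∏ (λ i → ∑ (x i) ^ (n (prev i) ∸ M) * esym M (x i))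

    private
      -- The map out of index `i` has `n i ∸ M` free values in the set of index `next i`; reindexing
      -- by `next` turns this into the exponent `n (prev i) ∸ M` beside `esym M (x i)`. Each of the
      -- `k` sets other than the first contributes `M !` orderings.
      collect : ∀ M → tail-factor M * esym M (x zero) * s₁ ^ (n₀ ∸ M) ≈
                      ((M !) ℕ.^ k) × torusMonomial M
      collect M = begin
        tail-factor M * e zero * s zero
          ≈⟨ *-congʳ (*-congʳ (trans (∏.∑-distrib-+ {k} _ _) (*-congˡ (trans
               (∏.sum-cong-≋ {k} λ i → injectiveSum≈ M (x (suc i))) (∏-× k (λ i → e (suc i))))))) ⟩
        ∏ (λ i → s (suc i)) * (((M !) ℕ.^ k) × ∏ (λ i → e (suc i))) * e zero * s zero
          ≈⟨ solve 4 (λ p q r t → p :* q :* r :* t := t :* p :* (r :* q)) refl _ _ _ _ ⟩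
        ∏ s * (e zero * (((M !) ℕ.^ k) × ∏ (λ i → e (suc i))))
          ≈⟨ trans (*-congˡ (×-comm-* ((M !) ℕ.^ k) _ _)) (×-comm-* ((M !) ℕ.^ k) _ _) ⟩
        ((M !) ℕ.^ k) × (∏ s * ∏ e)
          ≈⟨ ×-congʳ ((M !) ℕ.^ k) (trans (*-congʳ shift) (sym (∏.∑-distrib-+ {suc k} (λ i → ∑ (x i) ^ (n (prev i) ∸ M)) e))) ⟩
        ((M !) ℕ.^ k) × torusMonomial M
          ∎
        where
        s : Fin (suc k) → Carrier
        s i = ∑ (x (next i)) ^ (n i ∸ M)
        e : Fin (suc k) → Carrier
        e i = esym M (x i)
        shift : ∏ s ≈ ∏ (λ i → ∑ (x i) ^ (n (prev i) ∸ M))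
        shift = sym (trans (∏.∑-permute (λ i → ∑ (x i) ^ (n (prev i) ∸ M)) next-permutation)
          (∏.sum-cong-≋ {suc k} λ i → reflexive (≡.cong (λ j → ∑ (x (next i)) ^ (n j ∸ M)) (prev-next i))))
        ∏-× : ∀ l (r : Fin l → Carrier) → ∏ (λ i → (M !) × r i) ≈ ((M !) ℕ.^ l) × ∏ r
        ∏-× zero    r = sym (+-identityʳ 1#)
        ∏-× (suc l) r = trans (*-congˡ (∏-× l (r ∘ suc))) (trans (×-comm-* ((M !) ℕ.^ l) _ _)
          (trans (×-congʳ ((M !) ℕ.^ l) (×-assoc-* (M !) _ _)) (trans (×-assocˡ _ ((M !) ℕ.^ l) (M !))
            (×-congˡ (ℕ.*-comm ((M !) ℕ.^ l) (M !))))))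

    P-formula : P N x + ((suc N ! ) ℕ.^ k ℕ.* (m ! ℕ.* suc N)) × torusMonomial (suc N) ≈
                ((N !) ℕ.^ k ℕ.* m !) × torusMonomial N
    P-formula = begin
      P N x + ((suc N !) ℕ.^ k ℕ.* (m ! ℕ.* suc N)) × torusMonomial (suc N)
        ≈⟨ +-congˡ (trans (factor ((suc N !) ℕ.^ k) (m ! ℕ.* suc N) (collect (suc N)))
             (*-congʳ (*-congˡ (trans (sym (×-assocˡ _ (m !) (suc N))) (sym (normalSum-avoiding m (x zero))))))) ⟩
      P N x + tail-factor (suc N) * Avoiding (x zero) * s₁ ^ (n₀ ∸ suc N)
        ≈⟨ P-identity ⟩
      tail-factor N * normalSum m (x zero) * s₁ ^ (n₀ ∸ N)
        ≈⟨ trans (factor ((N !) ℕ.^ k) (m !) (collect N)) (*-congʳ (*-congˡ (sym (normalSum≈ m (x zero))))) ⟨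
      ((N !) ℕ.^ k ℕ.* m !) × torusMonomial N
        ∎
      where
      factor : ∀ p q {r s t u} → r * s * t ≈ p × u → (p ℕ.* q) × u ≈ r * (q × s) * t
      factor p q {r} {s} {t} {u} e = begin
        (p ℕ.* q) × u        ≈⟨ ×-congˡ (ℕ.*-comm p q) ⟩
        (q ℕ.* p) × u        ≈⟨ ×-assocˡ u q p ⟨
        q × (p × u)          ≈⟨ ×-congʳ q e ⟨
        q × (r * s * t)      ≈⟨ ×-assoc-* q (r * s) t ⟨
        (q × (r * s)) * t    ≈⟨ *-congʳ (×-comm-* q r s) ⟨
        r * (q × s) * t      ∎

-- Eigenbases of representations

module Eigenbases {a} (K : CommutativeRing a a) where

  open CommutativeRing K hiding (zero)
  open Sums K
  open Characters K
  open Product using (_×_)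
  open SemiringExp semiring using (_^_)

  +-elim : ∀ {ℓ} m {n} (P : Fin (m ℕ.+ n) → Set ℓ) → (∀ i → P (i ↑ˡ n)) → (∀ j → P (m ↑ʳ j)) → ∀ k → P k
  +-elim m {n} P l r k = ≡.subst P (Fin.join-splitAt m n k) (by (splitAt m k))
    where
    by : ∀ s → P (join m n s)
    by (inj₁ i) = l i
    by (inj₂ j) = r j

  -- Compatibility with zero and negation follows from these three fields, which keeps the
  -- verification short for the many maps constructed below.
  record Linear (M M′ : Mod) (φ : LeftModule.Carrierᴹ M → LeftModule.Carrierᴹ M′) : Set a where
    private
      module M = LeftModule M
      module M′ = LeftModule M′
    field
      cong   : ∀ {u v} → u M.≈ᴹ v → φ u M′.≈ᴹ φ v
      +-homo : ∀ u v → φ (u M.+ᴹ v) M′.≈ᴹ φ u M′.+ᴹ φ v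
      *-homo : ∀ r v → φ (r M.*ₗ v) M′.≈ᴹ r M′.*ₗ φ v

    0-homo : φ M.0ᴹ M′.≈ᴹ M′.0ᴹ
    0-homo = M′.≈ᴹ-trans (cong (M.≈ᴹ-sym (M.*ₗ-zeroˡ M.0ᴹ)))
      (M′.≈ᴹ-trans (*-homo 0# M.0ᴹ) (M′.*ₗ-zeroˡ _))

    combination-homo : ∀ {d} (r : Fin d → Carrier) (b : Fin d → M.Carrierᴹ) →
      φ (combination M r b) M′.≈ᴹ combination M′ r (φ ∘ b)
    combination-homo {zero}  r b = 0-homo
    combination-homo {suc d} r b = M′.≈ᴹ-trans (+-homo _ _)
      (M′.+ᴹ-cong (*-homo (r zero) (b zero)) (combination-homo (r ∘ suc) (b ∘ suc)))

  IsLinear⇒Linear : ∀ M M′ {φ} → IsLinear M M′ φ → Linear M M′ φ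
  IsLinear⇒Linear M M′ l = record { cong = L.⟦⟧-cong ; +-homo = L.+ᴹ-homo ; *-homo = L.*ₗ-homo }
    where
    open import Algebra.Module.Morphism.Structures using (module LeftModuleMorphisms)
    module L = LeftModuleMorphisms.IsLeftModuleHomomorphism l

  ∘-Linear : ∀ M M′ M″ {φ ψ} → Linear M′ M″ φ → Linear M M′ ψ → Linear M M″ (φ ∘ ψ)
  ∘-Linear M M′ M″ {φ} {ψ} l l′ = record
    { cong = l.cong ∘ l′.cong
    ; +-homo = λ u v → M″.≈ᴹ-trans (l.cong (l′.+-homo u v)) (l.+-homo (ψ u) (ψ v))
    ; *-homo = λ r v → M″.≈ᴹ-trans (l.cong (l′.*-homo r v)) (l.*-homo r (ψ v))
    }
    where
    module M″ = LeftModule M″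
    module l = Linear l
    module l′ = Linear l′

  module Combination (M : Mod) where
    open LeftModule M
    private module ∑ᴹ = CommutativeMonoidSum +ᴹ-commutativeMonoid
    private module Singleᴹ = MonoidSums +ᴹ-commutativeMonoid
    open import Algebra.Solver.CommutativeMonoid +ᴹ-commutativeMonoid using (solve; _⊜_) renaming (_⊕_ to _⊞_)

    interchange : ∀ p q r s → (p +ᴹ q) +ᴹ (r +ᴹ s) ≈ᴹ (p +ᴹ r) +ᴹ (q +ᴹ s)
    interchange = solve 4 (λ p q r s → (p ⊞ q) ⊞ (r ⊞ s) ⊜ (p ⊞ r) ⊞ (q ⊞ s)) ≈ᴹ-refl

    *ₗ-comm : ∀ r s v → r *ₗ s *ₗ v ≈ᴹ s *ₗ r *ₗ v
    *ₗ-comm r s v = ≈ᴹ-trans (≈ᴹ-sym (*ₗ-assoc r s v)) (≈ᴹ-trans (*ₗ-cong (*-comm r s) ≈ᴹ-refl) (*ₗ-assoc s r v))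

    combination-cong : ∀ {d} {r s : Fin d → Carrier} {b c : Fin d → Carrierᴹ} →
      (∀ i → r i ≈ s i) → (∀ i → b i ≈ᴹ c i) → combination M r b ≈ᴹ combination M s c
    combination-cong {d} e e′ = ∑ᴹ.sum-cong-≋ {d} λ i → *ₗ-cong (e i) (e′ i)

    combination-+ : ∀ {d} (r s : Fin d → Carrier) (b : Fin d → Carrierᴹ) →
      combination M (λ i → r i + s i) b ≈ᴹ combination M r b +ᴹ combination M s b
    combination-+ {d} r s b = ≈ᴹ-trans (∑ᴹ.sum-cong-≋ {d} λ i → *ₗ-distribʳ (b i) (r i) (s i))
      (∑ᴹ.∑-distrib-+ {d} (λ i → r i *ₗ b i) (λ i → s i *ₗ b i))

    combination-* : ∀ {d} t (r : Fin d → Carrier) (b : Fin d → Carrierᴹ) →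
      combination M (λ i → t * r i) b ≈ᴹ t *ₗ combination M r b
    combination-* {zero}  t r b = ≈ᴹ-sym (*ₗ-zeroʳ t)
    combination-* {suc d} t r b = ≈ᴹ-trans (+ᴹ-cong (*ₗ-assoc t _ _) (combination-* t (r ∘ suc) (b ∘ suc)))
      (≈ᴹ-sym (*ₗ-distribˡ t _ _))

    combination-linear : ∀ {d} (b : Fin d → Carrierᴹ) → Linear (K^ d) M (λ r → combination M r b)
    combination-linear b = record
      { cong = λ e → combination-cong e (λ _ → ≈ᴹ-refl)
      ; +-homo = λ r s → combination-+ r s b
      ; *-homo = λ t r → combination-* t r b
      }

    combination-++ : ∀ {d e} (r : Fin d → Carrier) (s : Fin e → Carrier) (b : Fin d → Carrierᴹ) (c : Fin e → Carrierᴹ) →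
      combination M (r ++ s) (b ++ c) ≈ᴹ combination M r b +ᴹ combination M s c
    combination-++ {d} {e} r s b c = ≈ᴹ-trans (Singleᴹ.sum-split d _) (+ᴹ-cong
      (∑ᴹ.sum-cong-≋ {d} λ i → *ₗ-cong (reflexive (lookup-++ˡ r s i)) (≈ᴹ-reflexive (lookup-++ˡ b c i)))
      (∑ᴹ.sum-cong-≋ {e} λ j → *ₗ-cong (reflexive (lookup-++ʳ r s j)) (≈ᴹ-reflexive (lookup-++ʳ b c j))))

  combination-K^ : ∀ {d e} (r : Fin d → Carrier) (b : Fin d → Fin e → Carrier) j →
    combination (K^ e) r b j ≈ ∑ (λ i → r i * b i j)
  combination-K^ {zero}  r b j = refl
  combination-K^ {suc d} r b j = +-congˡ (combination-K^ (r ∘ suc) (b ∘ suc) j)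

  module Eval {X : Set a} {R : Term X → Term X → Set a} (M : Mod) (h : X → LeftModule.Carrierᴹ M) where
    open LeftModule M
    open Presented R

    eval : Term X → Carrierᴹ
    eval (gen x) = h x
    eval 𝟘       = 0ᴹ
    eval (t ⊕ u) = eval t +ᴹ eval u
    eval (r ⊙ t) = r *ₗ eval t

    eval-linear : (∀ {t u} → R t u → eval t ≈ᴹ eval u) → Linear presented M eval
    eval-linear resp = record { cong = respects ; +-homo = λ _ _ → ≈ᴹ-refl ; *-homo = λ _ _ → ≈ᴹ-refl }
      where
      respects : ∀ {t u} → t ∼ u → eval t ≈ᴹ eval u
      respects (relation q)    = resp q
      respects ∼-refl          = ≈ᴹ-refl
      respects (∼-sym e)       = ≈ᴹ-sym (respects e)
      respects (∼-trans e e′)  = ≈ᴹ-trans (respects e) (respects e′)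
      respects (⊕-cong e e′)   = +ᴹ-cong (respects e) (respects e′)
      respects (⊙-cong e e′)   = *ₗ-cong e (respects e′)
      respects (⊕-assoc t u v) = +ᴹ-assoc _ _ _
      respects (⊕-comm t u)    = +ᴹ-comm _ _
      respects (⊕-idˡ t)       = +ᴹ-identityˡ _
      respects (⊙-distʳ t r s) = *ₗ-distribʳ _ r s
      respects (⊙-distˡ r t u) = *ₗ-distribˡ r _ _
      respects (⊙-assoc r s t) = *ₗ-assoc r s _
      respects (⊙-idˡ t)       = *ₗ-identityˡ _
      respects (⊙-zeroˡ t)     = *ₗ-zeroˡ _

  module _ {X : Set a} {R : Term X → Term X → Set a} (M : Mod) where
    open LeftModule M
    open Presented R

    -- The uniqueness half of the universal property, `Eval` being the existence half. Elements are
    -- terms, so the comparison is a recursion on syntax.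
    linear-ext : ∀ {φ ψ} → Linear presented M φ → Linear presented M ψ →
                 (∀ x → φ (gen x) ≈ᴹ ψ (gen x)) → ∀ t → φ t ≈ᴹ ψ t
    linear-ext l l′ e (gen x) = e x
    linear-ext l l′ e 𝟘       = ≈ᴹ-trans (Linear.0-homo l) (≈ᴹ-sym (Linear.0-homo l′))
    linear-ext l l′ e (t ⊕ u) = ≈ᴹ-trans (Linear.+-homo l t u) (≈ᴹ-trans
      (+ᴹ-cong (linear-ext l l′ e t) (linear-ext l l′ e u)) (≈ᴹ-sym (Linear.+-homo l′ t u)))
    linear-ext l l′ e (r ⊙ t) = ≈ᴹ-trans (Linear.*-homo l r t) (≈ᴹ-trans
      (*ₗ-cong refl (linear-ext l l′ e t)) (≈ᴹ-sym (Linear.*-homo l′ r t)))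

  δ : ∀ {d} → Fin d → Fin d → Carrier
  δ i j = 𝟙 (i Fin.≟ j)

  -- Diagonalisation with a linear coordinate map dual to the basis. Unlike a bare trace, this
  -- structure passes to tensor products and exterior powers; duality and linearity together give
  -- the uniqueness of coordinates that a basis requires.
  record Eigenbasis {G : Group a a} (W : Rep G) (g : Group.Carrier G) (t : Carrier) : Set a where
    open Rep W hiding (module Linear)
    field
      {dim}        : ℕ
      basis        : Fin dim → Carrierᴹ
      coordinates  : Carrierᴹ → Fin dim → Carrier
      linear       : Linear space (K^ dim) coordinates
      dual         : ∀ i j → coordinates (basis i) j ≈ δ i j
      expansion    : ∀ v → combination space (coordinates v) basis ≈ᴹ v
      eigenvalue   : Fin dim → Carrier
      eigenvector  : ∀ i → act g (basis i) ≈ᴹ eigenvalue i *ₗ basis i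
      trace        : ∑ eigenvalue ≈ t

    open Linear linear public using () renaming (cong to coordinates-cong; *-homo to coordinates-*)

    isTrace : IsTrace space (act g) t
    isTrace = dim , basis , isBasis , (begin
      t                                                ≈⟨ trace ⟨
      ∑ eigenvalue                                     ≈⟨ ∑.sum-cong-≋ {dim} (λ i → begin
        eigenvalue i                                     ≈⟨ *-identityʳ _ ⟨
        eigenvalue i * 1#                                ≈⟨ *-congˡ (trans (dual i i) (𝟙-yes (i Fin.≟ i) ≡.refl)) ⟨
        eigenvalue i * coordinates (basis i) i           ≈⟨ coordinates-* _ _ i ⟨
        coordinates (eigenvalue i *ₗ basis i) i          ≈⟨ coordinates-cong (eigenvector i) i ⟨
        coordinates (act g (basis i)) i                  ∎) ⟩
      ∑ (λ i → coordinates (act g (basis i)) i)        ∎)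
      where
      open import Relation.Binary.Reasoning.Setoid setoid
      isBasis : IsBasis space basis
      isBasis = record
        { coordinates = coordinates
        ; expansion = expansion
        ; unique = λ v r e i → begin
            r i                                                ≈⟨ ∑-𝟙 r i ⟨
            ∑ (λ j → δ i j * r j)                              ≈⟨ ∑.sum-cong-≋ {dim} (λ j → trans (*-comm _ _)
                (*-congˡ (trans (𝟙-⇔ (i Fin.≟ j) (j Fin.≟ i) ≡.sym ≡.sym) (sym (dual j i))))) ⟩
            ∑ (λ j → r j * coordinates (basis j) i)            ≈⟨ combination-K^ r (coordinates ∘ basis) i ⟨
            combination (K^ dim) r (coordinates ∘ basis) i     ≈⟨ Linear.combination-homo linear r basis i ⟨
            coordinates (combination space r basis) i          ≈⟨ coordinates-cong e i ⟩
            coordinates v i                                    ∎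
        }

  module _ {G : Group a a} {g : Group.Carrier G} where

    Eigenbasis-trace : ∀ {W : Rep G} {t u} → t ≈ u → Eigenbasis W g t → Eigenbasis W g u
    Eigenbasis-trace e B = record
      { basis = basis ; coordinates = coordinates ; linear = linear ; dual = dual ; expansion = expansion
      ; eigenvalue = eigenvalue ; eigenvector = eigenvector ; trace = trans trace e }
      where open Eigenbasis B

    trivial-eigenbasis : Eigenbasis (trivial {G}) g 1#
    trivial-eigenbasis = record
      { dim = 1
      ; basis = λ _ → 1#
      ; coordinates = λ v _ → v
      ; linear = record { cong = λ e _ → e ; +-homo = λ _ _ _ → refl ; *-homo = λ _ _ _ → refl }
      ; dual = λ { zero zero → refl }
      ; expansion = λ v → trans (+-identityʳ _) (*-identityʳ v)
      ; eigenvalue = λ _ → 1#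
      ; eigenvector = λ _ → sym (*-identityˡ 1#)
      ; trace = +-identityʳ 1#
      }

    module _ {V W : Rep G} {s t} (B : Eigenbasis V g s) (C : Eigenbasis W g t) where
      private
        module V = Rep V
        module W = Rep W
        module B = Eigenbasis B
        module C = Eigenbasis C
        module T = Rep (V ⊗ W)
        open Presented (TensorRel V W)
        open Combination T.space
        module ∑ᵀ = CommutativeMonoidSum T.+ᴹ-commutativeMonoid

        flat : ∀ {ℓ} {A : Set ℓ} → (Fin B.dim → Fin C.dim → A) → Fin (B.dim ℕ.* C.dim) → A
        flat f k = let i , j = remQuot C.dim k in f i j

        flat-combine : ∀ {ℓ} {A : Set ℓ} (f : Fin B.dim → Fin C.dim → A) i j → flat f (combine i j) ≡ f i j
        flat-combine f i j = ≡.cong (λ (i , j) → f i j) (Fin.remQuot-combine i j)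

        pair : V.Carrierᴹ × W.Carrierᴹ → Fin (B.dim ℕ.* C.dim) → Carrier
        pair (v , w) = flat λ i j → B.coordinates v i * C.coordinates w j

        open Eval {R = TensorRel V W} (K^ (B.dim ℕ.* C.dim)) pair

        pair-resp : ∀ {t u} → TensorRel V W t u → ∀ k → eval t k ≈ eval u k
        pair-resp (⊗-cong e e′) k = *-cong (B.coordinates-cong e _) (C.coordinates-cong e′ _)
        pair-resp (+-⊗ v v′ w)  k = trans (*-congʳ (Linear.+-homo B.linear v v′ _)) (distribʳ _ _ _)
        pair-resp (⊗-+ v w w′)  k = trans (*-congˡ (Linear.+-homo C.linear w w′ _)) (distribˡ _ _ _)
        pair-resp (*-⊗ r v w)   k = trans (*-congʳ (Linear.*-homo B.linear r v _)) (*-assoc _ _ _)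
        pair-resp (⊗-* r v w)   k = trans (*-congˡ (Linear.*-homo C.linear r w _))
          (trans (sym (*-assoc _ _ _)) (trans (*-congʳ (*-comm _ _)) (*-assoc _ _ _)))

        eval-lin : Linear T.space (K^ (B.dim ℕ.* C.dim)) eval
        eval-lin = eval-linear pair-resp

        β : Fin (B.dim ℕ.* C.dim) → T.Carrierᴹ
        β = flat λ i j → gen (B.basis i , C.basis j)

        left : ∀ w → Linear V.space T.space (λ v → gen (v , w))
        left w = record { cong = λ e → relation (⊗-cong e W.≈ᴹ-refl) ; +-homo = λ _ _ → relation (+-⊗ _ _ _)
                        ; *-homo = λ _ _ → relation (*-⊗ _ _ _) }

        right : ∀ v → Linear W.space T.space (λ w → gen (v , w))
        right v = record { cong = λ e → relation (⊗-cong V.≈ᴹ-refl e) ; +-homo = λ _ _ → relation (⊗-+ _ _ _)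
                         ; *-homo = λ _ _ → relation (⊗-* _ _ _) }

        expand : ∀ v w → combination T.space (pair (v , w)) β ∼ gen (v , w)
        expand v w = begin
          combination T.space (pair (v , w)) β
            ≈⟨ MonoidSums.sum-combine T.+ᴹ-commutativeMonoid B.dim {C.dim} _ ⟩
          ∑ᵀ.sum (λ (i : Fin B.dim) → ∑ᵀ.sum (λ (j : Fin C.dim) → pair (v , w) (combine i j) ⊙ β (combine i j)))
            ≈⟨ ∑ᵀ.sum-cong-≋ {B.dim} (λ i → ∼-trans
                 (∑ᵀ.sum-cong-≋ {C.dim} λ j → ⊙-cong
                   (reflexive (flat-combine (λ i j → B.coordinates v i * C.coordinates w j) i j))
                   (≡.subst (λ u → u ∼ gen (B.basis i , C.basis j)) (≡.sym (flat-combine (λ i j → gen (B.basis i , C.basis j)) i j)) ∼-refl))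
                 (combination-* (B.coordinates v i) (C.coordinates w) (λ j → gen (B.basis i , C.basis j)))) ⟩
          combination T.space (B.coordinates v) (λ i → combination T.space (C.coordinates w) (λ j → gen (B.basis i , C.basis j)))
            ≈⟨ combination-cong (λ _ → refl) (λ i → ∼-trans
                 (∼-sym (Linear.combination-homo (right (B.basis i)) (C.coordinates w) C.basis))
                 (relation (⊗-cong V.≈ᴹ-refl (C.expansion w)))) ⟩
          combination T.space (B.coordinates v) (λ i → gen (B.basis i , w))
            ≈⟨ Linear.combination-homo (left w) (B.coordinates v) B.basis ⟨
          gen (combination V.space (B.coordinates v) B.basis , w)
            ≈⟨ relation (⊗-cong (B.expansion v) W.≈ᴹ-refl) ⟩
          gen (v , w)
            ∎
          where open import Relation.Binary.Reasoning.Setoid T.≈ᴹ-setoid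

        combine-elim : ∀ {ℓ} (P : Fin (B.dim ℕ.* C.dim) → Set ℓ) → (∀ (i : Fin B.dim) (j : Fin C.dim) → P (combine i j)) → ∀ k → P k
        combine-elim P p k = let i , j , e = Fin.combine-surjective {B.dim} {C.dim} k in ≡.subst P e (p i j)

      -- Products of coordinates are bilinear and hence define a linear map on the tensor product.
      -- Its values on products of basis vectors show their independence.
      ⊗-eigenbasis : Eigenbasis (V ⊗ W) g (s * t)
      ⊗-eigenbasis = record
        { basis = β
        ; coordinates = eval
        ; linear = eval-lin
        ; dual = combine-elim (λ k → ∀ l → eval (β k) l ≈ δ k l) λ i j →
            combine-elim (λ l → eval (β (combine i j)) l ≈ δ (combine i j) l) λ k l → trans
            (reflexive (≡.trans (≡.cong (λ u → eval u (combine k l)) (flat-combine (λ i j → gen (B.basis i , C.basis j)) i j))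
              (flat-combine (λ k l → B.coordinates (B.basis i) k * C.coordinates (C.basis j) l) k l)))
            (trans (*-cong (B.dual i k) (C.dual j l)) (trans (sym (𝟙-× (i Fin.≟ k) (j Fin.≟ l)))
              (𝟙-⇔ ((i Fin.≟ k) ×-dec (j Fin.≟ l)) (combine i j Fin.≟ combine k l)
                (λ { (≡.refl , ≡.refl) → ≡.refl }) (Fin.combine-injective i j k l))))
        ; expansion = linear-ext {R = TensorRel V W} T.space
            (∘-Linear T.space (K^ (B.dim ℕ.* C.dim)) T.space (combination-linear β) eval-lin)
            (record { cong = λ e → e ; +-homo = λ _ _ → ∼-refl ; *-homo = λ _ _ → ∼-refl })
            (λ (v , w) → expand v w)
        ; eigenvalue = flat λ i j → B.eigenvalue i * C.eigenvalue j
        ; eigenvector = λ k → let i , j = remQuot C.dim k in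
            ∼-trans (relation (⊗-cong (B.eigenvector i) (C.eigenvector j)))
              (∼-trans (relation (*-⊗ _ _ _)) (∼-trans (⊙-cong refl (relation (⊗-* _ _ _))) (∼-sym (⊙-assoc _ _ _))))
        ; trace = begin
            ∑ (flat λ i j → B.eigenvalue i * C.eigenvalue j)
              ≈⟨ MonoidSums.sum-combine +-commutativeMonoid B.dim {C.dim} _ ⟩
            ∑ (λ (i : Fin B.dim) → ∑ (λ (j : Fin C.dim) → flat (λ i j → B.eigenvalue i * C.eigenvalue j) (combine i j)))
              ≈⟨ ∑.sum-cong-≋ {B.dim} (λ i → trans
                   (∑.sum-cong-≋ {C.dim} λ j → reflexive (flat-combine (λ i j → B.eigenvalue i * C.eigenvalue j) i j))
                   (sym (∑.*-distribˡ-sum {C.dim} (B.eigenvalue i) C.eigenvalue))) ⟩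
            ∑ (λ i → B.eigenvalue i * ∑ C.eigenvalue)
              ≈⟨ ∑.*-distribʳ-sum {B.dim} _ B.eigenvalue ⟨
            ∑ B.eigenvalue * ∑ C.eigenvalue
              ≈⟨ *-cong B.trace C.trace ⟩
            s * t ∎
        }
        where open import Relation.Binary.Reasoning.Setoid setoid

    ⨂-eigenbasis : ∀ {d} {W : Fin d → Rep G} {t : Fin d → Carrier} →
                   (∀ i → Eigenbasis (W i) g (t i)) → Eigenbasis (⨂ W) g (∏ t)
    ⨂-eigenbasis {zero}  B = trivial-eigenbasis
    ⨂-eigenbasis {suc d} B = ⊗-eigenbasis (B zero) (⨂-eigenbasis (B ∘ suc))

    ^⊗-eigenbasis : ∀ {V : Rep G} {t} r → Eigenbasis V g t → Eigenbasis (V ^⊗ r) g (t ^ r)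
    ^⊗-eigenbasis {V} {t} r B = Eigenbasis-trace {⨂ {d = r} λ _ → V} (power r) (⨂-eigenbasis {r} λ _ → B)
      where
      power : ∀ r → ∏ {r} (λ _ → t) ≈ t ^ r
      power zero    = refl
      power (suc r) = *-congˡ (power r)

-- Exterior powers

module ExteriorPowers {a} (K : CommutativeRing a a) where

  open CommutativeRing K hiding (zero)
  open Sums K
  open ElementarySymmetric K using (esym)
  open Eigenbases K
  open Characters K
  open import Level using () renaming (suc to ℓsuc)
  open import Algebra.Solver.Ring.NaturalCoefficients.Default commutativeSemiring using (solve; _:=_; _:+_; _:*_)

  -- Pascal's recursion makes `Fin (binom (suc n) (suc s))` split by definition into the blades with
  -- and without the first basis vector.
  binom : ℕ → ℕ → ℕ
  binom _       zero    = 1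
  binom zero    (suc s) = 0
  binom (suc n) (suc s) = binom n s ℕ.+ binom n (suc s)

  -- Signs are factors ν, so that the linearity of wedge follows from semiring identities.
  ν : Carrier
  ν = - 1#

  r+νr : ∀ r → r + ν * r ≈ 0#
  r+νr r = trans (+-congʳ (sym (*-identityˡ r))) (trans (sym (distribʳ r 1# ν))
    (trans (*-congʳ (-‿inverseʳ 1#)) (zeroˡ r)))

  -- A vector of K^(n+1) is (v₀ , v′), and an element of degree s + 1 of its exterior algebra is
  -- e₀ ∧ α + β with α and β in the exterior algebra of K^n, in degrees s and s + 1.
  wedge : ∀ {n} s → (Fin n → Carrier) → (Fin (binom n s) → Carrier) → Fin (binom n (suc s)) → Carrier
  wedge {zero}  s       v ω ()
  wedge {suc n} zero    v ω = (λ i → v zero * ω i) ++ wedge {n} zero (v ∘ suc) ω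
  wedge {suc n} (suc s) v ω =
    (λ i → v zero * ω (binom n s ↑ʳ i) + ν * wedge s (v ∘ suc) (λ j → ω (j ↑ˡ binom n (suc s))) i) ++
    wedge (suc s) (v ∘ suc) (λ j → ω (binom n s ↑ʳ j))

  ++-cong : ∀ {m n} {f f′ : Fin m → Carrier} {g g′ : Fin n → Carrier} →
    (∀ i → f i ≈ f′ i) → (∀ j → g j ≈ g′ j) → ∀ k → (f ++ g) k ≈ (f′ ++ g′) k
  ++-cong {m} e e′ k with splitAt m k
  ... | inj₁ i = e i
  ... | inj₂ j = e′ j

  ++-map : ∀ {m n} (h : Carrier → Carrier) (f : Fin m → Carrier) (g : Fin n → Carrier) k →
    ((h ∘ f) ++ (h ∘ g)) k ≈ h ((f ++ g) k)
  ++-map {m} h f g k with splitAt m k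
  ... | inj₁ i = refl
  ... | inj₂ j = refl

  ++-+ : ∀ {m n} (f f′ : Fin m → Carrier) (g g′ : Fin n → Carrier) k →
    ((λ i → f i + f′ i) ++ (λ j → g j + g′ j)) k ≈ (f ++ g) k + (f′ ++ g′) k
  ++-+ {m} f f′ g g′ k with splitAt m k
  ... | inj₁ i = refl
  ... | inj₂ j = refl

  wedge-cong : ∀ {n} s {u v : Fin n → Carrier} {ω η : Fin (binom n s) → Carrier} →
    (∀ i → u i ≈ v i) → (∀ i → ω i ≈ η i) → ∀ i → wedge s u ω i ≈ wedge s v η i
  wedge-cong {zero}  s       e e′ ()
  wedge-cong {suc n} zero    e e′ = ++-cong (λ i → *-cong (e zero) (e′ i)) (wedge-cong {n} zero (e ∘ suc) e′)
  wedge-cong {suc n} (suc s) e e′ = ++-cong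
    (λ i → +-cong (*-cong (e zero) (e′ _)) (*-congˡ (wedge-cong s (e ∘ suc) (λ j → e′ _) i)))
    (wedge-cong (suc s) (e ∘ suc) (λ j → e′ _))

  wedge-+ˡ : ∀ {n} s (ω : Fin (binom n s) → Carrier) (u v : Fin n → Carrier) i →
    wedge s (λ j → u j + v j) ω i ≈ wedge s u ω i + wedge s v ω i
  wedge-+ˡ {zero}  s    ω u v ()
  wedge-+ˡ {suc n} zero ω u v k = trans
    (++-cong (λ i → distribʳ (ω i) (u zero) (v zero)) (wedge-+ˡ {n} zero ω (u ∘ suc) (v ∘ suc)) k)
    (++-+ (λ i → u zero * ω i) (λ i → v zero * ω i) (wedge {n} zero (u ∘ suc) ω) _ k)
  wedge-+ˡ {suc n} (suc s) ω u v k = trans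
    (++-cong (λ i → trans (+-congˡ (*-congˡ (wedge-+ˡ s _ (u ∘ suc) (v ∘ suc) i)))
        (solve 6 (λ u v β ν p q → (u :+ v) :* β :+ ν :* (p :+ q) := (u :* β :+ ν :* p) :+ (v :* β :+ ν :* q))
          refl (u zero) (v zero) _ ν _ _))
      (wedge-+ˡ (suc s) _ (u ∘ suc) (v ∘ suc)) k)
    (++-+ {binom n (suc s)} _ _ (wedge (suc s) (u ∘ suc) _) _ k)

  wedge-*ˡ : ∀ {n} s (ω : Fin (binom n s) → Carrier) r (v : Fin n → Carrier) i →
    wedge s (λ j → r * v j) ω i ≈ r * wedge s v ω i
  wedge-*ˡ {zero}  s    ω r v ()
  wedge-*ˡ {suc n} zero ω r v k = trans
    (++-cong (λ i → *-assoc r (v zero) (ω i)) (wedge-*ˡ {n} zero ω r (v ∘ suc)) k)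
    (++-map (r *_) (λ i → v zero * ω i) (wedge {n} zero (v ∘ suc) ω) k)
  wedge-*ˡ {suc n} (suc s) ω r v k = trans
    (++-cong (λ i → trans (+-congˡ (*-congˡ (wedge-*ˡ s _ r (v ∘ suc) i)))
        (solve 5 (λ r v β ν p → (r :* v) :* β :+ ν :* (r :* p) := r :* (v :* β :+ ν :* p)) refl r (v zero) _ ν _))
      (wedge-*ˡ (suc s) _ r (v ∘ suc)) k)
    (++-map {binom n (suc s)} (r *_) _ (wedge (suc s) (v ∘ suc) _) k)

  wedge-+ʳ : ∀ {n} s (v : Fin n → Carrier) (ω η : Fin (binom n s) → Carrier) i →
    wedge s v (λ j → ω j + η j) i ≈ wedge s v ω i + wedge s v η i
  wedge-+ʳ {zero}  s    v ω η ()
  wedge-+ʳ {suc n} zero v ω η k = trans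
    (++-cong (λ i → distribˡ (v zero) (ω i) (η i)) (wedge-+ʳ {n} zero (v ∘ suc) ω η) k)
    (++-+ (λ i → v zero * ω i) (λ i → v zero * η i) (wedge {n} zero (v ∘ suc) ω) _ k)
  wedge-+ʳ {suc n} (suc s) v ω η k = trans
    (++-cong (λ i → trans (+-congˡ (*-congˡ (wedge-+ʳ s (v ∘ suc) _ _ i)))
        (solve 6 (λ v β γ ν p q → v :* (β :+ γ) :+ ν :* (p :+ q) := (v :* β :+ ν :* p) :+ (v :* γ :+ ν :* q))
          refl (v zero) _ _ ν _ _))
      (wedge-+ʳ (suc s) (v ∘ suc) _ _) k)
    (++-+ {binom n (suc s)} _ _ (wedge (suc s) (v ∘ suc) _) _ k)

  wedge-*ʳ : ∀ {n} s (v : Fin n → Carrier) r (ω : Fin (binom n s) → Carrier) i →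
    wedge s v (λ j → r * ω j) i ≈ r * wedge s v ω i
  wedge-*ʳ {zero}  s    v r ω ()
  wedge-*ʳ {suc n} zero v r ω k = trans
    (++-cong (λ i → solve 3 (λ v r ω → v :* (r :* ω) := r :* (v :* ω)) refl (v zero) r (ω i))
      (wedge-*ʳ {n} zero (v ∘ suc) r ω) k)
    (++-map (r *_) (λ i → v zero * ω i) (wedge {n} zero (v ∘ suc) ω) k)
  wedge-*ʳ {suc n} (suc s) v r ω k = trans
    (++-cong (λ i → trans (+-congˡ (*-congˡ (wedge-*ʳ s (v ∘ suc) r _ i)))
        (solve 5 (λ r v β ν p → v :* (r :* β) :+ ν :* (r :* p) := r :* (v :* β :+ ν :* p)) refl r (v zero) _ ν _))
      (wedge-*ʳ (suc s) (v ∘ suc) r _) k)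
    (++-map {binom n (suc s)} (r *_) _ (wedge (suc s) (v ∘ suc) _) k)

  ++-zero : ∀ {m n} {f : Fin m → Carrier} {g : Fin n → Carrier} →
    (∀ i → f i ≈ 0#) → (∀ j → g j ≈ 0#) → ∀ k → (f ++ g) k ≈ 0#
  ++-zero {m} e e′ k with splitAt m k
  ... | inj₁ i = e i
  ... | inj₂ j = e′ j

  -- Write v = v₀e₀ + v′ and ω = e₀ ∧ α + β. The e₀ component of the double product is v₀ (v′ ∧ β) -
  -- v′ ∧ (v₀ β - v′ ∧ α): the terms with v₀ cancel, and v′ ∧ v′ ∧ α vanishes by induction.
  wedge-square : ∀ {n} s (v : Fin n → Carrier) ω i → wedge (suc s) v (wedge s v ω) i ≈ 0#
  wedge-square {zero}  s    v ω ()
  wedge-square {suc n} zero v ω = ++-zero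
    (λ i → trans
      (+-cong (*-congˡ (reflexive (lookup-++ʳ top bot i)))
        (*-congˡ (trans (wedge-cong {n} zero (λ _ → refl) (λ j → reflexive (lookup-++ˡ top bot j)) i)
                        (wedge-*ʳ {n} zero v′ (v zero) ω i))))
      (r+νr _))
    (λ j → trans (wedge-cong {n} 1 (λ _ → refl) (λ j → reflexive (lookup-++ʳ top bot j)) j)
                 (wedge-square zero v′ ω j))
    where
    v′ = v ∘ suc
    top = λ i → v zero * ω i
    bot = wedge {n} zero v′ ω
  wedge-square {suc n} (suc s) v ω = ++-zero
    (λ i → trans
      (+-cong (*-congˡ (reflexive (lookup-++ʳ top bot i)))
        (*-congˡ (trans (wedge-cong {n} (suc s) (λ _ → refl) (λ j → reflexive (lookup-++ˡ top bot j)) i)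
          (trans (wedge-+ʳ (suc s) v′ (λ i → v zero * β i) (λ i → ν * wedge s v′ α i) i)
            (trans (+-cong (wedge-*ʳ (suc s) v′ (v zero) β i)
                           (trans (wedge-*ʳ (suc s) v′ ν (wedge s v′ α) i) (trans (*-congˡ (wedge-square s v′ α i)) (zeroʳ ν))))
                   (+-identityʳ _))))))
      (r+νr _))
    (λ j → trans (wedge-cong {n} (suc (suc s)) (λ _ → refl) (λ j → reflexive (lookup-++ʳ top bot j)) j)
                 (wedge-square (suc s) v′ β j))
    where
    v′ = v ∘ suc
    α = λ j → ω (j ↑ˡ binom n (suc s))
    β = λ j → ω (binom n s ↑ʳ j)
    top = λ i → v zero * β i + ν * wedge s v′ α i
    bot = wedge (suc s) v′ β

  -- The part of the structure shared by the presented exterior powers and the coordinate model,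
  -- with multiplication by vectors from the left only. Blades and signs are treated once, and the
  -- two instances are compared by `blades-homo`.
  record ExteriorAlgebra (M : Mod) : Set (ℓsuc a) where
    field
      degree : ℕ → Mod
    module E s = LeftModule (degree s)
    open LeftModule M
    field
      one        : E.Carrierᴹ 0
      mul        : ∀ s → Carrierᴹ → E.Carrierᴹ s → E.Carrierᴹ (suc s)
      mul-linˡ   : ∀ s t → Linear M (degree (suc s)) (λ u → mul s u t)
      mul-linʳ   : ∀ s u → Linear (degree s) (degree (suc s)) (mul s u)
      mul-square : ∀ s u t → E._≈ᴹ_ (suc (suc s)) (mul (suc s) u (mul s u t)) (E.0ᴹ (suc (suc s)))

    private
      module L s t = Linear (mul-linˡ s t)
      module R s u = Linear (mul-linʳ s u)

    -- Polarisation: expanding the vanishing square of `u +ᴹ v` leaves the two mixed products, whose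
    -- sum is therefore zero.
    mul-anticommute : ∀ s u v t → E._≈ᴹ_ (suc (suc s))
      (mul (suc s) u (mul s v t)) (E._*ₗ_ (suc (suc s)) ν (mul (suc s) v (mul s u t)))
    mul-anticommute s u v t = begin
      X                           ≈⟨ F.+ᴹ-identityʳ X ⟨
      X F.+ᴹ F.0ᴹ                 ≈⟨ F.+ᴹ-congˡ (F.≈ᴹ-trans (F.+ᴹ-congʳ (F.≈ᴹ-sym (F.*ₗ-identityˡ Y))) (F.≈ᴹ-trans (F.≈ᴹ-sym (F.*ₗ-distribʳ Y 1# ν))
                                       (F.≈ᴹ-trans (F.*ₗ-cong (-‿inverseʳ 1#) F.≈ᴹ-refl) (F.*ₗ-zeroˡ Y)))) ⟨
      X F.+ᴹ (Y F.+ᴹ ν F.*ₗ Y)    ≈⟨ F.+ᴹ-assoc X Y _ ⟨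
      X F.+ᴹ Y F.+ᴹ ν F.*ₗ Y      ≈⟨ F.+ᴹ-congʳ sum≈0 ⟩
      F.0ᴹ F.+ᴹ ν F.*ₗ Y          ≈⟨ F.+ᴹ-identityˡ _ ⟩
      ν F.*ₗ Y                    ∎
      where
      module F = LeftModule (degree (suc (suc s)))
      open import Relation.Binary.Reasoning.Setoid F.≈ᴹ-setoid
      X = mul (suc s) u (mul s v t)
      Y = mul (suc s) v (mul s u t)
      sum≈0 : X F.+ᴹ Y F.≈ᴹ F.0ᴹ
      sum≈0 = begin
        X F.+ᴹ Y
          ≈⟨ F.+ᴹ-cong (F.+ᴹ-identityˡ X) (F.+ᴹ-identityʳ Y) ⟨
        (F.0ᴹ F.+ᴹ X) F.+ᴹ (Y F.+ᴹ F.0ᴹ)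
          ≈⟨ F.+ᴹ-cong (F.+ᴹ-congʳ (mul-square s u t)) (F.+ᴹ-congˡ (mul-square s v t)) ⟨
        (mul (suc s) u (mul s u t) F.+ᴹ X) F.+ᴹ (Y F.+ᴹ mul (suc s) v (mul s v t))
          ≈⟨ F.+ᴹ-cong (R.+-homo (suc s) u _ _) (R.+-homo (suc s) v _ _) ⟨
        mul (suc s) u (E′._+ᴹ_ (mul s u t) (mul s v t)) F.+ᴹ mul (suc s) v (E′._+ᴹ_ (mul s u t) (mul s v t))
          ≈⟨ L.+-homo (suc s) _ u v ⟨
        mul (suc s) (u +ᴹ v) (E′._+ᴹ_ (mul s u t) (mul s v t))
          ≈⟨ R.cong (suc s) (u +ᴹ v) (L.+-homo s t u v) ⟨
        mul (suc s) (u +ᴹ v) (mul s (u +ᴹ v) t)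
          ≈⟨ mul-square s (u +ᴹ v) t ⟩
        F.0ᴹ
          ∎
        where module E′ = LeftModule (degree (suc s))

    blades : ∀ {n} → (Fin n → Carrierᴹ) → ∀ s → Fin (binom n s) → E.Carrierᴹ s
    blades b zero    _ = one
    blades {zero}  b (suc s) ()
    blades {suc n} b (suc s) = (λ i → mul s (b zero) (blades (b ∘ suc) s i)) ++ blades (b ∘ suc) (suc s)

    -- In every exterior algebra `wedge` computes the coefficients of a product with respect to
    -- blades. Iterated over the factors of a generator, this proves that the blades of a basis
    -- span.
    mul-combination : ∀ {n} (b : Fin n → Carrierᴹ) s (r : Fin n → Carrier) (ω : Fin (binom n s) → Carrier) →
      E._≈ᴹ_ (suc s) (mul s (combination M r b) (combination (degree s) ω (blades b s)))
                     (combination (degree (suc s)) (wedge s r ω) (blades b (suc s)))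
    mul-combination {zero} b s r ω = L.0-homo s _
    mul-combination {suc n} b zero r ω = begin
      mul 0 (r zero *ₗ b zero +ᴹ combination M r′ b′) t
        ≈⟨ L.+-homo 0 t _ _ ⟩
      mul 0 (r zero *ₗ b zero) t +₁ mul 0 (combination M r′ b′) t
        ≈⟨ E₁.+ᴹ-cong (E₁.≈ᴹ-trans (L.*-homo 0 t _ _) (E₁.*ₗ-cong refl (R.combination-homo 0 (b zero) ω (blades b′ zero))))
             (mul-combination b′ zero r′ ω) ⟩
      (r zero E₁.*ₗ combination (degree 1) ω (λ i → mul 0 (b zero) (blades b′ zero i))) +₁
        combination (degree 1) (wedge {n} zero r′ ω) (blades b′ 1)
        ≈⟨ E₁.+ᴹ-congʳ (C.combination-* (r zero) ω (λ i → mul 0 (b zero) (blades b′ zero i))) ⟨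
      combination (degree 1) (λ i → r zero * ω i) (λ i → mul 0 (b zero) (blades b′ zero i)) +₁
        combination (degree 1) (wedge {n} zero r′ ω) (blades b′ 1)
        ≈⟨ C.combination-++ (λ i → r zero * ω i) (wedge {n} zero r′ ω) (λ i → mul 0 (b zero) (blades b′ zero i)) (blades b′ 1) ⟨
      combination (degree 1) (wedge {suc n} zero r ω) (blades b 1)
        ∎
      where
      r′ = r ∘ suc
      b′ = b ∘ suc
      t = combination (degree 0) ω (blades b 0)
      module E₁ = LeftModule (degree 1)
      module C = Combination (degree 1)
      open E₁ using () renaming (_+ᴹ_ to _+₁_)
      open import Relation.Binary.Reasoning.Setoid E₁.≈ᴹ-setoid
    mul-combination {suc n} b (suc s) r ω = begin
      mul (suc s) u t
        ≈⟨ R.cong (suc s) u (E₁.≈ᴹ-trans split-t (E₁.+ᴹ-congʳ (E₁.≈ᴹ-sym (R.combination-homo s (b zero) α _)))) ⟩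
      mul (suc s) u (mul s (b zero) A E₁.+ᴹ B)
        ≈⟨ E₂.≈ᴹ-trans (R.+-homo (suc s) u _ _) (E₂.+ᴹ-cong (L.+-homo (suc s) _ _ _) (L.+-homo (suc s) _ _ _)) ⟩
      (mul (suc s) (r zero *ₗ b zero) (mul s (b zero) A) E₂.+ᴹ mul (suc s) ρ (mul s (b zero) A)) E₂.+ᴹ
        (mul (suc s) (r zero *ₗ b zero) B E₂.+ᴹ mul (suc s) ρ B)
        ≈⟨ E₂.+ᴹ-cong
             (E₂.≈ᴹ-trans (E₂.+ᴹ-cong
               (E₂.≈ᴹ-trans (L.*-homo (suc s) _ _ _) (E₂.≈ᴹ-trans (E₂.*ₗ-cong refl (mul-square s (b zero) A)) (E₂.*ₗ-zeroʳ _)))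
               (E₂.≈ᴹ-trans (mul-anticommute s ρ (b zero) A) (E₂.≈ᴹ-sym (R.*-homo (suc s) (b zero) ν _))))
               (E₂.+ᴹ-identityˡ _))
             (E₂.+ᴹ-congʳ (E₂.≈ᴹ-trans (L.*-homo (suc s) _ _ _) (E₂.≈ᴹ-sym (R.*-homo (suc s) (b zero) _ _)))) ⟩
      mul (suc s) (b zero) (ν E₁.*ₗ mul s ρ A) E₂.+ᴹ (mul (suc s) (b zero) (r zero E₁.*ₗ B) E₂.+ᴹ mul (suc s) ρ B)
        ≈⟨ E₂.≈ᴹ-trans (E₂.≈ᴹ-sym (E₂.+ᴹ-assoc _ _ _)) (E₂.+ᴹ-congʳ (E₂.≈ᴹ-trans (E₂.+ᴹ-comm _ _) (E₂.≈ᴹ-sym (R.+-homo (suc s) (b zero) _ _)))) ⟩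
      mul (suc s) (b zero) (r zero E₁.*ₗ B E₁.+ᴹ ν E₁.*ₗ mul s ρ A) E₂.+ᴹ mul (suc s) ρ B
        ≈⟨ E₂.+ᴹ-cong
             (R.cong (suc s) (b zero) (E₁.≈ᴹ-sym (E₁.≈ᴹ-trans (C₁.combination-+ (λ i → r zero * β i) (λ i → ν * wedge s r′ α i) _)
               (E₁.+ᴹ-cong (C₁.combination-* (r zero) β _)
                 (E₁.≈ᴹ-trans (C₁.combination-* ν (wedge s r′ α) _) (E₁.*ₗ-cong refl (E₁.≈ᴹ-sym (mul-combination b′ s r′ α))))))))
             (mul-combination b′ (suc s) r′ β) ⟩
      mul (suc s) (b zero) (combination (degree (suc s)) (λ i → r zero * β i + ν * wedge s r′ α i) (blades b′ (suc s))) E₂.+ᴹ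
        combination (degree (suc (suc s))) (wedge (suc s) r′ β) (blades b′ (suc (suc s)))
        ≈⟨ E₂.+ᴹ-congʳ (R.combination-homo (suc s) (b zero) (λ i → r zero * β i + ν * wedge s r′ α i) _) ⟩
      combination (degree (suc (suc s))) (λ i → r zero * β i + ν * wedge s r′ α i) (λ i → mul (suc s) (b zero) (blades b′ (suc s) i)) E₂.+ᴹ
        combination (degree (suc (suc s))) (wedge (suc s) r′ β) (blades b′ (suc (suc s)))
        ≈⟨ C₂.combination-++ (λ i → r zero * β i + ν * wedge s r′ α i) (wedge (suc s) r′ β) _ _ ⟨
      combination (degree (suc (suc s))) (wedge (suc s) r ω) (blades b (suc (suc s)))
        ∎
      where
      r′ = r ∘ suc
      b′ = b ∘ suc
      u = combination M r b
      ρ = combination M r′ b′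
      α = λ j → ω (j ↑ˡ binom n (suc s))
      β = λ j → ω (binom n s ↑ʳ j)
      t = combination (degree (suc s)) ω (blades b (suc s))
      A = combination (degree s) α (blades b′ s)
      B = combination (degree (suc s)) β (blades b′ (suc s))
      module E₁ = LeftModule (degree (suc s))
      module E₂ = LeftModule (degree (suc (suc s)))
      module C₁ = Combination (degree (suc s))
      module C₂ = Combination (degree (suc (suc s)))
      open import Relation.Binary.Reasoning.Setoid E₂.≈ᴹ-setoid
      split-t : t E₁.≈ᴹ combination (degree (suc s)) α (λ i → mul s (b zero) (blades b′ s i)) E₁.+ᴹ B
      split-t = E₁.≈ᴹ-trans (C₁.combination-cong (λ k → sym (rejoin k)) (λ _ → E₁.≈ᴹ-refl)) (C₁.combination-++ α β _ _)
        where
        rejoin : ∀ k → (α ++ β) k ≈ ω k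
        rejoin = +-elim (binom n s) (λ k → (α ++ β) k ≈ ω k)
          (λ i → reflexive (lookup-++ˡ α β i)) (λ j → reflexive (lookup-++ʳ α β j))

  module _ {M M′ : Mod} (A : ExteriorAlgebra M) (A′ : ExteriorAlgebra M′) where
    private
      module M′ = LeftModule M′
      module A = ExteriorAlgebra A
      module A′ = ExteriorAlgebra A′

    blades-homo : (φ : LeftModule.Carrierᴹ M → M′.Carrierᴹ) (Φ : ∀ s → A.E.Carrierᴹ s → A′.E.Carrierᴹ s) →
      (∀ s {t u} → A.E._≈ᴹ_ s t u → A′.E._≈ᴹ_ s (Φ s t) (Φ s u)) →
      A′.E._≈ᴹ_ 0 (Φ 0 A.one) A′.one →
      (∀ s u t → A′.E._≈ᴹ_ (suc s) (Φ (suc s) (A.mul s u t)) (A′.mul s (φ u) (Φ s t))) →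
      ∀ {n} (b : Fin n → LeftModule.Carrierᴹ M) (b′ : Fin n → M′.Carrierᴹ) → (∀ i → φ (b i) M′.≈ᴹ b′ i) →
      ∀ s i → A′.E._≈ᴹ_ s (Φ s (A.blades b s i)) (A′.blades b′ s i)
    blades-homo φ Φ Φ-cong Φ-one Φ-mul = homo
      where
      homo : ∀ {n} (b : Fin n → LeftModule.Carrierᴹ M) (b′ : Fin n → M′.Carrierᴹ) → (∀ i → φ (b i) M′.≈ᴹ b′ i) →
        ∀ s i → A′.E._≈ᴹ_ s (Φ s (A.blades b s i)) (A′.blades b′ s i)
      homo b b′ e zero i = Φ-one
      homo {zero}  b b′ e (suc s) ()
      homo {suc n} b b′ e (suc s) k with splitAt (binom n s) k
      ... | inj₁ i = E′.≈ᴹ-trans (Φ-mul s _ _) (E′.≈ᴹ-trans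
        (Linear.cong (A′.mul-linˡ s _) (e zero)) (Linear.cong (A′.mul-linʳ s _) (homo (b ∘ suc) (b′ ∘ suc) (e ∘ suc) s i)))
        where module E′ = LeftModule (A′.degree (suc s))
      ... | inj₂ j = homo (b ∘ suc) (b′ ∘ suc) (e ∘ suc) (suc s) j

  -- The coordinate model and the blades of the standard basis

  standard : ∀ n → ExteriorAlgebra (K^ n)
  standard n = record
    { degree = λ s → K^ (binom n s)
    ; one = λ _ → 1#
    ; mul = wedge
    ; mul-linˡ = λ s ω → record
      { cong = λ e → wedge-cong s e (λ _ → refl) ; +-homo = wedge-+ˡ s ω ; *-homo = wedge-*ˡ s ω }
    ; mul-linʳ = λ s v → record
      { cong = wedge-cong s (λ _ → refl) ; +-homo = wedge-+ʳ s v ; *-homo = wedge-*ʳ s v }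
    ; mul-square = wedge-square
    }

  module Standard n = ExteriorAlgebra (standard n)

  wedge-zeroˡ : ∀ {n} s {v : Fin n → Carrier} ω → (∀ i → v i ≈ 0#) → ∀ i → wedge s v ω i ≈ 0#
  wedge-zeroˡ {n} s ω e i = trans (wedge-cong s e (λ _ → refl) i) (Linear.0-homo (Standard.mul-linˡ n s ω) i)

  wedge-zeroʳ : ∀ {n} s (v : Fin n → Carrier) {ω} → (∀ i → ω i ≈ 0#) → ∀ i → wedge s v ω i ≈ 0#
  wedge-zeroʳ {n} s v e i = trans (wedge-cong s (λ _ → refl) e i) (Linear.0-homo (Standard.mul-linʳ n s v) i)

  -- Induced on exterior powers by the inclusion v ↦ (0 , v) of K^n in K^(n+1).
  shift : ∀ {n} s → (Fin (binom n s) → Carrier) → Fin (binom (suc n) s) → Carrier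
  shift     zero    ω = ω
  shift {n} (suc s) ω = (λ (_ : Fin (binom n s)) → 0#) ++ ω

  wedge-shift : ∀ {n} s (v : Fin n → Carrier) ω i → shift (suc s) (wedge s v ω) i ≈ wedge s (0# ∷ v) (shift s ω) i
  wedge-shift {n} zero v ω = ++-cong {1} (λ i → sym (zeroˡ (ω i))) (λ j → refl {wedge {n} zero v ω j})
  wedge-shift {n} (suc s) v ω = ++-cong
    (λ i → sym (trans (+-cong (zeroˡ _) (trans (*-congˡ (wedge-zeroʳ s v (λ j → reflexive (lookup-++ˡ {m = binom n s} (λ _ → 0#) ω j)) i)) (zeroʳ ν)))
                      (+-identityˡ 0#)))
    (wedge-cong {n} (suc s) (λ _ → refl) (λ j → reflexive (≡.sym (lookup-++ʳ {m = binom n s} (λ _ → 0#) ω j))))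

  wedge-δ-shift : ∀ {n} s (ω : Fin (binom n s) → Carrier) i →
    wedge s (δ zero) (shift s ω) i ≈ (ω ++ (λ (_ : Fin (binom n (suc s))) → 0#)) i
  wedge-δ-shift {n} zero ω = ++-cong {1} (λ i → *-identityˡ (ω i)) (wedge-zeroˡ {n} zero ω (λ _ → refl))
  wedge-δ-shift {n} (suc s) ω = ++-cong
    (λ i → trans (+-cong (trans (*-identityˡ _) (reflexive (lookup-++ʳ {m = binom n s} (λ _ → 0#) ω i)))
                         (trans (*-congˡ (wedge-zeroˡ {n} s _ (λ _ → refl) i)) (zeroʳ ν)))
                 (+-identityʳ _))
    (wedge-zeroˡ {n} (suc s) _ (λ _ → refl))

  δ-↑ˡ : ∀ {m n} (i : Fin m) k → (δ i ++ (λ (_ : Fin n) → 0#)) k ≈ δ (i ↑ˡ n) k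
  δ-↑ˡ {m} {n} i = +-elim m (λ k → (δ i ++ (λ (_ : Fin n) → 0#)) k ≈ δ (i ↑ˡ n) k)
    (λ j → trans (reflexive (lookup-++ˡ (δ i) (λ (_ : Fin n) → 0#) j))
      (𝟙-⇔ (i Fin.≟ j) (i ↑ˡ n Fin.≟ j ↑ˡ n) (≡.cong (_↑ˡ n)) (Fin.↑ˡ-injective n i j)))
    (λ j → trans (reflexive (lookup-++ʳ (δ i) (λ (_ : Fin n) → 0#) j))
      (sym (𝟙-no (i ↑ˡ n Fin.≟ m ↑ʳ j) λ e →
        contradiction (≡.trans (≡.sym (Fin.splitAt-↑ˡ m i n)) (≡.trans (≡.cong (splitAt m) e) (Fin.splitAt-↑ʳ m n j))) λ ())))

  δ-↑ʳ : ∀ {m n} (i : Fin n) k → ((λ (_ : Fin m) → 0#) ++ δ i) k ≈ δ (m ↑ʳ i) k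
  δ-↑ʳ {m} {n} i = +-elim m (λ k → ((λ (_ : Fin m) → 0#) ++ δ i) k ≈ δ (m ↑ʳ i) k)
    (λ j → trans (reflexive (lookup-++ˡ (λ (_ : Fin m) → 0#) (δ i) j))
      (sym (𝟙-no (m ↑ʳ i Fin.≟ j ↑ˡ n) λ e →
        contradiction (≡.trans (≡.sym (Fin.splitAt-↑ˡ m j n)) (≡.trans (≡.cong (splitAt m) (≡.sym e)) (Fin.splitAt-↑ʳ m n i))) λ ())))
    (λ j → trans (reflexive (lookup-++ʳ (λ (_ : Fin m) → 0#) (δ i) j))
      (𝟙-⇔ (i Fin.≟ j) (m ↑ʳ i Fin.≟ m ↑ʳ j) (≡.cong (m ↑ʳ_)) (Fin.↑ʳ-injective m i j)))

  shift-cong : ∀ {n} s {ω η : Fin (binom n s) → Carrier} → (∀ i → ω i ≈ η i) → ∀ i → shift {n} s ω i ≈ shift {n} s η i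
  shift-cong zero    e = e
  shift-cong (suc s) e = ++-cong (λ _ → refl) e

  -- Induction on `n`: blades without the first basis vector are the images under `shift` of the
  -- blades one dimension lower, and the others are obtained from such images by one product with
  -- the first basis vector.
  standard-blades : ∀ n s i j → Standard.blades n δ s i j ≈ δ i j
  standard-blades n zero zero zero = refl
  standard-blades (suc n) (suc s) = +-elim (binom n s) (λ k → ∀ j → Standard.blades (suc n) δ (suc s) k j ≈ δ k j)
    (λ i j → trans (reflexive (≡.cong (λ ω → ω j) (lookup-++ˡ (λ i → wedge s (δ zero) (Standard.blades (suc n) (δ ∘ suc) s i)) _ i)))
      (trans (wedge-cong s (λ _ → refl) (shifted s i) j) (trans (wedge-δ-shift s (δ i) j) (δ-↑ˡ i j))))
    (λ i j → trans (reflexive (≡.cong (λ ω → ω j) (lookup-++ʳ (λ i → wedge s (δ zero) (Standard.blades (suc n) (δ ∘ suc) s i)) _ i)))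
      (trans (shifted (suc s) i j) (δ-↑ʳ i j)))
    where
    shifted : ∀ s i j → Standard.blades (suc n) (δ ∘ suc) s i j ≈ shift {n} s (δ i) j
    shifted s i j = trans
      (sym (blades-homo (standard n) (standard (suc n)) (0# ∷_) (shift {n}) (shift-cong {n}) (λ _ → refl) wedge-shift
        δ (δ ∘ suc) (λ i → λ { zero → refl ; (suc j) → 𝟙-⇔ (i Fin.≟ j) (suc i Fin.≟ suc j) (≡.cong suc) Fin.suc-injective }) s i j))
      (shift-cong {n} s (standard-blades n s i) j)

  -- The product of the weights of the vectors in a blade, enumerated in the order of `blades`.
  bladeWeight : ∀ {n} s → (Fin n → Carrier) → Fin (binom n s) → Carrier
  bladeWeight zero    x _ = 1#
  bladeWeight {zero}  (suc s) x ()
  bladeWeight {suc n} (suc s) x = (λ i → x zero * bladeWeight s (x ∘ suc) i) ++ bladeWeight (suc s) (x ∘ suc)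

  ∑-bladeWeight : ∀ {n} s (x : Fin n → Carrier) → ∑ (bladeWeight s x) ≈ esym s x
  ∑-bladeWeight zero x = +-identityʳ 1#
  ∑-bladeWeight {zero}  (suc s) x = refl
  ∑-bladeWeight {suc n} (suc s) x = trans (MonoidSums.sum-split +-commutativeMonoid (binom n s) _) (+-cong
    (trans (∑.sum-cong-≋ {binom n s} λ i → reflexive (lookup-++ˡ top bot i))
      (trans (sym (∑.*-distribˡ-sum {binom n s} (x zero) _)) (*-congˡ (∑-bladeWeight s (x ∘ suc)))))
    (trans (∑.sum-cong-≋ {binom n (suc s)} λ j → reflexive (lookup-++ʳ top bot j)) (∑-bladeWeight (suc s) (x ∘ suc))))
    where
    top = λ i → x zero * bladeWeight s (x ∘ suc) i
    bot = bladeWeight (suc s) (x ∘ suc)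

  -- Presented exterior powers as an exterior algebra

  module _ {G : Group a a} (V : Rep G) where
    private
      module V = Rep V

      prefix : ∀ s → V.Carrierᴹ → Term (Fin s → V.Carrierᴹ) → Term (Fin (suc s) → V.Carrierᴹ)
      prefix s u = Eval.eval {R = ExteriorRel s V} (Rep.space (Λ (suc s) V)) (λ v → gen (u ∷ v))

      module _ {s : ℕ} where
        open Presented (ExteriorRel (suc s) V) public
        open Combination (Rep.space (Λ (suc s) V)) public using (interchange; *ₗ-comm)

      prefix-resp : ∀ s u {t t′} → ExteriorRel s V t t′ → prefix s u t ∼ prefix s u t′
      prefix-resp s u (∧-cong e) = relation (∧-cong λ { zero → V.≈ᴹ-refl ; (suc i) → e i })
      prefix-resp s u (additive j e e₁ e₂) = relation (additive (suc j) e
        (λ { zero ne → V.≈ᴹ-refl ; (suc i) ne → e₁ i (ne ∘ ≡.cong suc) })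
        (λ { zero ne → V.≈ᴹ-refl ; (suc i) ne → e₂ i (ne ∘ ≡.cong suc) }))
      prefix-resp s u (homogeneous j r e e₁) = relation (homogeneous (suc j) r e
        (λ { zero ne → V.≈ᴹ-refl ; (suc i) ne → e₁ i (ne ∘ ≡.cong suc) }))
      prefix-resp s u (alternating {i} {j} ne e) = relation (alternating {i = suc i} {suc j} (ne ∘ Fin.suc-injective) e)

      prefix-linear : ∀ s u → Linear (Rep.space (Λ s V)) (Rep.space (Λ (suc s) V)) (prefix s u)
      prefix-linear s u = Eval.eval-linear {R = ExteriorRel s V} (Rep.space (Λ (suc s) V)) (λ v → gen (u ∷ v)) (prefix-resp s u)

      prefix-cong : ∀ s t {u v} → u V.≈ᴹ v → prefix s u t ∼ prefix s v t
      prefix-cong s t e = linear-ext (Rep.space (Λ (suc s) V)) (prefix-linear s _) (prefix-linear s _)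
        (λ w → relation (∧-cong λ { zero → e ; (suc i) → V.≈ᴹ-refl })) t

      prefix-+ : ∀ s t u v → prefix s (u V.+ᴹ v) t ∼ prefix s u t ⊕ prefix s v t
      prefix-+ s t u v = linear-ext (Rep.space (Λ (suc s) V)) (prefix-linear s _)
        (record { cong = λ e → ⊕-cong (U.cong e) (U′.cong e)
                ; +-homo = λ t t′ → interchange (prefix s u t) (prefix s u t′) (prefix s v t) (prefix s v t′)
                ; *-homo = λ r t → ∼-sym (⊙-distˡ r (prefix s u t) (prefix s v t)) })
        (λ w → relation (additive zero V.≈ᴹ-refl
          (λ { zero ne → contradiction ≡.refl ne ; (suc i) ne → V.≈ᴹ-refl })
          (λ { zero ne → contradiction ≡.refl ne ; (suc i) ne → V.≈ᴹ-refl }))) t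
        where
        module U = Linear (prefix-linear s u)
        module U′ = Linear (prefix-linear s v)

      prefix-* : ∀ s t r u → prefix s (r V.*ₗ u) t ∼ r ⊙ prefix s u t
      prefix-* s t r u = linear-ext (Rep.space (Λ (suc s) V)) (prefix-linear s _)
        (record { cong = λ e → ⊙-cong refl (Linear.cong (prefix-linear s u) e)
                ; +-homo = λ t t′ → ⊙-distˡ r (prefix s u t) (prefix s u t′)
                ; *-homo = λ r′ t → *ₗ-comm r r′ (prefix s u t) })
        (λ w → relation (homogeneous zero r V.≈ᴹ-refl
          (λ { zero ne → contradiction ≡.refl ne ; (suc i) ne → V.≈ᴹ-refl }))) t

      prefix-square : ∀ s u t → prefix (suc s) u (prefix s u t) ∼ 𝟘
      prefix-square s u t = linear-ext (Rep.space (Λ (suc (suc s)) V))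
        (∘-Linear (Rep.space (Λ s V)) (Rep.space (Λ (suc s) V)) (Rep.space (Λ (suc (suc s)) V)) (prefix-linear (suc s) u) (prefix-linear s u))
        (record { cong = λ _ → ∼-refl ; +-homo = λ _ _ → ∼-sym (⊕-idˡ 𝟘)
                ; *-homo = λ r t → ∼-sym (LeftModule.*ₗ-zeroʳ (Rep.space (Λ (suc (suc s)) V)) r) })
        (λ w → relation (alternating {i = zero} {suc zero} (λ ()) V.≈ᴹ-refl)) t

    Λ-algebra : ExteriorAlgebra V.space
    Λ-algebra = record
      { degree = λ s → Rep.space (Λ s V)
      ; one = gen (λ ())
      ; mul = prefix
      ; mul-linˡ = λ s t → record { cong = prefix-cong s t ; +-homo = prefix-+ s t ; *-homo = prefix-* s t }
      ; mul-linʳ = prefix-linear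
      ; mul-square = prefix-square
      }

  -- Eigenbases of exterior powers

  module _ {G : Group a a} {V : Rep G} {g t} (B : Eigenbasis V g t) where
    private
      module V = Rep V
      module B = Eigenbasis B
      module A = ExteriorAlgebra (Λ-algebra V)
      n = B.dim
      module S = Standard n

      coords : ∀ s → (Fin s → V.Carrierᴹ) → Fin (binom n s) → Carrier
      coords zero    v _ = 1#
      coords (suc s) v = wedge s (B.coordinates (v zero)) (coords s (v ∘ suc))

      coords-cong : ∀ s {u v : Fin s → V.Carrierᴹ} → (∀ i → u i V.≈ᴹ v i) → ∀ k → coords s u k ≈ coords s v k
      coords-cong zero    e k = refl
      coords-cong (suc s) e k = wedge-cong {n} s (B.coordinates-cong (e zero)) (coords-cong s (e ∘ suc)) k

      coords-additive : ∀ s j {u v w : Fin s → V.Carrierᴹ} → u j V.≈ᴹ v j V.+ᴹ w j →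
        (∀ i → i ≢ j → u i V.≈ᴹ v i) → (∀ i → i ≢ j → u i V.≈ᴹ w i) → ∀ k → coords s u k ≈ coords s v k + coords s w k
      coords-additive (suc s) zero {u} {v} {w} e e₁ e₂ k = begin
        wedge s (B.coordinates (u zero)) (coords s (u ∘ suc)) k
          ≈⟨ wedge-cong {n} s (λ i → trans (B.coordinates-cong e i) (Linear.+-homo B.linear (v zero) (w zero) i)) (λ _ → refl) k ⟩
        wedge s (λ i → B.coordinates (v zero) i + B.coordinates (w zero) i) (coords s (u ∘ suc)) k
          ≈⟨ wedge-+ˡ {n} s _ _ _ k ⟩
        wedge s (B.coordinates (v zero)) (coords s (u ∘ suc)) k + wedge s (B.coordinates (w zero)) (coords s (u ∘ suc)) k
          ≈⟨ +-cong (wedge-cong {n} s (λ _ → refl) (coords-cong s λ i → e₁ (suc i) λ ()) k)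
                    (wedge-cong {n} s (λ _ → refl) (coords-cong s λ i → e₂ (suc i) λ ()) k) ⟩
        coords (suc s) v k + coords (suc s) w k
          ∎
        where open import Relation.Binary.Reasoning.Setoid setoid
      coords-additive (suc s) (suc j) {u} {v} {w} e e₁ e₂ k = begin
        wedge s (B.coordinates (u zero)) (coords s (u ∘ suc)) k
          ≈⟨ wedge-cong {n} s (λ _ → refl) (coords-additive s j e
               (λ i ne → e₁ (suc i) (ne ∘ Fin.suc-injective)) (λ i ne → e₂ (suc i) (ne ∘ Fin.suc-injective))) k ⟩
        wedge s (B.coordinates (u zero)) (λ i → coords s (v ∘ suc) i + coords s (w ∘ suc) i) k
          ≈⟨ wedge-+ʳ {n} s _ _ _ k ⟩
        wedge s (B.coordinates (u zero)) (coords s (v ∘ suc)) k + wedge s (B.coordinates (u zero)) (coords s (w ∘ suc)) k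
          ≈⟨ +-cong (wedge-cong {n} s (B.coordinates-cong (e₁ zero λ ())) (λ _ → refl) k)
                    (wedge-cong {n} s (B.coordinates-cong (e₂ zero λ ())) (λ _ → refl) k) ⟩
        coords (suc s) v k + coords (suc s) w k
          ∎
        where open import Relation.Binary.Reasoning.Setoid setoid

      coords-homogeneous : ∀ s j r {u v : Fin s → V.Carrierᴹ} → u j V.≈ᴹ r V.*ₗ v j →
        (∀ i → i ≢ j → u i V.≈ᴹ v i) → ∀ k → coords s u k ≈ r * coords s v k
      coords-homogeneous (suc s) zero r {u} {v} e e₁ k = trans
        (wedge-cong {n} s (λ i → trans (B.coordinates-cong e i) (B.coordinates-* r (v zero) i)) (coords-cong s λ i → e₁ (suc i) λ ()) k)
        (wedge-*ˡ {n} s _ r _ k)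
      coords-homogeneous (suc s) (suc j) r {u} {v} e e₁ k = trans
        (wedge-cong {n} s (B.coordinates-cong (e₁ zero λ ()))
          (coords-homogeneous s j r e (λ i ne → e₁ (suc i) (ne ∘ Fin.suc-injective))) k)
        (wedge-*ʳ {n} s _ r _ k)

      -- Anticommuting moves `u` past the leading factors, at the cost of signs, until it stands
      -- beside the equal factor `v j`, where the square vanishes.
      absorb : ∀ s j {u} (v : Fin s → V.Carrierᴹ) → u V.≈ᴹ v j → ∀ k → wedge s (B.coordinates u) (coords s v) k ≈ 0#
      absorb (suc s) zero    v e k = trans (wedge-cong {n} (suc s) (B.coordinates-cong e) (λ _ → refl) k)
        (wedge-square {n} s (B.coordinates (v zero)) (coords s (v ∘ suc)) k)
      absorb (suc s) (suc j) {u} v e k = trans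
        (S.mul-anticommute s (B.coordinates u) (B.coordinates (v zero)) (coords s (v ∘ suc)) k)
        (trans (*-congˡ (wedge-zeroʳ {n} (suc s) (B.coordinates (v zero)) (absorb s j (v ∘ suc) e) k)) (zeroʳ ν))

      coords-alternating : ∀ s {i j} {v : Fin s → V.Carrierᴹ} → i ≢ j → v i V.≈ᴹ v j → ∀ k → coords s v k ≈ 0#
      coords-alternating (suc s) {zero}  {zero}  ne e k = contradiction ≡.refl ne
      coords-alternating (suc s) {zero}  {suc j} ne e k = absorb s j _ e k
      coords-alternating (suc s) {suc i} {zero}  ne e k = absorb s i _ (V.≈ᴹ-sym e) k
      coords-alternating (suc s) {suc i} {suc j} ne e k =
        wedge-zeroʳ {n} s _ (coords-alternating s (ne ∘ ≡.cong suc) e) k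

      open module Coordinates s = Eval {R = ExteriorRel s V} (K^ (binom n s)) (coords s) using (eval; eval-linear)

      resp : ∀ s {t u} → ExteriorRel s V t u → ∀ k → eval s t k ≈ eval s u k
      resp s (∧-cong e)              = coords-cong s e
      resp s (additive j e e₁ e₂)    = coords-additive s j e e₁ e₂
      resp s (homogeneous j r e e₁)  = coords-homogeneous s j r e e₁
      resp s (alternating ne e)      = coords-alternating s ne e

      lin : ∀ s → Linear (A.degree s) (K^ (binom n s)) (eval s)
      lin s = eval-linear s (resp s)

      eval-mul : ∀ s u t k → eval (suc s) (A.mul s u t) k ≈ wedge s (B.coordinates u) (eval s t) k
      eval-mul s u = linear-ext {R = ExteriorRel s V} (K^ (binom n (suc s)))
        (∘-Linear (A.degree s) (A.degree (suc s)) (K^ (binom n (suc s))) (lin (suc s)) (A.mul-linʳ s u))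
        (∘-Linear (A.degree s) (K^ (binom n s)) (K^ (binom n (suc s))) (S.mul-linʳ s (B.coordinates u)) (lin s))
        (λ v k → refl)

      expand : ∀ s v → A.E._≈ᴹ_ s (combination (A.degree s) (coords s v) (A.blades B.basis s)) (gen v)
      expand zero v = E.≈ᴹ-trans (E.≈ᴹ-trans (E.+ᴹ-identityʳ _) (E.*ₗ-identityˡ _)) (Presented.relation (∧-cong λ ()))
        where module E = LeftModule (A.degree 0)
      expand (suc s) v = begin
        combination (A.degree (suc s)) (coords (suc s) v) (A.blades B.basis (suc s))
          ≈⟨ A.mul-combination B.basis s (B.coordinates (v zero)) (coords s (v ∘ suc)) ⟨
        A.mul s (combination V.space (B.coordinates (v zero)) B.basis) (combination (A.degree s) (coords s (v ∘ suc)) (A.blades B.basis s))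
          ≈⟨ Linear.cong (A.mul-linˡ s (combination (A.degree s) (coords s (v ∘ suc)) (A.blades B.basis s))) (B.expansion (v zero)) ⟩
        A.mul s (v zero) (combination (A.degree s) (coords s (v ∘ suc)) (A.blades B.basis s))
          ≈⟨ Linear.cong (A.mul-linʳ s (v zero)) (expand s (v ∘ suc)) ⟩
        gen (v zero ∷ v ∘ suc)
          ≈⟨ Presented.relation (∧-cong λ { zero → V.≈ᴹ-refl ; (suc i) → V.≈ᴹ-refl }) ⟩
        gen v
          ∎
        where open import Relation.Binary.Reasoning.Setoid (LeftModule.≈ᴹ-setoid (A.degree (suc s)))

      act-linear : ∀ s → Linear (A.degree s) (A.degree s) (Rep.act (Λ s V) g)
      act-linear s = IsLinear⇒Linear (A.degree s) (A.degree s) (Rep.act-linear (Λ s V) g)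

      act-mul : ∀ s u t → A.E._≈ᴹ_ (suc s) (Rep.act (Λ (suc s) V) g (A.mul s u t)) (A.mul s (V.act g u) (Rep.act (Λ s V) g t))
      act-mul s u = linear-ext {R = ExteriorRel s V} (A.degree (suc s))
        (∘-Linear (A.degree s) (A.degree (suc s)) (A.degree (suc s)) (act-linear (suc s)) (A.mul-linʳ s u))
        (∘-Linear (A.degree s) (A.degree s) (A.degree (suc s)) (A.mul-linʳ s (V.act g u)) (act-linear s))
        (λ v → Presented.relation (∧-cong λ { zero → V.≈ᴹ-refl ; (suc i) → V.≈ᴹ-refl }))

      act-blades : ∀ {m} (b : Fin m → V.Carrierᴹ) (x : Fin m → Carrier) → (∀ i → V.act g (b i) V.≈ᴹ x i V.*ₗ b i) →
        ∀ s i → A.E._≈ᴹ_ s (Rep.act (Λ s V) g (A.blades b s i)) (A.E._*ₗ_ s (bladeWeight s x i) (A.blades b s i))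
      act-blades b x e zero i = E.≈ᴹ-trans (Presented.relation (∧-cong λ ())) (E.≈ᴹ-sym (E.*ₗ-identityˡ _))
        where module E = LeftModule (A.degree 0)
      act-blades {zero}  b x e (suc s) ()
      act-blades {suc m} b x e (suc s) k with splitAt (binom m s) k
      ... | inj₂ j = act-blades (b ∘ suc) (x ∘ suc) (e ∘ suc) (suc s) j
      ... | inj₁ i = begin
        Rep.act (Λ (suc s) V) g (A.mul s (b zero) w)
          ≈⟨ act-mul s (b zero) w ⟩
        A.mul s (V.act g (b zero)) (Rep.act (Λ s V) g w)
          ≈⟨ Linear.cong (A.mul-linˡ s (Rep.act (Λ s V) g w)) (e zero) ⟩
        A.mul s (x zero V.*ₗ b zero) (Rep.act (Λ s V) g w)
          ≈⟨ Linear.cong (A.mul-linʳ s (x zero V.*ₗ b zero)) (act-blades (b ∘ suc) (x ∘ suc) (e ∘ suc) s i) ⟩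
        A.mul s (x zero V.*ₗ b zero) (A.E._*ₗ_ s y w)
          ≈⟨ Linear.*-homo (A.mul-linˡ s (A.E._*ₗ_ s y w)) (x zero) (b zero) ⟩
        x zero E.*ₗ A.mul s (b zero) (A.E._*ₗ_ s y w)
          ≈⟨ E.*ₗ-cong refl (Linear.*-homo (A.mul-linʳ s (b zero)) y w) ⟩
        x zero E.*ₗ y E.*ₗ A.mul s (b zero) w
          ≈⟨ E.*ₗ-assoc (x zero) y _ ⟨
        (x zero * y) E.*ₗ A.mul s (b zero) w
          ∎
        where
        w = A.blades (b ∘ suc) s i
        y = bladeWeight s (x ∘ suc) i
        module E = LeftModule (A.degree (suc s))
        open import Relation.Binary.Reasoning.Setoid E.≈ᴹ-setoid

    Λ-eigenbasis : ∀ s → Eigenbasis (Λ s V) g (esym s (Eigenbasis.eigenvalue B))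
    Λ-eigenbasis s = record
      { basis = A.blades B.basis s
      ; coordinates = eval s
      ; linear = lin s
      -- Independence: `eval` respects products, so it carries the blades of the given basis to
      -- those of the standard basis, which are the coordinate vectors.
      ; dual = λ i j → trans
          (blades-homo (Λ-algebra V) (standard n) B.coordinates eval (λ s → Linear.cong (lin s)) (λ _ → refl) eval-mul
            B.basis δ B.dual s i j)
          (standard-blades n s i j)
      ; expansion = linear-ext {R = ExteriorRel s V} (A.degree s)
          (∘-Linear (A.degree s) (K^ (binom n s)) (A.degree s)
            (Combination.combination-linear (A.degree s) (A.blades B.basis s)) (lin s))
          (record { cong = λ e → e ; +-homo = λ _ _ → A.E.≈ᴹ-refl s ; *-homo = λ _ _ → A.E.≈ᴹ-refl s })
          (expand s)
      ; eigenvalue = bladeWeight s B.eigenvalue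
      ; eigenvector = act-blades B.basis B.eigenvalue B.eigenvector s
      ; trace = ∑-bladeWeight s B.eigenvalue
      }

-- Characters and the formula

open import Data.Integer.Base as ℤ using (+_; -1ℤ; 1ℤ)
import Data.Integer.Properties as ℤ
open import Data.Nat.Base using (_^_; _*_; _≤_)
open import Data.Nat.Solver using (module +-*-Solver)
open import Data.Product.Base using (_×_)

module Character {a} (K : CommutativeRing a a) {k : ℕ} (n : Fin k → ℕ) where
  open CommutativeRing K hiding (zero) renaming (_*_ to _*ᴷ_)
  open Sums K
  open ElementarySymmetric K using (esym)
  open Eigenbases K
  open ExteriorPowers K using (Λ-eigenbasis)
  open Characters K
  open GLProduct n
  open import Algebra.Properties.Semiring.Exp semiring using () renaming (_^_ to _^ᴷ_)
  open RingProperties ring using (-0#≈0#; -‿+-comm)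

  torus : Torus → ∀ i → GL (n i)
  torus x i = diag (x i)

  V-eigenbasis : ∀ x i → Eigenbasis (V i) (torus x) (∑ (values x i))
  V-eigenbasis x i = record
    { basis = δ
    ; coordinates = λ v → v
    ; linear = record { cong = λ e → e ; +-homo = λ _ _ _ → refl ; *-homo = λ _ _ _ → refl }
    ; dual = λ _ _ → refl
    ; expansion = λ v j → trans (combination-K^ v δ j) (trans
        (∑.sum-cong-≋ {n i} λ l → trans (*-comm _ _) (*-congʳ (𝟙-⇔ (l Fin.≟ j) (j Fin.≟ l) ≡.sym ≡.sym)))
        (∑-𝟙 v j))
    ; eigenvalue = values x i
    ; eigenvector = λ l j → scale l j
    ; trace = refl
    }
    where
    scale : ∀ l j → values x i j *ᴷ δ l j ≈ values x i l *ᴷ δ l j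
    scale l j = trans (*-comm _ _) (trans (𝟙-guard (l Fin.≟ j) λ e → reflexive (≡.cong (values x i) (≡.sym e))) (*-comm _ _))

  summand : ℕ → Rep G
  summand M = ⨂ (λ i → (V i ^⊗ (n (prev i) ∸ M)) ⊗ Λ M (V i))

  summandCharacter : ℕ → Torus → Carrier
  summandCharacter M x = ∏ (λ i → ∑ (values x i) ^ᴷ (n (prev i) ∸ M) *ᴷ esym M (values x i))

  summand-isCharacter : ∀ M → IsCharacter (summand M) (summandCharacter M)
  summand-isCharacter M x = Eigenbasis.isTrace (⨂-eigenbasis λ i →
    ⊗-eigenbasis (^⊗-eigenbasis (n (prev i) ∸ M) (V-eigenbasis x i)) (Λ-eigenbasis (V-eigenbasis x i) M))

  ×ℕ-neg : ∀ m y → m ×ℕ (- y) ≈ - (m ×ℕ y)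
  ×ℕ-neg zero    y = sym -0#≈0#
  ×ℕ-neg (suc m) y = trans (+-congˡ (×ℕ-neg m y)) (-‿+-comm y (m ×ℕ y))

  ×ℤ-neg : ∀ m y → (-1ℤ ℤ.* (+ m ℤ.* 1ℤ)) ×ℤ y ≈ - (m ×ℕ y)
  ×ℤ-neg m y rewrite ℤ.*-identityʳ (+ m) | ℤ.-1*i≡-i (+ m) = neg m
    where
    neg : ∀ m → (ℤ.- (+ m)) ×ℤ y ≈ - (m ×ℕ y)
    neg zero    = sym -0#≈0#
    neg (suc m) = refl

-- With N = `suc m`, each of the `k` lifted sequences gives one factor N + 1 because (N + 1)! = (N +
-- 1) N!, and the vertex chosen outside the cycle gives the last one.
coefficient : ∀ k m → ((suc (suc m)) !) ^ k * (m ! * suc (suc m)) ≡ ((suc m) !) ^ k * m ! * suc (suc m) ^ suc k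
coefficient k m = begin
  (s * f) ^ k * (m ! * s)      ≡⟨ ≡.cong (_* (m ! * s)) (*-^ k) ⟩
  s ^ k * f ^ k * (m ! * s)    ≡⟨ solve 4 (λ a b c d → a :* b :* (c :* d) := b :* c :* (d :* a)) ≡.refl (s ^ k) (f ^ k) (m !) s ⟩
  f ^ k * m ! * s ^ suc k      ∎
  where
  open ≡.≡-Reasoning
  open +-*-Solver
  s = suc (suc m)
  f = suc m !
  *-^ : ∀ k → (s * f) ^ k ≡ s ^ k * f ^ k
  *-^ zero    = ≡.refl
  *-^ (suc k) = ≡.trans (≡.cong (s * f *_) (*-^ k))
    (solve 4 (λ a b c d → a :* b :* (c :* d) := a :* c :* (b :* d)) ≡.refl s f (s ^ k) (f ^ k))

corollary4p5 : ∀ {a} (K : CommutativeRing a a) →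
    (k N : ℕ) .{{_ : NonZero k}} .{{_ : NonZero N}} →
    (n : Fin k → ℕ) → (∀ i → 2 ≤ n i) →
    let open CommutativeRing K using (Carrier)
        open CommutativeRing K using (_≈_)
        open Characters K
        open GLProduct n
    in
    ∃ λ (χ : Torus → Carrier) →
      HasCharacter
        ([ ⨂ (λ i → (V i ^⊗ (n (prev i) ∸ N)) ⊗ Λ N (V i)) ]
          ⊖ + (suc N ^ k) · [ ⨂ (λ i → (V i ^⊗ (n (prev i) ∸ suc N)) ⊗ Λ (suc N) (V i)) ])
        χ
      × (∀ x → P N (values x) ≈ ((N !) ^ (k ∸ 1) * (N ∸ 1) !) ×ℕ χ x)
corollary4p5 K zero    N {{()}}
corollary4p5 K (suc k) zero {{_}} {{()}}
corollary4p5 K (suc k) (suc m) n _ = χ ,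
  (χ₁ , (λ x → z ×ℤ χ₂ x + 0#) , summand-isCharacter (suc m) ,
    (χ₂ , (λ _ → 0#) , summand-isCharacter (suc (suc m)) , (λ _ → refl) , λ _ → refl) ,
    λ _ → refl) ,
  formula
  where
  open CommutativeRing K hiding (zero; _*_)
  open Characters K
  open GLProduct n
  open Character K n
  open Counting K using (P-formula)
  open import Algebra.Properties.CommutativeMonoid.Mult +-commutativeMonoid using (×-congˡ; ×-congʳ; ×-assocˡ; ×-distrib-+)
  open import Relation.Binary.Reasoning.Setoid setoid

  N = suc m
  s = suc N ^ suc k
  c = (N !) ^ k * m !
  z = -1ℤ ℤ.* (+ s ℤ.* 1ℤ)
  χ₁ = summandCharacter N
  χ₂ = summandCharacter (suc N)

  χ : Torus → Carrier
  χ x = 1ℤ ×ℤ χ₁ x + (z ×ℤ χ₂ x + 0#)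

  formula : ∀ x → P N (values x) ≈ c ×ℕ χ x
  formula x = begin
    p                                             ≈⟨ +-identityʳ p ⟨
    -- `P-formula` has the negative term on the side of `p`; adding and subtracting it brings it to
    -- the other side.
    p + 0#                                        ≈⟨ +-congˡ (-‿inverseʳ ((c * s) ×ℕ χ₂ x)) ⟨
    p + ((c * s) ×ℕ χ₂ x - (c * s) ×ℕ χ₂ x)       ≈⟨ +-assoc p _ _ ⟨
    p + (c * s) ×ℕ χ₂ x - (c * s) ×ℕ χ₂ x         ≈⟨ +-congʳ (trans (+-congˡ (×-congˡ (≡.sym (coefficient k m)))) (P-formula (values x) m)) ⟩
    c ×ℕ χ₁ x - (c * s) ×ℕ χ₂ x                   ≈⟨ +-cong (×-congʳ c (+-identityʳ _)) (trans (×ℕ-neg c (s ×ℕ χ₂ x)) (-‿cong (×-assocˡ (χ₂ x) c s))) ⟨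
    c ×ℕ (1ℤ ×ℤ χ₁ x) + c ×ℕ (- (s ×ℕ χ₂ x))      ≈⟨ +-congˡ (×-congʳ c (trans (+-identityʳ _) (×ℤ-neg s (χ₂ x)))) ⟨
    c ×ℕ (1ℤ ×ℤ χ₁ x) + c ×ℕ (z ×ℤ χ₂ x + 0#)     ≈⟨ ×-distrib-+ _ _ c ⟨
    c ×ℕ χ x                                      ∎
    where
    p = P N (values x)
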